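{- The group $\Gamma^{(2)} = \text{GU}_2(D)\cap U_2$ consists of the following set of matrices: \[\Gamma^{(2)} =\text{SU}_{2}(D)\cap g^{ -1}\text{GL}_2(\mathcal{O})g.\]
   Context: $D$ is a definite quaternion algebra over $\mathbb{Q}$ ramified exactly at $\{p,\infty\}$ for a fixed prime $p$, with standard involution $x\mapsto\overline{x}$, and $\mathcal{O}$ is a fixed maximal order. $\text{GU}_2(D) = \{g\in M_2(D)\,|\,g\overline{g}^T = \mu(g)I,\ \mu(g)\in\mathbb{Q}^\times\}$ is the unitary similitude group, and $\text{SU}_2(D)$ denotes its elements with similitude $\mu=1$. Fix $g\in\text{GL}_2(D)$ such that the left $\mathcal{O}$-lattice $\mathcal{O}^2 g\subseteq D^2$ lies in the non-principal genus (i.e. its completion at $p$ is not locally equivalent to $\mathcal{O}_p^2$). Let $U_2 = \text{Stab}_{\text{GU}_2(D_{\mathbb{A}_f})}(\mathcal{O}^2 g)$ be the corresponding open compact subgroup of $\text{GU}_2(D_{\mathbb{A}_f})$, and $\Gamma^{(2)} = \text{GU}_2(D)\cap U_2$, i.e. $\Gamma^{(2)} = \text{Stab}_{\text{GU}_2(D)}(\mathcal{O}^2 g)$. -}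

module Defs where

open import Algebra.Bundles.Raw using (RawMonoid; RawRing)
import Algebra.Definitions
open import Algebra.Definitions.RawMonoid using (sum)
open import Data.Fin.Base using (Fin; zero; suc)
open import Data.Integer.Base as ℤ using (ℤ; +_; 0ℤ; 1ℤ)
open import Data.Integer.Divisibility.Signed using (_∣_; divides; ∣m∣n⇒∣m+n; ∣m⇒∣m*n; ∣n⇒∣m*n; ∣m⇒∣-m)
import Data.Integer.Properties as ℤ
open import Data.Integer.Tactic.RingSolver using (solve-∀)
open import Data.Nat.Base as ℕ using (ℕ; suc; _^_; _!)
import Data.Nat.Properties as ℕ
open import Data.Nat.Primality using (Prime)
open import Data.Product.Base using (Σ; ∃; ∃-syntax; _×_; _,_; proj₁; proj₂)
open import Data.Rational.Base as ℚ using (ℚ; 0ℚ; 1ℚ; ½; ↥_; ↧ₙ_; _/_)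
import Data.Rational.Properties as ℚ
import Data.Rational.Solver as ℚ-Solver
open import Data.Sum.Base using (_⊎_)
open import Data.Vec.Functional using (Vector)
open import Function.Base using (id)
open import Function.Bundles using (_⇔_)
open import Level using (0ℓ)
open import Relation.Binary.PropositionalEquality using (_≡_; _≢_; refl; sym; trans; cong; cong₂; subst; subst₂)
open import Relation.Nullary.Negation using (¬_)
open import Relation.Unary using (Pred; _∈_; _⊆_; _≐_)

Invertible : (R : RawRing 0ℓ 0ℓ) → Pred (RawRing.Carrier R) 0ℓ
Invertible R = Algebra.Definitions.Invertible _≈_ 1# _*_
  where open RawRing R

-- The inverse is only asked to exist classically: demanding a witness would
-- already fail constructively for the fields ℝ and ℚ_ℓ, where x ≉ 0 does not
-- provide a bound from below on the size of x.
IsDivisionRing : RawRing 0ℓ 0ℓ → Set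
IsDivisionRing R = 1# ≉ 0# × (∀ x → x ≉ 0# → ¬ ¬ Invertible R x)
  where open RawRing R

-- All v = Σᵢ cᵢ • xᵢ (a finite sum) with xᵢ ∈ X.
module _ (M : RawMonoid 0ℓ 0ℓ) where

  open RawMonoid M

  Span : {C : Set} → (C → Carrier → Carrier) → Pred Carrier 0ℓ → Pred Carrier 0ℓ
  Span {C} _•_ X v = ∃[ k ] Σ (Vector C k) λ c → Σ (Vector Carrier k) λ x →
    (∀ i → x i ∈ X) × v ≈ sum M (λ i → c i • x i)

record Extension : Set₁ where
  field
    scalars : RawRing 0ℓ 0ℓ
    embed   : ℚ → RawRing.Carrier scalars

rationals : Extension
rationals = record { scalars = ℚ.+-*-rawRing ; embed = id }

-- The inverse limit of the rings ℤ / m n, for a sequence of moduli with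
-- m n ∣ m (suc n), and its localisation at the nonzero integers.

module Profinite (m : ℕ → ℕ) where

  record ℤ̂ : Set where
    field
      residue    : ℕ → ℤ
      compatible : ∀ n → + m n ∣ residue (suc n) ℤ.- residue n
  open ℤ̂ public

  infix 4 _≋_
  _≋_ : ℤ̂ → ℤ̂ → Set
  x ≋ y = ∀ n → + m n ∣ residue x n ℤ.- residue y n

  fromℤ : ℤ → ℤ̂
  fromℤ z = record
    { residue    = λ _ → z
    ; compatible = λ n → divides 0ℤ (ℤ.+-inverseʳ z)
    }

  infixl 6 _⊞_
  _⊞_ : ℤ̂ → ℤ̂ → ℤ̂
  x ⊞ y = record
    { residue    = λ n → residue x n ℤ.+ residue y n
    ; compatible = λ n → subst (+ m n ∣_)
        (eq (residue x (suc n)) (residue x n) (residue y (suc n)) (residue y n))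
        (∣m∣n⇒∣m+n (compatible x n) (compatible y n))
    }
    where
    eq : ∀ x′ x y′ y → (x′ ℤ.- x) ℤ.+ (y′ ℤ.- y) ≡ (x′ ℤ.+ y′) ℤ.- (x ℤ.+ y)
    eq = solve-∀

  infixl 7 _⊠_
  _⊠_ : ℤ̂ → ℤ̂ → ℤ̂
  x ⊠ y = record
    { residue    = λ n → residue x n ℤ.* residue y n
    ; compatible = λ n → subst (+ m n ∣_)
        (eq (residue x (suc n)) (residue x n) (residue y (suc n)) (residue y n))
        (∣m∣n⇒∣m+n (∣n⇒∣m*n (residue x (suc n)) (compatible y n))
                   (∣m⇒∣m*n (residue y n) (compatible x n)))
    }
    where
    eq : ∀ x′ x y′ y →
         x′ ℤ.* (y′ ℤ.- y) ℤ.+ (x′ ℤ.- x) ℤ.* y ≡ x′ ℤ.* y′ ℤ.- x ℤ.* y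
    eq = solve-∀

  ⊟_ : ℤ̂ → ℤ̂
  ⊟ x = record
    { residue    = λ n → ℤ.- residue x n
    ; compatible = λ n → subst (+ m n ∣_)
        (eq (residue x (suc n)) (residue x n)) (∣m⇒∣-m (compatible x n))
    }
    where
    eq : ∀ x′ x → ℤ.- (x′ ℤ.- x) ≡ ℤ.- x′ ℤ.- ℤ.- x
    eq = solve-∀

  record Fraction : Set where
    constructor _over_
    field
      numerator       : ℤ̂
      denominator     : ℕ
      .{{nonZero}}    : ℕ.NonZero denominator
  open Fraction public

  integral : ℤ̂ → Fraction
  integral z = z over 1

  fractions : RawRing 0ℓ 0ℓ
  fractions = record
    { Carrier = Fraction
    ; _≈_     = λ (x over d) (y over e) → x ⊠ fromℤ (+ e) ≋ y ⊠ fromℤ (+ d)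
    ; _+_     = λ (x over d) (y over e) →
        _over_ (x ⊠ fromℤ (+ e) ⊞ y ⊠ fromℤ (+ d)) (d ℕ.* e) {{ℕ.m*n≢0 d e}}
    ; _*_     = λ (x over d) (y over e) → _over_ (x ⊠ y) (d ℕ.* e) {{ℕ.m*n≢0 d e}}
    ; -_      = λ (x over d) → (⊟ x) over d
    ; 0#      = integral (fromℤ 0ℤ)
    ; 1#      = integral (fromℤ 1ℤ)
    }

  extension : Extension
  extension = record
    { scalars = fractions
    ; embed   = λ q → fromℤ (↥ q) over (↧ₙ q)
    }

-- ℤ_ℓ = lim ℤ/ℓⁿ inside ℚ_ℓ = ℤ_ℓ ⊗ ℚ.
module Adic (ℓ : ℕ) = Profinite (λ n → ℓ ^ n)

-- The factorials are cofinal for divisibility, so the limit of the ℤ/n! is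
-- the full profinite completion of ℤ; tensoring it with ℚ gives the finite
-- adeles.
module Adelic = Profinite (λ n → n !)

module Reals where

  open import Data.Rational.Base using (_+_; _*_; -_; _-_; ∣_∣; 1/_; _≤_; _<_; Positive; NonNegative)
  open ℚ-Solver.+-*-Solver using (solve; _:=_; _:+_; _:*_; :-_; con)

  IsCauchy : (ℕ → ℚ) → Set
  IsCauchy x = ∀ ε → 0ℚ < ε →
    ∃[ N ] ∀ i j → N ℕ.≤ i → N ℕ.≤ j → ∣ x i - x j ∣ ≤ ε

  record ℝ : Set where
    field
      approx   : ℕ → ℚ
      isCauchy : IsCauchy approx
  open ℝ public

  _≃_ : ℝ → ℝ → Set
  x ≃ y = ∀ ε → 0ℚ < ε → ∃[ N ] ∀ n → N ℕ.≤ n → ∣ approx x n - approx y n ∣ ≤ ε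

  private
    half-pos : ∀ {ε} → 0ℚ < ε → 0ℚ < ½ * ε
    half-pos {ε} 0<ε =
      ℚ.positive⁻¹ (½ * ε) {{ℚ.pos*pos⇒pos ½ ε {{ℚ.positive 0<ε}}}}

    half+half : ∀ ε → ½ * ε + ½ * ε ≡ ε
    half+half = solve 1 (λ ε → con ½ :* ε :+ con ½ :* ε := ε) refl

    *-mono-≤ : ∀ {p q r s} → NonNegative q → NonNegative r →
               p ≤ q → r ≤ s → p * r ≤ q * s
    *-mono-≤ {p} {q} {r} {s} q≥0 r≥0 p≤q r≤s = ℚ.≤-trans
      (ℚ.*-monoʳ-≤-nonNeg r {{r≥0}} p≤q) (ℚ.*-monoˡ-≤-nonNeg q {{q≥0}} r≤s)

    bounded : ∀ x → IsCauchy x →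
              ∃[ B ] 0ℚ < B × ∃[ N ] ∀ n → N ℕ.≤ n → ∣ x n ∣ ≤ B
    bounded x cx with cx 1ℚ (ℚ.positive⁻¹ 1ℚ)
    ... | N , close = ∣ x N ∣ + 1ℚ
                    , ℚ.+-mono-≤-< (ℚ.0≤∣p∣ (x N)) (ℚ.positive⁻¹ 1ℚ)
                    , N , λ n N≤n → subst (λ t → ∣ t ∣ ≤ ∣ x N ∣ + 1ℚ) (eq (x N) (x n))
                        (ℚ.≤-trans (ℚ.∣p+q∣≤∣p∣+∣q∣ (x N) (x n - x N))
                          (ℚ.+-monoʳ-≤ ∣ x N ∣ (close n N N≤n ℕ.≤-refl)))
      where
      eq : ∀ s t → s + (t - s) ≡ t
      eq = solve 2 (λ s t → s :+ (t :+ :- s) := t) refl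

  constant : ℚ → ℝ
  constant q = record
    { approx   = λ _ → q
    ; isCauchy = λ ε 0<ε → 0 , λ i j _ _ →
        subst (_≤ ε) (sym (cong ∣_∣ (ℚ.+-inverseʳ q))) (ℚ.<⇒≤ 0<ε)
    }

  infixl 6 _⊞_
  _⊞_ : ℝ → ℝ → ℝ
  x ⊞ y = record
    { approx   = λ n → approx x n + approx y n
    ; isCauchy = λ ε 0<ε →
        let (N , cx) = isCauchy x (½ * ε) (half-pos 0<ε)
            (M , cy) = isCauchy y (½ * ε) (half-pos 0<ε)
        in N ℕ.+ M , λ i j i≥ j≥ → subst₂ _≤_
          (cong ∣_∣ (eq (approx x i) (approx x j) (approx y i) (approx y j)))
          (half+half ε)
          (ℚ.≤-trans (ℚ.∣p+q∣≤∣p∣+∣q∣ (approx x i - approx x j) _)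
            (ℚ.+-mono-≤
              (cx i j (ℕ.m+n≤o⇒m≤o N i≥) (ℕ.m+n≤o⇒m≤o N j≥))
              (cy i j (ℕ.m+n≤o⇒n≤o N i≥) (ℕ.m+n≤o⇒n≤o N j≥))))
    }
    where
    eq : ∀ x x′ y y′ → (x - x′) + (y - y′) ≡ (x + y) - (x′ + y′)
    eq = solve 4 (λ x x′ y y′ → (x :+ :- x′) :+ (y :+ :- y′) := (x :+ y) :+ :- (x′ :+ y′)) refl

  ⊟_ : ℝ → ℝ
  ⊟ x = record
    { approx   = λ n → - approx x n
    ; isCauchy = λ ε 0<ε →
        let (N , cx) = isCauchy x ε 0<ε
        in N , λ i j i≥ j≥ → subst (_≤ ε)
          (trans (sym (ℚ.∣-p∣≡∣p∣ (approx x i - approx x j)))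
                 (cong ∣_∣ (eq (approx x i) (approx x j))))
          (cx i j i≥ j≥)
    }
    where
    eq : ∀ x x′ → - (x - x′) ≡ - x - - x′
    eq = solve 2 (λ x x′ → :- (x :+ :- x′) := :- x :+ :- (:- x′)) refl

  infixl 7 _⊠_
  _⊠_ : ℝ → ℝ → ℝ
  x ⊠ y = record
    { approx   = λ n → approx x n * approx y n
    ; isCauchy = cauchy (bounded (approx x) (isCauchy x)) (bounded (approx y) (isCauchy y))
    }
    where
    eq : ∀ x x′ y y′ → x * (y - y′) + (x - x′) * y′ ≡ x * y - x′ * y′
    eq = solve 4 (λ x x′ y y′ →
      x :* (y :+ :- y′) :+ (x :+ :- x′) :* y′ := x :* y :+ :- (x′ :* y′)) refl

    cauchy : (∃[ B ] 0ℚ < B × ∃[ N ] ∀ n → N ℕ.≤ n → ∣ approx x n ∣ ≤ B) →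
             (∃[ B ] 0ℚ < B × ∃[ N ] ∀ n → N ℕ.≤ n → ∣ approx y n ∣ ≤ B) →
             IsCauchy (λ n → approx x n * approx y n)
    cauchy (B , 0<B , N₁ , x≤B) (C , 0<C , N₂ , y≤C) ε 0<ε =
      N₁ ℕ.+ N₂ ℕ.+ (N₃ ℕ.+ N₄) , λ i j i≥ j≥ →
        subst₂ _≤_
          (cong ∣_∣ (eq (approx x i) (approx x j) (approx y i) (approx y j)))
          (trans (cong₂ _+_ (cancel B 0<B) (trans (ℚ.*-comm (δ C 0<C) C) (cancel C 0<C)))
                 (half+half ε))
          (ℚ.≤-trans
            (ℚ.∣p+q∣≤∣p∣+∣q∣ (approx x i * (approx y i - approx y j)) _)
            (ℚ.+-mono-≤
              (subst (_≤ B * δ B 0<B) (sym (ℚ.∣p*q∣≡∣p∣*∣q∣ (approx x i) _))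
                (*-mono-≤ (ℚ.nonNegative (ℚ.<⇒≤ 0<B)) (ℚ.∣-∣-nonNeg (approx y i - approx y j))
                  (x≤B i (ℕ.m+n≤o⇒m≤o N₁ (low i i≥)))
                  (cy i j (ℕ.m+n≤o⇒n≤o N₃ (high i i≥)) (ℕ.m+n≤o⇒n≤o N₃ (high j j≥)))))
              (subst (_≤ δ C 0<C * C) (sym (ℚ.∣p*q∣≡∣p∣*∣q∣ (approx x i - approx x j) _))
                (*-mono-≤ (ℚ.nonNegative (ℚ.<⇒≤ (δ-pos C 0<C))) (ℚ.∣-∣-nonNeg (approx y j))
                  (cx i j (ℕ.m+n≤o⇒m≤o N₃ (high i i≥)) (ℕ.m+n≤o⇒m≤o N₃ (high j j≥)))
                  (y≤C j (ℕ.m+n≤o⇒n≤o N₁ (low j j≥)))))))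
      where
      inv : ∀ B → 0ℚ < B → ℚ
      inv B 0<B = (1/ B) {{ℚ.pos⇒nonZero B {{ℚ.positive 0<B}}}}

      δ : ∀ B → 0ℚ < B → ℚ
      δ B 0<B = inv B 0<B * (½ * ε)

      δ-pos : ∀ B (0<B : 0ℚ < B) → 0ℚ < δ B 0<B
      δ-pos B 0<B = ℚ.positive⁻¹ (δ B 0<B)
        {{ℚ.pos*pos⇒pos (inv B 0<B) {{ℚ.1/pos⇒pos B {{ℚ.positive 0<B}}}}
                        (½ * ε) {{ℚ.positive (half-pos 0<ε)}}}}

      cancel : ∀ B (0<B : 0ℚ < B) → B * δ B 0<B ≡ ½ * ε
      cancel B 0<B = trans (sym (ℚ.*-assoc B (inv B 0<B) (½ * ε)))
        (trans (cong (_* (½ * ε)) (ℚ.*-inverseʳ B {{ℚ.pos⇒nonZero B {{ℚ.positive 0<B}}}}))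
               (ℚ.*-identityˡ (½ * ε)))

      N₃ N₄ : ℕ
      N₃ = proj₁ (isCauchy x (δ C 0<C) (δ-pos C 0<C))
      N₄ = proj₁ (isCauchy y (δ B 0<B) (δ-pos B 0<B))
      cx = proj₂ (isCauchy x (δ C 0<C) (δ-pos C 0<C))
      cy = proj₂ (isCauchy y (δ B 0<B) (δ-pos B 0<B))

      low : ∀ i → N₁ ℕ.+ N₂ ℕ.+ (N₃ ℕ.+ N₄) ℕ.≤ i → N₁ ℕ.+ N₂ ℕ.≤ i
      low i = ℕ.m+n≤o⇒m≤o (N₁ ℕ.+ N₂)

      high : ∀ i → N₁ ℕ.+ N₂ ℕ.+ (N₃ ℕ.+ N₄) ℕ.≤ i → N₃ ℕ.+ N₄ ℕ.≤ i
      high i = ℕ.m+n≤o⇒n≤o (N₁ ℕ.+ N₂)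

  extension : Extension
  extension = record
    { scalars = record
      { Carrier = ℝ
      ; _≈_     = _≃_
      ; _+_     = _⊞_
      ; _*_     = _⊠_
      ; -_      = ⊟_
      ; 0#      = constant 0ℚ
      ; 1#      = constant 1ℚ
      }
    ; embed   = constant
    }

data Place : Set where
  finite   : (ℓ : ℕ) → .(Prime ℓ) → Place
  infinite : Place

completion : Place → Extension
completion (finite ℓ _) = Adic.extension ℓ
completion infinite     = Reals.extension

-- The algebra (a, b | ℚ) generated by i, j with i² = a, j² = b, ij = -ji.
record QuaternionAlgebra : Set where
  field
    a b : ℚ
    a≢0 : a ≢ 0ℚ
    b≢0 : b ≢ 0ℚ

module BaseChange (D : QuaternionAlgebra) (E : Extension) where

  open Extension E
  open QuaternionAlgebra D using (a; b)
  open RawRing scalars using (_≈_; _+_; _*_; -_; 0#; 1#) renaming (Carrier to K)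

  private
    α β : K
    α = embed a
    β = embed b

  -- quat t x y z = t + x i + y j + z ij
  record Quaternion : Set where
    constructor quat
    field
      t x y z : K

  quaternions : RawRing 0ℓ 0ℓ
  quaternions = record
    { Carrier = Quaternion
    ; _≈_     = λ (quat t x y z) (quat t′ x′ y′ z′) →
        t ≈ t′ × x ≈ x′ × y ≈ y′ × z ≈ z′
    ; _+_     = λ (quat t x y z) (quat t′ x′ y′ z′) →
        quat (t + t′) (x + x′) (y + y′) (z + z′)
    ; _*_     = λ (quat t x y z) (quat t′ x′ y′ z′) → quat
        (t * t′ + α * (x * x′) + β * (y * y′) + - (α * β * (z * z′)))
        (t * x′ + x * t′ + β * (z * y′) + - (β * (y * z′)))
        (t * y′ + y * t′ + α * (x * z′) + - (α * (z * x′)))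
        (t * z′ + z * t′ + x * y′ + - (y * x′))
    ; -_      = λ (quat t x y z) → quat (- t) (- x) (- y) (- z)
    ; 0#      = quat 0# 0# 0# 0#
    ; 1#      = quat 1# 0# 0# 0#
    }

  module Q = RawRing quaternions

  conj : Quaternion → Quaternion
  conj (quat t x y z) = quat t (- x) (- y) (- z)

  scalar : K → Quaternion
  scalar c = quat c 0# 0# 0#

  infixr 8 _•_
  _•_ : K → Quaternion → Quaternion
  c • quat t x y z = quat (c * t) (c * x) (c * y) (c * z)

  Row : Set
  Row = Vector Quaternion 2

  rows : RawMonoid 0ℓ 0ℓ
  rows = record
    { Carrier = Row
    ; _≈_     = λ u v → ∀ i → u i Q.≈ v i
    ; _∙_     = λ u v i → u i Q.+ v i
    ; ε       = λ _ → Q.0#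
    }

  open RawMonoid rows public using () renaming (_≈_ to _≈ᵣ_)

  Matrix : Set
  Matrix = Fin 2 → Fin 2 → Quaternion

  diagonal : Quaternion → Matrix
  diagonal d zero       zero       = d
  diagonal d zero       (suc zero) = Q.0#
  diagonal d (suc zero) zero       = Q.0#
  diagonal d (suc zero) (suc zero) = d

  infixl 7 _·_
  _·_ : Row → Matrix → Row
  (u · m) j = sum Q.+-rawMonoid (λ k → u k Q.* m k j)

  matrices : RawRing 0ℓ 0ℓ
  matrices = record
    { Carrier = Matrix
    ; _≈_     = λ m n → ∀ i j → m i j Q.≈ n i j
    ; _+_     = λ m n i j → m i j Q.+ n i j
    ; _*_     = λ m n i → m i · n
    ; -_      = λ m i j → Q.- m i j
    ; 0#      = λ _ _ → Q.0#
    ; 1#      = diagonal Q.1#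
    }

  module M = RawRing matrices

  _† : Matrix → Matrix
  (m †) i j = conj (m j i)

  HasSimilitude : K → Pred Matrix 0ℓ
  HasSimilitude μ m = m M.* (m †) M.≈ diagonal (scalar μ)

  GU₂ : Pred Matrix 0ℓ
  GU₂ m = ∃[ μ ] Invertible scalars μ × HasSimilitude μ m

  SU₂ : Pred Matrix 0ℓ
  SU₂ = HasSimilitude 1#

  infixl 7 _·ₗ_
  _·ₗ_ : Pred Row 0ℓ → Matrix → Pred Row 0ℓ
  (L ·ₗ m) v = ∃[ u ] u ∈ L × v ≈ᵣ u · m

module Rational (D : QuaternionAlgebra) = BaseChange D rationals

module _ (D : QuaternionAlgebra) where

  open Rational D

  RamifiedAt : Pred Place 0ℓ
  RamifiedAt v = IsDivisionRing (BaseChange.quaternions D (completion v))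

  -- Being definite is being ramified at the infinite place.
  RamifiedExactlyAt-∞-and : (p : ℕ) → .(Prime p) → Set
  RamifiedExactlyAt-∞-and p p-prime =
    ∀ v → RamifiedAt v ⇔ (v ≡ finite p p-prime ⊎ v ≡ infinite)

  SpanOf : {C : Set} → (C → ℚ) → ∀ {n} → Vector Quaternion n → Pred Quaternion 0ℓ
  SpanOf ι e = Span Q.+-rawMonoid (λ c x → ι c • x) (λ x → ∃[ i ] x ≡ e i)

  record IsOrder (𝒪 : Pred Quaternion 0ℓ) : Set where
    field
      rank       : ℕ
      generators : Vector Quaternion rank
      ℤ-spanned  : 𝒪 ≐ SpanOf (λ (c : ℤ) → c / 1) generators
      ℚ-spanning : ∀ x → x ∈ SpanOf (λ (c : ℚ) → c) generators
      1∈𝒪        : Q.1# ∈ 𝒪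
      *-closed   : ∀ {x y} → x ∈ 𝒪 → y ∈ 𝒪 → x Q.* y ∈ 𝒪

  IsMaximalOrder : Pred Quaternion 0ℓ → Set₁
  IsMaximalOrder 𝒪 = IsOrder 𝒪 × (∀ 𝒪′ → IsOrder 𝒪′ → 𝒪 ⊆ 𝒪′ → 𝒪′ ⊆ 𝒪)

  module _ (E : Extension) where

    private module E = BaseChange D E

    baseChange : Quaternion → E.Quaternion
    baseChange (quat t x y z) = E.quat (ι t) (ι x) (ι y) (ι z)
      where open Extension E renaming (embed to ι)

    baseChangeᴹ : Matrix → E.Matrix
    baseChangeᴹ m i j = baseChange (m i j)

    -- The span of a lattice L ⊆ D² over a ring of integers Λ of E.
    _⊗[_] : Pred Row 0ℓ → {Λ : Set} → (Λ → RawRing.Carrier (Extension.scalars E)) →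
            Pred E.Row 0ℓ
    L ⊗[ ι ] = Span E.rows (λ c v i → ι c E.• v i)
                    (λ v → ∃[ u ] u ∈ L × v E.≈ᵣ (λ i → baseChange (u i)))

  standard : Pred Quaternion 0ℓ → Pred Row 0ℓ
  standard 𝒪 v = ∀ i → v i ∈ 𝒪

  module _ (ℓ : ℕ) where

    open Adic ℓ using (extension; integral)
    private module D_ℓ = BaseChange D extension

    completeAt : Pred Row 0ℓ → Pred D_ℓ.Row 0ℓ
    completeAt L = _⊗[_] extension L integral

    LocallyEquivalent : Pred Row 0ℓ → Pred Row 0ℓ → Set
    LocallyEquivalent L L′ =
      ∃[ h ] h ∈ D_ℓ.GU₂ × completeAt L ≐ completeAt L′ D_ℓ.·ₗ h

  -- p is the ramified prime: the completion of 𝒪² g at p is not a translate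
  -- of 𝒪_p² by a unitary similitude.
  NonPrincipal : ℕ → Pred Quaternion 0ℓ → Matrix → Set
  NonPrincipal p 𝒪 g = ¬ LocallyEquivalent p (standard 𝒪 ·ₗ g) (standard 𝒪)

  GL₂ : Set
  GL₂ = Σ Matrix (Invertible matrices)

  GL₂[_] : Pred Quaternion 0ℓ → Pred Matrix 0ℓ
  GL₂[ 𝒪 ] h = (∀ i j → h i j ∈ 𝒪) ×
    ∃[ h⁻¹ ] (∀ i j → h⁻¹ i j ∈ 𝒪) × h⁻¹ M.* h M.≈ M.1# × h M.* h⁻¹ M.≈ M.1#

  conjugateBy : GL₂ → Pred Matrix 0ℓ → Pred Matrix 0ℓ
  conjugateBy (g , g⁻¹ , _) S γ = ∃[ h ] h ∈ S × γ M.≈ g⁻¹ M.* h M.* g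

  private module D_𝔸 = BaseChange D Adelic.extension

  complete : Pred Row 0ℓ → Pred D_𝔸.Row 0ℓ
  complete L = _⊗[_] Adelic.extension L Adelic.integral

  U₂ : Pred Quaternion 0ℓ → GL₂ → Pred D_𝔸.Matrix 0ℓ
  U₂ 𝒪 (g , _) u = u ∈ D_𝔸.GU₂ × L̂ D_𝔸.·ₗ u ≐ L̂
    where
    L̂ : Pred D_𝔸.Row 0ℓ
    L̂ = complete (standard 𝒪 ·ₗ g)

  Γ⁽²⁾ : Pred Quaternion 0ℓ → GL₂ → Pred Matrix 0ℓ
  Γ⁽²⁾ 𝒪 g γ = γ ∈ GU₂ × baseChangeᴹ Adelic.extension γ ∈ U₂ 𝒪 g

module Submission where

open import Defs
open import Algebra.Bundles using (CommutativeRing; Ring)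
open import Algebra.Bundles.Raw using (RawMonoid; RawRing)
open import Algebra.Definitions.RawMonoid using (sum)
import Algebra.Properties.CommutativeSemigroup as CommutativeSemigroupProperties
import Algebra.Properties.Ring as RingProperties
import Algebra.Solver.Ring.NaturalCoefficients.Default as SemiringSolver
open import Algebra.Structures using (IsCommutativeRing; IsRing)
open import Data.Empty using (⊥; ⊥-elim)
open import Data.Fin.Base using (Fin; zero; suc)
open import Data.Fin.Patterns using (0F; 1F)
open import Data.Integer.Base as ℤ using (ℤ; +_; -[1+_]; 0ℤ; 1ℤ; +≤+)
open import Data.Integer.Divisibility.Signed
  using (_∣_; divides; ∣m∣n⇒∣m+n; ∣m∣n⇒∣m-n; ∣m⇒∣m*n; ∣m⇒∣-m; ∣-trans; ∣ᵤ⇒∣; m∣∣m∣; *-cancelʳ-∣)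
import Data.Integer.Properties as ℤ
open import Data.Integer.Tactic.RingSolver using (solve-∀)
open import Data.Nat.Base as ℕ using (ℕ; zero; suc; _!; _⊔_)
open import Data.Nat.Coprimality using (1-coprimeTo)
import Data.Nat.Divisibility as ℕ
open import Data.Nat.Induction using (<-rec)
open import Data.Nat.Primality using (Prime)
import Data.Nat.Properties as ℕ
open import Data.Product.Base using (Σ; ∃-syntax; _×_; _,_; proj₁; proj₂)
open import Data.Rational.Base as ℚ using (ℚ; mkℚ; 0ℚ; 1ℚ; ½; ↥_; ↧_)
open import Data.Rational.Literals using (fromℤ)
import Data.Rational.Properties as ℚ
import Data.Rational.Solver as ℚ-Solver
import Data.Rational.Unnormalised.Base as ℚᵘ
import Data.Rational.Unnormalised.Properties as ℚᵘ
open import Data.Sum.Base using (inj₁; inj₂; [_,_])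
open import Data.Unit.Base using (⊤; tt)
open import Data.Vec.Functional using (Vector; _∷_)
open import Function.Base using (_$_)
open import Function.Bundles using (Equivalence)
open import Level using (0ℓ)
open import Relation.Binary.Definitions using (tri<; tri≈; tri>)
import Relation.Binary.PropositionalEquality as ≡
open import Relation.Binary.PropositionalEquality using (_≡_; _≢_; _≗_)
open import Relation.Nullary.Decidable.Core using (yes; no; from-yes; from-no)
open import Relation.Nullary.Negation using (¬_)
open import Relation.Unary using (Pred; _∈_; _⊆_; _≐_; _∩_)

-- Over ℝ a definite quaternion algebra (a, b | ℚ) has a, b < 0: for a > 0 the
-- element √a + i is a zero divisor.  Hence the reduced norm is positive
-- definite over ℚ, one-sided inverses of similitudes are two-sided, and
-- q(v) = N(v₁) + N(v₂) is a positive definite form with q(v γ) = μ q(v) for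
-- every similitude γ with factor μ.
--
-- Let L = 𝒪² g.  Since L̂ ∩ D² = L, a similitude stabilises L̂ exactly when it
-- stabilises L, which is to say that it is conjugate under g to an element of
-- GL₂(𝒪).  On L the values of q have a common denominator, so γ cannot scale
-- them by a positive factor other than 1, and μ = 1.

-- The condition m m† = μ hands over a right inverse only, whereas both inclusions in L̂ γ = L̂ and
-- the scaling of q by γ⁻¹ call for a left inverse as well. Instead of a dimension count in M₂(D),
-- it is computed from the reduced norms of the four entries.
--
-- That μ = 1 is often read off from μ being a positive rational that is a unit of ℤ̂. Here no
-- adelic similitude factor is examined: γ when μ < 1, or γ⁻¹ when μ > 1, maps L into itself and
-- shrinks q, and iterating it contradicts the common denominator. So q lives over ℚ only, and the
-- adeles serve just to pass between stability of L̂ and stability of L.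
--
-- Every vector of L̂ is a ℤ̂-combination of rational rows. Identities such as the cancellation of γ
-- against γ⁻¹ are checked on rational rows and extended by linearity, so associativity of adelic
-- quaternions never enters.
--
-- L̂ ∩ D² = L rests on 𝒪 and ℤ⁴ being commensurable: a ℤ̂-combination is as close as desired to an
-- integer combination, and a rational vector close enough to 𝒪 lies in 𝒪.

record RationalAlgebra : Set₁ where
  field
    commutativeRing : CommutativeRing 0ℓ 0ℓ
  open CommutativeRing commutativeRing public hiding (zero)
  field
    embed     : ℚ → Carrier
    embed-+   : ∀ p q → embed (p ℚ.+ q) ≈ embed p + embed q
    embed-*   : ∀ p q → embed (p ℚ.* q) ≈ embed p * embed q
    embed-neg : ∀ p → embed (ℚ.- p) ≈ - embed p
    embed-0   : embed 0ℚ ≈ 0#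
    embed-1   : embed 1ℚ ≈ 1#

  extension : Extension
  extension = record { scalars = rawRing ; embed = embed }

-- Quaternions, rows and lattices over a commutative ℚ-algebra

module BaseChangeProperties (D : QuaternionAlgebra) (R : RationalAlgebra) where

  open RationalAlgebra R
  open QuaternionAlgebra D using (a; b)
  open SemiringSolver commutativeSemiring using (solve; _:=_; _:+_; _:*_; con)
  open RingProperties ring using (-‿+-comm; -‿distribʳ-*)

  module 𝔻 = Rational D
  open BaseChange D extension

  bc : 𝔻.Quaternion → Quaternion
  bc = baseChange D extension

  bcᴹ : 𝔻.Matrix → Matrix
  bcᴹ = baseChangeᴹ D extension

  bcᴿ : 𝔻.Row → Row
  bcᴿ u i = bc (u i)

  private
    α β : Carrier
    α = embed a
    β = embed b

    -- The shape shared by the four coordinates of a product.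
    lin : Carrier → Carrier → Carrier → Carrier → Carrier
    lin p q r s = p + q + r + - s

    lin-cong : ∀ {p p′ q q′ r r′ s s′} → p ≈ p′ → q ≈ q′ → r ≈ r′ → s ≈ s′ →
               lin p q r s ≈ lin p′ q′ r′ s′
    lin-cong p q r s = +-cong (+-cong (+-cong p q) r) (-‿cong s)

    +-interchange₄ : ∀ p q r s p′ q′ r′ s′ →
      p + p′ + (q + q′) + (r + r′) + (s + s′) ≈
      p + q + r + s + (p′ + q′ + r′ + s′)
    +-interchange₄ = solve 8 (λ p q r s p′ q′ r′ s′ →
      p :+ p′ :+ (q :+ q′) :+ (r :+ r′) :+ (s :+ s′) :=
      p :+ q :+ r :+ s :+ (p′ :+ q′ :+ r′ :+ s′)) refl

    *-distribˡ-+₄ : ∀ c p q r s →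
      c * p + c * q + c * r + c * s ≈ c * (p + q + r + s)
    *-distribˡ-+₄ = solve 5 (λ c p q r s →
      c :* p :+ c :* q :+ c :* r :+ c :* s :=
      c :* (p :+ q :+ r :+ s)) refl

    lin-+ : ∀ p q r s p′ q′ r′ s′ →
      lin (p + p′) (q + q′) (r + r′) (s + s′) ≈ lin p q r s + lin p′ q′ r′ s′
    lin-+ p q r s p′ q′ r′ s′ = trans (+-cong refl (sym (-‿+-comm s s′)))
      (+-interchange₄ p q r (- s) p′ q′ r′ (- s′))

    lin-* : ∀ c p q r s → lin (c * p) (c * q) (c * r) (c * s) ≈ c * lin p q r s
    lin-* c p q r s = trans (+-cong refl (-‿distribʳ-* c s)) (*-distribˡ-+₄ c p q r (- s))

    lin-0 : lin 0# 0# 0# 0# ≈ 0#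
    lin-0 = trans (lin-cong (sym (zeroˡ 0#)) (sym (zeroˡ 0#)) (sym (zeroˡ 0#)) (sym (zeroˡ 0#)))
              (trans (lin-* 0# 0# 0# 0# 0#) (zeroˡ _))

    embed-lin : ∀ p q r s → embed (p ℚ.+ q ℚ.+ r ℚ.+ ℚ.- s) ≈ lin (embed p) (embed q) (embed r) (embed s)
    embed-lin p q r s = trans (embed-+ _ _)
      (+-cong (trans (embed-+ _ _) (+-cong (embed-+ p q) refl)) (embed-neg s))

    embed-*₃ : ∀ p q r → embed (p ℚ.* (q ℚ.* r)) ≈ embed p * (embed q * embed r)
    embed-*₃ p q r = trans (embed-* _ _) (*-cong refl (embed-* q r))

    embed-*₄ : ∀ p q r s → embed (p ℚ.* q ℚ.* (r ℚ.* s)) ≈ embed p * embed q * (embed r * embed s)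
    embed-*₄ p q r s = trans (embed-* _ _) (*-cong (embed-* p q) (embed-* r s))

    distrib₃ : ∀ p x y z → p * ((x + y) * z) ≈ p * (x * z) + p * (y * z)
    distrib₃ p x y z = trans (*-cong refl (distribʳ z x y)) (distribˡ p (x * z) (y * z))

    zero₃ : ∀ p x → p * (0# * x) ≈ 0#
    zero₃ p x = trans (*-cong refl (zeroˡ x)) (zeroʳ p)

    pull₃ : ∀ c p x y → p * ((c * x) * y) ≈ c * (p * (x * y))
    pull₃ = solve 4 (λ c p x y →
      p :* ((c :* x) :* y) :=
      c :* (p :* (x :* y))) refl

    cong₃ : ∀ {p x x′ y y′} → x ≈ x′ → y ≈ y′ → p * (x * y) ≈ p * (x′ * y′)
    cong₃ x y = *-cong refl (*-cong x y)

  ≈-refl : ∀ {u} → u Q.≈ u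
  ≈-refl = refl , refl , refl , refl

  ≈-reflexive : ∀ {u v} → u ≡ v → u Q.≈ v
  ≈-reflexive ≡.refl = ≈-refl

  ≈-sym : ∀ {u v} → u Q.≈ v → v Q.≈ u
  ≈-sym (t , x , y , z) = sym t , sym x , sym y , sym z

  ≈-trans : ∀ {u v w} → u Q.≈ v → v Q.≈ w → u Q.≈ w
  ≈-trans (t , x , y , z) (t′ , x′ , y′ , z′) = trans t t′ , trans x x′ , trans y y′ , trans z z′

  +-Q-cong : ∀ {u u′ v v′} → u Q.≈ u′ → v Q.≈ v′ → u Q.+ v Q.≈ u′ Q.+ v′
  +-Q-cong (t , x , y , z) (t′ , x′ , y′ , z′) = +-cong t t′ , +-cong x x′ , +-cong y y′ , +-cong z z′

  *-Q-cong : ∀ {u u′ v v′} → u Q.≈ u′ → v Q.≈ v′ → u Q.* v Q.≈ u′ Q.* v′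
  *-Q-cong (t , x , y , z) (t′ , x′ , y′ , z′) =
      lin-cong (*-cong t t′) (cong₃ x x′) (cong₃ y y′) (cong₃ z z′)
    , lin-cong (*-cong t x′) (*-cong x t′) (cong₃ z y′) (cong₃ y z′)
    , lin-cong (*-cong t y′) (*-cong y t′) (cong₃ x z′) (cong₃ z x′)
    , lin-cong (*-cong t z′) (*-cong z t′) (*-cong x y′) (*-cong y x′)

  •-cong : ∀ {c u v} → u Q.≈ v → c • u Q.≈ c • v
  •-cong (t , x , y , z) = *-cong refl t , *-cong refl x , *-cong refl y , *-cong refl z

  -- Together with the two laws below, this is what linearity of u ↦ u · m amounts to; rows are
  -- acted on from the right, so only the left factor varies.
  *-Q-distribʳ-+ : ∀ w u v → (u Q.+ v) Q.* w Q.≈ u Q.* w Q.+ v Q.* w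
  *-Q-distribʳ-+ (quat t″ x″ y″ z″) (quat t x y z) (quat t′ x′ y′ z′) =
      trans (lin-cong (distribʳ t″ t t′) (distrib₃ α x x′ x″) (distrib₃ β y y′ y″) (distrib₃ (α * β) z z′ z″))
            (lin-+ (t * t″) (α * (x * x″)) (β * (y * y″)) (α * β * (z * z″)) (t′ * t″) (α * (x′ * x″)) (β * (y′ * y″)) (α * β * (z′ * z″)))
    , trans (lin-cong (distribʳ x″ t t′) (distribʳ t″ x x′) (distrib₃ β z z′ y″) (distrib₃ β y y′ z″))
            (lin-+ (t * x″) (x * t″) (β * (z * y″)) (β * (y * z″)) (t′ * x″) (x′ * t″) (β * (z′ * y″)) (β * (y′ * z″)))
    , trans (lin-cong (distribʳ y″ t t′) (distribʳ t″ y y′) (distrib₃ α x x′ z″) (distrib₃ α z z′ x″))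
            (lin-+ (t * y″) (y * t″) (α * (x * z″)) (α * (z * x″)) (t′ * y″) (y′ * t″) (α * (x′ * z″)) (α * (z′ * x″)))
    , trans (lin-cong (distribʳ z″ t t′) (distribʳ t″ z z′) (distribʳ y″ x x′) (distribʳ x″ y y′))
            (lin-+ (t * z″) (z * t″) (x * y″) (y * x″) (t′ * z″) (z′ * t″) (x′ * y″) (y′ * x″))

  •-Q-* : ∀ c u w → (c • u) Q.* w Q.≈ c • (u Q.* w)
  •-Q-* c (quat t x y z) (quat t″ x″ y″ z″) =
      trans (lin-cong (*-assoc c t t″) (pull₃ c α x x″) (pull₃ c β y y″) (pull₃ c (α * β) z z″)) (lin-* c _ _ _ _)
    , trans (lin-cong (*-assoc c t x″) (*-assoc c x t″) (pull₃ c β z y″) (pull₃ c β y z″)) (lin-* c _ _ _ _)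
    , trans (lin-cong (*-assoc c t y″) (*-assoc c y t″) (pull₃ c α x z″) (pull₃ c α z x″)) (lin-* c _ _ _ _)
    , trans (lin-cong (*-assoc c t z″) (*-assoc c z t″) (*-assoc c x y″) (*-assoc c y x″)) (lin-* c _ _ _ _)

  0-Q-* : ∀ w → Q.0# Q.* w Q.≈ Q.0#
  0-Q-* (quat t x y z) =
      trans (lin-cong (zeroˡ t) (zero₃ α x) (zero₃ β y) (zero₃ (α * β) z)) lin-0
    , trans (lin-cong (zeroˡ x) (zeroˡ t) (zero₃ β y) (zero₃ β z)) lin-0
    , trans (lin-cong (zeroˡ y) (zeroˡ t) (zero₃ α z) (zero₃ α x)) lin-0
    , trans (lin-cong (zeroˡ z) (zeroˡ t) (zeroˡ y) (zeroˡ x)) lin-0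

  bc-+ : ∀ u v → bc (u 𝔻.Q.+ v) Q.≈ bc u Q.+ bc v
  bc-+ (𝔻.quat t x y z) (𝔻.quat t′ x′ y′ z′) = embed-+ t t′ , embed-+ x x′ , embed-+ y y′ , embed-+ z z′

  bc-* : ∀ u v → bc (u 𝔻.Q.* v) Q.≈ bc u Q.* bc v
  bc-* (𝔻.quat t x y z) (𝔻.quat t′ x′ y′ z′) =
      trans (embed-lin _ _ _ _) (lin-cong (embed-* t t′) (embed-*₃ a x x′) (embed-*₃ b y y′) (embed-*₄ a b z z′))
    , trans (embed-lin _ _ _ _) (lin-cong (embed-* t x′) (embed-* x t′) (embed-*₃ b z y′) (embed-*₃ b y z′))
    , trans (embed-lin _ _ _ _) (lin-cong (embed-* t y′) (embed-* y t′) (embed-*₃ a x z′) (embed-*₃ a z x′))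
    , trans (embed-lin _ _ _ _) (lin-cong (embed-* t z′) (embed-* z t′) (embed-* x y′) (embed-* y x′))

  bc-conj : ∀ u → bc (𝔻.conj u) Q.≈ conj (bc u)
  bc-conj (𝔻.quat t x y z) = refl , embed-neg x , embed-neg y , embed-neg z

  bc-0 : bc 𝔻.Q.0# Q.≈ Q.0#
  bc-0 = embed-0 , embed-0 , embed-0 , embed-0

  ·-≈-cong : ∀ {u v : Row} {m n : Matrix} → u ≈ᵣ v → m M.≈ n → u · m ≈ᵣ v · n
  ·-≈-cong {u} {v} {m} {n} u≈v m≈n j = +-Q-cong {u 0F Q.* m 0F j} {v 0F Q.* n 0F j}
    (*-Q-cong {u 0F} {v 0F} {m 0F j} {n 0F j} (u≈v 0F) (m≈n 0F j))
    (+-Q-cong {u 1F Q.* m 1F j} {v 1F Q.* n 1F j} {Q.0#} {Q.0#}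
      (*-Q-cong {u 1F} {v 1F} {m 1F j} {n 1F j} (u≈v 1F) (m≈n 1F j)) (≈-refl {Q.0#}))

  ≈ᵣ-refl : ∀ {u} → u ≈ᵣ u
  ≈ᵣ-refl {u} i = ≈-refl {u i}

  ≈ᵣ-sym : ∀ {u v} → u ≈ᵣ v → v ≈ᵣ u
  ≈ᵣ-sym {u} {v} u≈v i = ≈-sym {u i} {v i} (u≈v i)

  ≈ᵣ-trans : ∀ {u v w} → u ≈ᵣ v → v ≈ᵣ w → u ≈ᵣ w
  ≈ᵣ-trans {u} {v} {w} u≈v v≈w i = ≈-trans {u i} {v i} {w i} (u≈v i) (v≈w i)

  ·-≈-congˡ : ∀ {u v : Row} (m : Matrix) → u ≈ᵣ v → u · m ≈ᵣ v · m
  ·-≈-congˡ {u} {v} m u≈v = ·-≈-cong {u} {v} {m} {m} u≈v (λ i j → ≈-refl {m i j})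

  private
    +ʳ : Row → Row → Row
    +ʳ = RawMonoid._∙_ rows

    shuffle : ∀ p p′ q q′ → p + p′ + (q + q′ + 0#) ≈ p + (q + 0#) + (p′ + (q′ + 0#))
    shuffle = solve 4 (λ p p′ q q′ →
      p :+ p′ :+ (q :+ q′ :+ con 0) :=
      p :+ (q :+ con 0) :+ (p′ :+ (q′ :+ con 0))) refl

    scale-shuffle : ∀ c p q → c * p + (c * q + 0#) ≈ c * (p + (q + 0#))
    scale-shuffle = solve 3 (λ c p q →
      c :* p :+ (c :* q :+ con 0) :=
      c :* (p :+ (q :+ con 0))) refl

  bc-· : ∀ u m → bcᴿ (u 𝔻.· m) ≈ᵣ bcᴿ u · bcᴹ m
  bc-· u m j = ≈-trans {bc ((u 𝔻.· m) j)} {bc p Q.+ bc (q 𝔻.Q.+ 𝔻.Q.0#)} {(bcᴿ u · bcᴹ m) j}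
    (bc-+ p (q 𝔻.Q.+ 𝔻.Q.0#))
    (+-Q-cong {bc p} {bc (u 0F) Q.* bc (m 0F j)} {bc (q 𝔻.Q.+ 𝔻.Q.0#)}
      (bc-* (u 0F) (m 0F j))
      (≈-trans {bc (q 𝔻.Q.+ 𝔻.Q.0#)} {bc q Q.+ bc 𝔻.Q.0#} (bc-+ q 𝔻.Q.0#)
        (+-Q-cong {bc q} {bc (u 1F) Q.* bc (m 1F j)} {bc 𝔻.Q.0#} (bc-* (u 1F) (m 1F j)) bc-0)))
    where
    p = u 0F 𝔻.Q.* m 0F j
    q = u 1F 𝔻.Q.* m 1F j

  ·-distribʳ-+ : ∀ m u v → (+ʳ u v) · m ≈ᵣ +ʳ (u · m) (v · m)
  ·-distribʳ-+ m u v j = ≈-trans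
    {(+ʳ u v · m) j} {(p 0F Q.+ p′ 0F) Q.+ ((p 1F Q.+ p′ 1F) Q.+ Q.0#)} {(u · m) j Q.+ (v · m) j}
    (+-Q-cong {(u 0F Q.+ v 0F) Q.* m 0F j} {p 0F Q.+ p′ 0F} (*-Q-distribʳ-+ (m 0F j) (u 0F) (v 0F))
      (+-Q-cong {(u 1F Q.+ v 1F) Q.* m 1F j} {p 1F Q.+ p′ 1F} {Q.0#} {Q.0#} (*-Q-distribʳ-+ (m 1F j) (u 1F) (v 1F)) (≈-refl {Q.0#})))
    ( shuffle (Quaternion.t (p 0F)) (Quaternion.t (p′ 0F)) (Quaternion.t (p 1F)) (Quaternion.t (p′ 1F))
    , shuffle (Quaternion.x (p 0F)) (Quaternion.x (p′ 0F)) (Quaternion.x (p 1F)) (Quaternion.x (p′ 1F))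
    , shuffle (Quaternion.y (p 0F)) (Quaternion.y (p′ 0F)) (Quaternion.y (p 1F)) (Quaternion.y (p′ 1F))
    , shuffle (Quaternion.z (p 0F)) (Quaternion.z (p′ 0F)) (Quaternion.z (p 1F)) (Quaternion.z (p′ 1F)))
    where
    p p′ : Fin 2 → Quaternion
    p k = u k Q.* m k j
    p′ k = v k Q.* m k j

  •-· : ∀ c u m → (λ i → c • u i) · m ≈ᵣ (λ i → c • (u · m) i)
  •-· c u m j = ≈-trans
    {((λ i → c • u i) · m) j} {c • p 0F Q.+ (c • p 1F Q.+ Q.0#)} {c • (u · m) j}
    (+-Q-cong {(c • u 0F) Q.* m 0F j} {c • p 0F} (•-Q-* c (u 0F) (m 0F j))
      (+-Q-cong {(c • u 1F) Q.* m 1F j} {c • p 1F} {Q.0#} {Q.0#} (•-Q-* c (u 1F) (m 1F j)) (≈-refl {Q.0#})))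
    ( scale-shuffle c (Quaternion.t (p 0F)) (Quaternion.t (p 1F))
    , scale-shuffle c (Quaternion.x (p 0F)) (Quaternion.x (p 1F))
    , scale-shuffle c (Quaternion.y (p 0F)) (Quaternion.y (p 1F))
    , scale-shuffle c (Quaternion.z (p 0F)) (Quaternion.z (p 1F)))
    where
    p : Fin 2 → Quaternion
    p k = u k Q.* m k j

  0-· : ∀ m → (λ _ → Q.0#) · m ≈ᵣ (λ _ → Q.0#)
  0-· m j = ≈-trans {((λ _ → Q.0#) · m) j} {Q.0# Q.+ (Q.0# Q.+ Q.0#)} {Q.0#}
    (+-Q-cong {Q.0# Q.* m 0F j} {Q.0#} (0-Q-* (m 0F j))
      (+-Q-cong {Q.0# Q.* m 1F j} {Q.0#} {Q.0#} {Q.0#} (0-Q-* (m 1F j)) (≈-refl {Q.0#})))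
    (0+0+0 , 0+0+0 , 0+0+0 , 0+0+0)
    where
    0+0+0 : 0# + (0# + 0#) ≈ 0#
    0+0+0 = trans (+-identityˡ _) (+-identityˡ 0#)

  module Completion {Λ : Set} (ι : Λ → Carrier) where

    combination : ∀ {k} → Vector Λ k → Vector Row k → Row
    combination c x = sum rows (λ i j → ι (c i) • x i j)

    combination-cong : ∀ {k} (c : Vector Λ k) {x y : Vector Row k} →
                       (∀ i → x i ≈ᵣ y i) → combination c x ≈ᵣ combination c y
    combination-cong {zero}  c x≈y = ≈ᵣ-refl {λ _ → Q.0#}
    combination-cong {suc k} c {x} {y} x≈y j =
      +-Q-cong {ι (c zero) • x zero j} {ι (c zero) • y zero j}
        (•-cong {ι (c zero)} {x zero j} {y zero j} (x≈y zero j))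
        (combination-cong (λ i → c (suc i)) {λ i → x (suc i)} {λ i → y (suc i)} (λ i → x≈y (suc i)) j)

    combination-· : ∀ {k} (c : Vector Λ k) (x : Vector Row k) m →
                    combination c x · m ≈ᵣ combination c (λ i → x i · m)
    combination-· {zero}  c x m = 0-· m
    combination-· {suc k} c x m = ≈ᵣ-trans {combination c x · m} {+ʳ (head · m) (tail · m)}
      (·-distribʳ-+ m head tail)
      (λ j → +-Q-cong {(head · m) j} {ι (c zero) • (x zero · m) j}
        (•-· (ι (c zero)) (x zero) m j) (combination-· (λ i → c (suc i)) (λ i → x (suc i)) m j))
      where
      head tail : Row
      head j = ι (c zero) • x zero j
      tail = combination (λ i → c (suc i)) (λ i → x (suc i))

    hat : Pred 𝔻.Row 0ℓ → Pred Row 0ℓ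
    hat L = _⊗[_] D extension L ι

    hat-resp-≈ : ∀ L {v w} → v ≈ᵣ w → v ∈ hat L → w ∈ hat L
    hat-resp-≈ L {v} {w} v≈w (k , c , x , x∈L , v≈) =
      k , c , x , x∈L , ≈ᵣ-trans {w} {v} {combination c x} (≈ᵣ-sym {v} {w} v≈w) v≈

    -- Right multiplication by m is linear, so a combination of vectors of L goes to the combination
    -- of their images with the same coefficients.
    hat-· : ∀ L L′ m → (∀ u → u ∈ L → (u 𝔻.· m) ∈ L′) → ∀ {v} → v ∈ hat L → (v · bcᴹ m) ∈ hat L′
    hat-· L L′ m Lm⊆L′ {v} (k , c , x , x∈L , v≈) =
      k , c , (λ i → x i · bcᴹ m)
      , (λ i → let (u , u∈L , x≈u) = x∈L i in u 𝔻.· m , Lm⊆L′ u u∈L ,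
           ≈ᵣ-trans {x i · bcᴹ m} {bcᴿ u · bcᴹ m} {bcᴿ (u 𝔻.· m)}
             (·-≈-congˡ {x i} {bcᴿ u} (bcᴹ m) x≈u) (≈ᵣ-sym {bcᴿ (u 𝔻.· m)} {bcᴿ u · bcᴹ m} (bc-· u m)))
      , ≈ᵣ-trans {v · bcᴹ m} {combination c x · bcᴹ m}
          (·-≈-congˡ {v} {combination c x} (bcᴹ m) v≈) (combination-· c x (bcᴹ m))

    -- Cancellation is known on rational rows only. Both multiplications are pushed through the
    -- combination that represents v, and cancellation happens in each of its terms.
    hat-·-cancel : ∀ L m n → (∀ u → (u 𝔻.· m) 𝔻.· n ≗ u) → ∀ {v} → v ∈ hat L → (v · bcᴹ m) · bcᴹ n ≈ᵣ v
    hat-·-cancel L m n umn≡u {v} (k , c , x , x∈L , v≈) =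
      ≈ᵣ-trans {(v · bcᴹ m) · bcᴹ n} {(combination c x · bcᴹ m) · bcᴹ n} {v}
        (·-≈-congˡ {v · bcᴹ m} {combination c x · bcᴹ m} (bcᴹ n) (·-≈-congˡ {v} {combination c x} (bcᴹ m) v≈))
      (≈ᵣ-trans {(combination c x · bcᴹ m) · bcᴹ n} {combination c (λ i → x i · bcᴹ m) · bcᴹ n} {v}
        (·-≈-congˡ {combination c x · bcᴹ m} {combination c (λ i → x i · bcᴹ m)} (bcᴹ n) (combination-· c x (bcᴹ m)))
      (≈ᵣ-trans {combination c (λ i → x i · bcᴹ m) · bcᴹ n} {combination c (λ i → (x i · bcᴹ m) · bcᴹ n)} {v}
        (combination-· c (λ i → x i · bcᴹ m) (bcᴹ n))
      (≈ᵣ-trans {combination c (λ i → (x i · bcᴹ m) · bcᴹ n)} {combination c x} {v}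
        (combination-cong c {λ i → (x i · bcᴹ m) · bcᴹ n} {x} cancel)
        (≈ᵣ-sym {v} {combination c x} v≈))))
      where
      cancel : ∀ i → (x i · bcᴹ m) · bcᴹ n ≈ᵣ x i
      cancel i = let (u , _ , x≈u) = x∈L i in
        ≈ᵣ-trans {(x i · bcᴹ m) · bcᴹ n} {(bcᴿ u · bcᴹ m) · bcᴹ n} {x i}
          (·-≈-congˡ {x i · bcᴹ m} {bcᴿ u · bcᴹ m} (bcᴹ n) (·-≈-congˡ {x i} {bcᴿ u} (bcᴹ m) x≈u))
        (≈ᵣ-trans {(bcᴿ u · bcᴹ m) · bcᴹ n} {bcᴿ (u 𝔻.· m) · bcᴹ n} {x i}
          (·-≈-congˡ {bcᴿ u · bcᴹ m} {bcᴿ (u 𝔻.· m)} (bcᴹ n) (≈ᵣ-sym {bcᴿ (u 𝔻.· m)} {bcᴿ u · bcᴹ m} (bc-· u m)))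
        (≈ᵣ-trans {bcᴿ (u 𝔻.· m) · bcᴹ n} {bcᴿ ((u 𝔻.· m) 𝔻.· n)} {x i}
          (≈ᵣ-sym {bcᴿ ((u 𝔻.· m) 𝔻.· n)} {bcᴿ (u 𝔻.· m) · bcᴹ n} (bc-· (u 𝔻.· m) n))
        (≈ᵣ-trans {bcᴿ ((u 𝔻.· m) 𝔻.· n)} {bcᴿ u} {x i}
          (λ j → ≈-reflexive (≡.cong bc (umn≡u u j))) (≈ᵣ-sym {x i} {bcᴿ u} x≈u))))

    ∈-hat : ∀ L 𝟙 → ι 𝟙 ≈ 1# → ∀ u → u ∈ L → bcᴿ u ∈ hat L
    ∈-hat L 𝟙 ι𝟙≈1 u u∈L = 1 , (λ _ → 𝟙) , (λ _ → bcᴿ u) , (λ _ → u , u∈L , ≈ᵣ-refl {bcᴿ u}) ,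
      λ j → expand (bc (u j))
      where
      unit : ∀ p → p ≈ ι 𝟙 * p + 0#
      unit p = sym (trans (+-identityʳ _) (trans (*-cong ι𝟙≈1 refl) (*-identityˡ p)))
      expand : ∀ v → v Q.≈ ι 𝟙 • v Q.+ Q.0#
      expand (quat t x y z) = unit t , unit x , unit y , unit z

  bc-diagonal : ∀ c → bcᴹ (𝔻.diagonal (𝔻.scalar c)) M.≈ diagonal (scalar (embed c))
  bc-diagonal c 0F 0F = refl , embed-0 , embed-0 , embed-0
  bc-diagonal c 0F 1F = bc-0
  bc-diagonal c 1F 0F = bc-0
  bc-diagonal c 1F 1F = refl , embed-0 , embed-0 , embed-0

  bc-similitude : ∀ {μ} γ → (∀ i → (γ 𝔻.M.* (γ 𝔻.†)) i ≗ 𝔻.diagonal (𝔻.scalar μ) i) →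
                  HasSimilitude (embed μ) (bcᴹ γ)
  bc-similitude {μ} γ γγ†≡μ i j =
    ≈-trans {(bcᴹ γ M.* (bcᴹ γ †)) i j} {(bcᴹ γ M.* bcᴹ (γ 𝔻.†)) i j} {diagonal (scalar (embed μ)) i j}
      (·-≈-cong {bcᴹ γ i} {bcᴹ γ i} {bcᴹ γ †} {bcᴹ (γ 𝔻.†)} (λ k → ≈-refl {bcᴹ γ i k})
        (λ k l → ≈-sym {bc (𝔻.conj (γ l k))} {conj (bc (γ l k))} (bc-conj (γ l k))) j)
    (≈-trans {(bcᴹ γ M.* bcᴹ (γ 𝔻.†)) i j} {bc ((γ 𝔻.M.* (γ 𝔻.†)) i j)} {diagonal (scalar (embed μ)) i j}
      (≈-sym {bc ((γ 𝔻.M.* (γ 𝔻.†)) i j)} {(bcᴹ γ M.* bcᴹ (γ 𝔻.†)) i j} (bc-· (γ i) (γ 𝔻.†) j))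
    (≈-trans {bc ((γ 𝔻.M.* (γ 𝔻.†)) i j)} {bcᴹ (𝔻.diagonal (𝔻.scalar μ)) i j} {diagonal (scalar (embed μ)) i j}
      (≈-reflexive (≡.cong bc (γγ†≡μ i j))) (bc-diagonal μ i j)))

-- Integers and order in ℚ

open ≡ using (refl; sym; trans; cong; cong₂; subst; subst₂; ≢-sym; isEquivalence; module ≡-Reasoning)
open import Data.Rational.Base using (_+_; _*_; -_; _-_; _≤_; _<_; _/_; 1/_; ∣_∣; *≤*; *<*; NonZero; Positive; positive; negative; nonNegative; ≢-nonZero)
open ℚ-Solver.+-*-Solver using (Polynomial; solve; _:=_; _:+_; _:*_; :-_; con)

-- `i / 1` passes through a normalisation that is stuck on a variable `i`; `fromℤ i` is the same
-- number already in lowest terms, and the form in which the proof computes.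
/1≡fromℤ : ∀ i → i / 1 ≡ fromℤ i
/1≡fromℤ i = ℚ.↥p/↧p≡p (fromℤ i)

fromℤ-+ : ∀ i j → fromℤ (i ℤ.+ j) ≡ fromℤ i + fromℤ j
fromℤ-+ i j = ℚ.toℚᵘ-injective (ℚᵘ.≃-sym (ℚᵘ.≃-trans
  (ℚ.toℚᵘ-homo-+ (fromℤ i) (fromℤ j))
  (ℚᵘ.*≡* (cong (ℤ._* + 1) (cong₂ ℤ._+_ (ℤ.*-identityʳ i) (ℤ.*-identityʳ j))))))

fromℤ-* : ∀ i j → fromℤ (i ℤ.* j) ≡ fromℤ i * fromℤ j
fromℤ-* i j = ℚ.toℚᵘ-injective (ℚᵘ.≃-sym (ℚ.toℚᵘ-homo-* (fromℤ i) (fromℤ j)))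

fromℤ-neg : ∀ i → fromℤ (ℤ.- i) ≡ - fromℤ i
fromℤ-neg i = ℚ.toℚᵘ-injective (ℚᵘ.≃-sym (ℚ.toℚᵘ-homo‿- (fromℤ i)))

fromℤ-injective : ∀ {i j} → fromℤ i ≡ fromℤ j → i ≡ j
fromℤ-injective refl = refl

fromℤ-cancel-< : ∀ {i j} → fromℤ i < fromℤ j → i ℤ.< j
fromℤ-cancel-< {i} {j} (*<* i<j) = subst₂ ℤ._<_ (ℤ.*-identityʳ i) (ℤ.*-identityʳ j) i<j

p*q≡0⇒q≡0 : ∀ {p q} → p ≢ 0ℚ → p * q ≡ 0ℚ → q ≡ 0ℚ
p*q≡0⇒q≡0 {p} {q} p≢0 pq≡0 = begin
  q                ≡⟨ ℚ.*-identityˡ q ⟨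
  1ℚ * q           ≡⟨ cong (_* q) (ℚ.*-inverseˡ p) ⟨
  (1/ p * p) * q   ≡⟨ ℚ.*-assoc (1/ p) p q ⟩
  1/ p * (p * q)   ≡⟨ cong (1/ p *_) pq≡0 ⟩
  1/ p * 0ℚ        ≡⟨ ℚ.*-zeroʳ (1/ p) ⟩
  0ℚ               ∎
  where
  open ≡-Reasoning
  instance
    p-nonZero : NonZero p
    p-nonZero = ≢-nonZero p≢0

*-cancelˡ-≢0 : ∀ {p q r} → p ≢ 0ℚ → p * q ≡ p * r → q ≡ r
*-cancelˡ-≢0 {p} {q} {r} p≢0 pq≡pr = begin
  q              ≡⟨ eq q r ⟩
  (q - r) + r    ≡⟨ cong (_+ r) (p*q≡0⇒q≡0 p≢0 diff) ⟩
  0ℚ + r         ≡⟨ ℚ.+-identityˡ r ⟩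
  r              ∎
  where
  open ≡-Reasoning
  eq : ∀ q r → q ≡ (q - r) + r
  eq = solve 2 (λ q r → q := (q :+ :- r) :+ r) refl
  diff : p * (q - r) ≡ 0ℚ
  diff = trans (solve 3 (λ p q r → p :* (q :+ :- r) := p :* q :+ :- (p :* r)) refl p q r)
    (trans (cong (λ s → s - p * r) pq≡pr) (ℚ.+-inverseʳ (p * r)))

*-nonNeg : ∀ {p q} → 0ℚ ≤ p → 0ℚ ≤ q → 0ℚ ≤ p * q
*-nonNeg {p} {q} 0≤p 0≤q = ℚ.nonNegative⁻¹ (p * q)
  {{ℚ.nonNeg*nonNeg⇒nonNeg p {{nonNegative 0≤p}} q {{nonNegative 0≤q}}}}

*-pos : ∀ {p q} → 0ℚ < p → 0ℚ < q → 0ℚ < p * q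
*-pos {p} {q} 0<p 0<q = ℚ.positive⁻¹ (p * q)
  {{ℚ.pos*pos⇒pos p {{positive 0<p}} q {{positive 0<q}}}}

neg*neg-pos : ∀ {p q} → p < 0ℚ → q < 0ℚ → 0ℚ < p * q
neg*neg-pos {p} {q} p<0 q<0 = ℚ.positive⁻¹ (p * q)
  {{ℚ.neg*neg⇒pos p {{negative p<0}} q {{negative q<0}}}}

square-nonNeg : ∀ p → 0ℚ ≤ p * p
square-nonNeg p with ℚ.<-cmp p 0ℚ
... | tri< p<0 _ _ = ℚ.<⇒≤ (neg*neg-pos p<0 p<0)
... | tri≈ _ refl _ = ℚ.≤-refl
... | tri> _ _ 0<p = ℚ.<⇒≤ (*-pos 0<p 0<p)

square≡0⇒≡0 : ∀ p → p * p ≡ 0ℚ → p ≡ 0ℚ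
square≡0⇒≡0 p p²≡0 with p ℚ.≟ 0ℚ
... | yes p≡0 = p≡0
... | no  p≢0 = p*q≡0⇒q≡0 p≢0 p²≡0

+-nonNeg : ∀ {p q} → 0ℚ ≤ p → 0ℚ ≤ q → 0ℚ ≤ p + q
+-nonNeg 0≤p 0≤q = ℚ.+-mono-≤ 0≤p 0≤q

nonNeg+nonNeg≡0 : ∀ {p q} → 0ℚ ≤ p → 0ℚ ≤ q → p + q ≡ 0ℚ → p ≡ 0ℚ × q ≡ 0ℚ
nonNeg+nonNeg≡0 {p} {q} 0≤p 0≤q p+q≡0 =
    ℚ.≤-antisym (subst₂ _≤_ (ℚ.+-identityʳ p) p+q≡0 (ℚ.+-monoʳ-≤ p 0≤q)) 0≤p
  , ℚ.≤-antisym (subst₂ _≤_ (ℚ.+-identityˡ q) p+q≡0 (ℚ.+-monoˡ-≤ q 0≤p)) 0≤q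

neg-pos : ∀ {p} → p < 0ℚ → 0ℚ < - p
neg-pos p<0 = ℚ.neg-antimono-< p<0

opaque
  -- Kept opaque: the ε-estimates use only the two properties of δ = ε / c, never its value as a
  -- fraction.
  divide : ∀ {c} ε → 0ℚ < ε → 0ℚ < c → ∃[ δ ] 0ℚ < δ × c * δ ≡ ε
  divide {c} ε 0<ε 0<c = 1/ c * ε , *-pos 0<1/c 0<ε , (begin
    c * (1/ c * ε)   ≡⟨ ℚ.*-assoc c (1/ c) ε ⟨
    (c * 1/ c) * ε   ≡⟨ cong (_* ε) (ℚ.*-inverseʳ c) ⟩
    1ℚ * ε           ≡⟨ ℚ.*-identityˡ ε ⟩
    ε                ∎)
    where
    open ≡-Reasoning
    instance
      c-positive : Positive c
      c-positive = positive 0<c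
      c-nonZero : NonZero c
      c-nonZero = ℚ.pos⇒nonZero c
    0<1/c : 0ℚ < 1/ c
    0<1/c = ℚ.positive⁻¹ (1/ c) {{ℚ.1/pos⇒pos c}}

*-mono-≤-nonNeg : ∀ {p q r s} → 0ℚ ≤ r → 0ℚ ≤ q → p ≤ q → r ≤ s → p * r ≤ q * s
*-mono-≤-nonNeg {p} {q} {r} {s} 0≤r 0≤q p≤q r≤s = ℚ.≤-trans
  (ℚ.*-monoʳ-≤-nonNeg r {{nonNegative 0≤r}} p≤q)
  (ℚ.*-monoˡ-≤-nonNeg q {{nonNegative 0≤q}} r≤s)

-- The difference is p² + p + 1. This makes p + 1 an upper bound for square roots of p, without any
-- case split at p = 1.
p<[p+1]² : ∀ {p} → 0ℚ ≤ p → p < (p + 1ℚ) * (p + 1ℚ)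
p<[p+1]² {p} 0≤p = subst₂ _<_ (ℚ.+-identityʳ p)
  (solve 1 (λ p → p :+ (p :* p :+ p :+ con 1ℚ) := (p :+ con 1ℚ) :* (p :+ con 1ℚ)) refl p)
  (ℚ.+-monoʳ-< p (ℚ.+-mono-≤-< (+-nonNeg (square-nonNeg p) 0≤p) (ℚ.positive⁻¹ 1ℚ)))

square-cancel-< : ∀ p q → 0ℚ ≤ q → p * p < q * q → p < q
square-cancel-< p q 0≤q p²<q² with p ℚ.<? q
... | yes p<q = p<q
... | no  p≮q = ⊥-elim (ℚ.<-irrefl refl (ℚ.<-≤-trans p²<q² (*-mono-≤-nonNeg 0≤q (ℚ.≤-trans 0≤q q≤p) q≤p q≤p)))
  where q≤p = ℚ.≮⇒≥ p≮q

i*j≢0 : ∀ {i j} → i ≢ 0ℤ → j ≢ 0ℤ → i ℤ.* j ≢ 0ℤ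
i*j≢0 {i} {j} i≢0 j≢0 ij≡0 with ℤ.i*j≡0⇒i≡0∨j≡0 i ij≡0
... | inj₁ i≡0 = i≢0 i≡0
... | inj₂ j≡0 = j≢0 j≡0

fromℤ≢0 : ∀ {i} → i ≢ 0ℤ → fromℤ i ≢ 0ℚ
fromℤ≢0 i≢0 eq = i≢0 (fromℤ-injective eq)

↧-clears : ∀ q → fromℤ (↧ q) * q ≡ fromℤ (↥ q)
↧-clears q@(mkℚ n d-1 _) = ℚ.toℚᵘ-injective (ℚᵘ.≃-trans
  (ℚ.toℚᵘ-homo-* (fromℤ (+ suc d-1)) q)
  (ℚᵘ.*≡* (begin
    + suc d-1 ℤ.* n ℤ.* + 1       ≡⟨ ℤ.*-identityʳ (+ suc d-1 ℤ.* n) ⟩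
    + suc d-1 ℤ.* n               ≡⟨ ℤ.*-comm (+ suc d-1) n ⟩
    n ℤ.* + suc d-1               ≡⟨ cong (λ d → n ℤ.* + d) (ℕ.*-identityˡ (suc d-1)) ⟨
    n ℤ.* + (1 ℕ.* suc d-1)       ∎)))
  where open ≡-Reasoning

↧≢0 : ∀ q → ↧ q ≢ 0ℤ
↧≢0 record{} ()

-- Common denominators of families of rationals

private
  clear-+ : ∀ N M p q → M * (N * p) + N * (M * q) ≡ (N * M) * (p + q)
  clear-+ = solve 4 (λ N M p q → M :* (N :* p) :+ N :* (M :* q) := (N :* M) :* (p :+ q)) refl

  clear-* : ∀ N M p q → (N * p) * (M * q) ≡ (N * M) * (p * q)
  clear-* = solve 4 (λ N M p q → (N :* p) :* (M :* q) := (N :* M) :* (p :* q)) refl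

  clear-neg : ∀ N p → - 1ℚ * (N * p) ≡ N * (- p)
  clear-neg = solve 2 (λ N p → con (- 1ℚ) :* (N :* p) := N :* (:- p)) refl

  clearˡ : ∀ N M q → M * (N * q) ≡ (N * M) * q
  clearˡ = solve 3 (λ N M q → M :* (N :* q) := (N :* M) :* q) refl

  clearʳ : ∀ N M q → N * (M * q) ≡ (N * M) * q
  clearʳ N M q = sym (ℚ.*-assoc N M q)

IsInteger : Pred ℚ 0ℓ
IsInteger q = ∃[ z ] q ≡ fromℤ z

integer-+ : ∀ {p q} → IsInteger p → IsInteger q → IsInteger (p + q)
integer-+ (z , refl) (w , refl) = z ℤ.+ w , sym (fromℤ-+ z w)

integer-* : ∀ {p q} → IsInteger p → IsInteger q → IsInteger (p * q)
integer-* (z , refl) (w , refl) = z ℤ.* w , sym (fromℤ-* z w)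

-- The index type may be infinite: in the end it ranges over all vectors of L. The denominator
-- carries no sign condition, so it can be built by multiplication alone.
record Bounded {I : Set} (f : I → ℚ) : Set where
  constructor bounded
  field
    denominator : ℤ
    nonzero     : denominator ≢ 0ℤ
    integer     : ∀ i → IsInteger (fromℤ denominator * f i)

bounded-const : ∀ {I : Set} q → Bounded {I} (λ _ → q)
bounded-const q = bounded (↧ q) (↧≢0 q) (λ _ → ↥ q , ↧-clears q)

bounded-+ : ∀ {I : Set} {f g : I → ℚ} → Bounded f → Bounded g → Bounded (λ i → f i + g i)
bounded-+ {f = f} {g} (bounded N N≢0 Nf) (bounded M M≢0 Mg) = bounded (N ℤ.* M) (i*j≢0 N≢0 M≢0) λ i →
  subst IsInteger (trans
      (clear-+ (fromℤ N) (fromℤ M) (f i) (g i))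
      (cong (_* (f i + g i)) (sym (fromℤ-* N M))))
    (integer-+ (integer-* (M , refl) (Nf i)) (integer-* (N , refl) (Mg i)))

bounded-* : ∀ {I : Set} {f g : I → ℚ} → Bounded f → Bounded g → Bounded (λ i → f i * g i)
bounded-* {f = f} {g} (bounded N N≢0 Nf) (bounded M M≢0 Mg) = bounded (N ℤ.* M) (i*j≢0 N≢0 M≢0) λ i →
  subst IsInteger (trans
      (clear-* (fromℤ N) (fromℤ M) (f i) (g i))
      (cong (_* (f i * g i)) (sym (fromℤ-* N M))))
    (integer-* (Nf i) (Mg i))

bounded-neg : ∀ {I : Set} {f : I → ℚ} → Bounded f → Bounded (λ i → - f i)
bounded-neg {f = f} (bounded N N≢0 Nf) = bounded N N≢0 λ i →
  subst IsInteger (clear-neg (fromℤ N) (f i))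
    (integer-* (ℤ.-1ℤ , refl) (Nf i))

-- A disjoint union of index types is the way to get one denominator for several families at once,
-- such as the four coordinates of a quaternion.
bounded-⊎ : ∀ {I J : Set} {f : I → ℚ} {g : J → ℚ} → Bounded f → Bounded g → Bounded [ f , g ]
bounded-⊎ {f = f} {g} (bounded N N≢0 Nf) (bounded M M≢0 Mg) = bounded (N ℤ.* M) (i*j≢0 N≢0 M≢0) λ
  { (inj₁ i) → subst IsInteger
      (trans (clearˡ (fromℤ N) (fromℤ M) (f i))
             (cong (_* f i) (sym (fromℤ-* N M))))
      (integer-* (M , refl) (Nf i))
  ; (inj₂ j) → subst IsInteger
      (trans (clearʳ (fromℤ N) (fromℤ M) (g j))
             (cong (_* g j) (sym (fromℤ-* N M))))
      (integer-* (N , refl) (Mg j))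
  }

bounded-finite : ∀ {k} (f : Fin k → ℚ) → Bounded f
bounded-finite {zero}  f = bounded 1ℤ (λ ()) λ ()
bounded-finite {suc k} f with bounded-⊎ {I = ⊤} (bounded-const (f zero)) (bounded-finite (λ i → f (suc i)))
... | bounded N N≢0 Nf = bounded N N≢0 λ { zero → Nf (inj₁ tt) ; (suc i) → Nf (inj₂ i) }

bounded-≗ : ∀ {I : Set} {f g : I → ℚ} → f ≗ g → Bounded f → Bounded g
bounded-≗ f≗g (bounded N N≢0 Nf) = bounded N N≢0 λ i →
  subst (λ q → IsInteger (fromℤ N * q)) (f≗g i) (Nf i)

positive-integer : ∀ {q} → 0ℚ < q → IsInteger q → ∃[ n ] q ≡ fromℤ (+ n)
positive-integer 0<q (+ n      , q≡)   = n , q≡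
positive-integer 0<q (-[1+ n ] , refl) with fromℤ-cancel-< {0ℤ} { -[1+ n ]} 0<q
... | ()

-- Φ v, Φ (act v), Φ (act (act v)), … would be a strictly decreasing sequence of
-- positive integers.
module _ {A : Set} (Φ : A → ℚ) (Φ-integer : ∀ v → IsInteger (Φ v)) (act : A → A) (ν : ℚ)
         (Φ-act : ∀ v → Φ (act v) ≡ ν * Φ v) (0<ν : 0ℚ < ν) (ν<1 : ν < 1ℚ) where

  no-contraction : ∀ v → 0ℚ < Φ v → ⊥
  no-contraction v 0<Φv with positive-integer 0<Φv (Φ-integer v)
  ... | n , Φv≡n = <-rec (λ n → ∀ v → 0ℚ < Φ v → Φ v ≡ fromℤ (+ n) → ⊥) step n v 0<Φv Φv≡n
    where
    step : ∀ n → (∀ {m} → m ℕ.< n → ∀ v → 0ℚ < Φ v → Φ v ≡ fromℤ (+ m) → ⊥) →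
           ∀ v → 0ℚ < Φ v → Φ v ≡ fromℤ (+ n) → ⊥
    step n rec v 0<Φv Φv≡n with positive-integer 0<Φ′ (Φ-integer (act v))
      where
      0<Φ′ : 0ℚ < Φ (act v)
      0<Φ′ = subst (0ℚ <_) (sym (Φ-act v)) (*-pos 0<ν 0<Φv)
    ... | m , Φ′≡m = rec m<n (act v) (subst (0ℚ <_) (sym (Φ-act v)) (*-pos 0<ν 0<Φv)) Φ′≡m
      where
      Φ′<Φ : Φ (act v) < Φ v
      Φ′<Φ = subst₂ _<_ (sym (Φ-act v)) (ℚ.*-identityˡ (Φ v)) (ℚ.*-monoˡ-<-pos (Φ v) {{positive 0<Φv}} ν<1)
      m<n : m ℕ.< n
      m<n = ℤ.drop‿+<+ (fromℤ-cancel-< {+ m} {+ n} (subst₂ _<_ Φ′≡m Φv≡n Φ′<Φ))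

1/pos : ∀ {p q} → q * p ≡ 1ℚ → 0ℚ < p → 0ℚ < q
1/pos {p} {q} qp≡1 0<p = ℚ.*-cancelʳ-<-nonNeg p {{nonNegative (ℚ.<⇒≤ 0<p)}}
  (subst₂ _<_ (sym (ℚ.*-zeroˡ p)) (sym qp≡1) (ℚ.positive⁻¹ 1ℚ))

≤∧≢⇒< : ∀ {q} → 0ℚ ≤ q → q ≢ 0ℚ → 0ℚ < q
≤∧≢⇒< {q} 0≤q q≢0 with ℚ.<-cmp 0ℚ q
... | tri< 0<q _ _ = 0<q
... | tri≈ _ 0≡q _ = ⊥-elim (q≢0 (sym 0≡q))
... | tri> _ _ q<0 = ⊥-elim (ℚ.<-irrefl refl (ℚ.≤-<-trans 0≤q q<0))

-- The finite adeles as fractions of ℤ̂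

n∣n! : ∀ n .{{_ : ℕ.NonZero n}} → n ℕ.∣ n !
n∣n! (suc n) = ℕ.m∣m*n (n !)

k!∣n! : ∀ {k n} → k ℕ.≤ n → + (k !) ∣ + (n !)
k!∣n! k≤n = ∣ᵤ⇒∣ (ℕ.m≤n⇒m!∣n! k≤n)

module Fractions where
  open Adelic renaming (fromℤ to constant)

  -- The congruences between consecutive levels telescope, since n! divides the modulus of every
  -- higher level.
  residue-compatible : ∀ x j n → + (n !) ∣ residue x (j ℕ.+ n) ℤ.- residue x n
  residue-compatible x zero n = divides 0ℤ (ℤ.+-inverseʳ (residue x n))
  residue-compatible x (suc j) n = subst (+ (n !) ∣_)
    (eq (residue x (suc j ℕ.+ n)) (residue x (j ℕ.+ n)) (residue x n))
    (∣m∣n⇒∣m+n (∣-trans (k!∣n! (ℕ.m≤n+m n j)) (compatible x (j ℕ.+ n))) (residue-compatible x j n))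
    where
    eq : ∀ p q r → (p ℤ.- q) ℤ.+ (q ℤ.- r) ≡ p ℤ.- r
    eq = solve-∀

  -- Each ℤ/n! may have e-torsion but the limit has none: e is cancelled at a level whose modulus is
  -- divisible by n! e, and the result is carried back down to level n.
  torsion-free : ∀ w e .{{_ : ℕ.NonZero e}} →
    (∀ n → + (n !) ∣ residue w n ℤ.* + e) → ∀ n → + (n !) ∣ residue w n
  torsion-free w e we≋0 n = subst (+ (n !) ∣_) (eq (residue w k) (residue w n))
    (∣m∣n⇒∣m-n n!∣wk (residue-compatible w (n ! ℕ.* e) n))
    where
    -- Being at least n! e, this k has n! e as a divisor of k!; the summand n gives it the shape j +
    -- n of `residue-compatible`.
    k = n ! ℕ.* e ℕ.+ n
    instance
      n!e≢0 : ℕ.NonZero (n ! ℕ.* e)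
      n!e≢0 = ℕ.m*n≢0 (n !) e {{ n ℕ.!≢0 }}
      e≢0 : ℤ.NonZero (+ e)
      e≢0 = ℤ.≢-nonZero (λ e≡0 → ℕ.≢-nonZero⁻¹ e (ℤ.+-injective e≡0))
    n!e∣k! : + (n !) ℤ.* + e ∣ + (k !)
    n!e∣k! = subst (_∣ + (k !)) (ℤ.pos-* (n !) e)
      (∣-trans (∣ᵤ⇒∣ (n∣n! (n ! ℕ.* e))) (k!∣n! (ℕ.m≤m+n (n ! ℕ.* e) n)))
    n!∣wk : + (n !) ∣ residue w k
    n!∣wk = *-cancelʳ-∣ (+ e) (∣-trans n!e∣k! (we≋0 k))
    eq : ∀ p q → p ℤ.- (p ℤ.- q) ≡ q
    eq = solve-∀

  private
    module F = RawRing fractions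
    infix 4 _≈_
    _≈_ = F._≈_

  -- The ring axioms that are equations hold already between integers at every level. Divisibility
  -- is left to symmetry, transitivity and the congruence laws.
  ≈-pointwise : ∀ f g → (∀ n → residue (numerator f) n ℤ.* + denominator g ≡
                               residue (numerator g) n ℤ.* + denominator f) → f ≈ g
  ≈-pointwise f g eq n = divides 0ℤ (ℤ.i≡j⇒i-j≡0 (eq n))

  ≈-refl : ∀ {f} → f ≈ f
  ≈-refl {f} = ≈-pointwise f f (λ _ → refl)

  ≈-sym : ∀ {f g} → f ≈ g → g ≈ f
  ≈-sym {x over d} {y over e} f≈g n = subst (+ (n !) ∣_)
    (eq (residue x n ℤ.* + e) (residue y n ℤ.* + d)) (∣m⇒∣-m (f≈g n))
    where
    eq : ∀ p q → ℤ.- (p ℤ.- q) ≡ q ℤ.- p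
    eq = solve-∀

  -- Combining the two congruences only shows that e times the wanted difference vanishes, where e
  -- is the middle denominator. Removing e is the purpose of `torsion-free`.
  ≈-trans : ∀ {f g h} → f ≈ g → g ≈ h → f ≈ h
  ≈-trans {x over d} {y over e} {z over f} p q =
    torsion-free (x ⊠ constant (+ f) ⊞ ⊟ (z ⊠ constant (+ d))) e λ n → subst (+ (n !) ∣_)
      (eq (residue x n) (residue y n) (residue z n) (+ d) (+ e) (+ f))
      (∣m∣n⇒∣m+n (∣m⇒∣m*n (+ f) (p n)) (∣m⇒∣m*n (+ d) (q n)))
    where
    eq : ∀ x y z d e f → (x ℤ.* e ℤ.- y ℤ.* d) ℤ.* f ℤ.+ (y ℤ.* f ℤ.- z ℤ.* e) ℤ.* d ≡ (x ℤ.* f ℤ.- z ℤ.* d) ℤ.* e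
    eq = solve-∀

  +-cong : ∀ {f f′ g g′} → f ≈ f′ → g ≈ g′ → f F.+ g ≈ f′ F.+ g′
  +-cong {x over d} {x′ over d′} {y over e} {y′ over e′} p q n
    = subst₂ (λ u v → + (n !) ∣ (residue x n ℤ.* + e ℤ.+ residue y n ℤ.* + d) ℤ.* u
                             ℤ.- (residue x′ n ℤ.* + e′ ℤ.+ residue y′ n ℤ.* + d′) ℤ.* v)
      (sym (ℤ.pos-* d′ e′)) (sym (ℤ.pos-* d e)) $ subst (+ (n !) ∣_)
      (eq (residue x n) (residue x′ n) (residue y n) (residue y′ n) (+ d) (+ d′) (+ e) (+ e′))
      (∣m∣n⇒∣m+n (∣m⇒∣m*n (+ e ℤ.* + e′) (p n)) (∣m⇒∣m*n (+ d ℤ.* + d′) (q n)))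
    where
    eq : ∀ x x′ y y′ d d′ e e′ →
      (x ℤ.* d′ ℤ.- x′ ℤ.* d) ℤ.* (e ℤ.* e′) ℤ.+ (y ℤ.* e′ ℤ.- y′ ℤ.* e) ℤ.* (d ℤ.* d′) ≡
      (x ℤ.* e ℤ.+ y ℤ.* d) ℤ.* (d′ ℤ.* e′) ℤ.- (x′ ℤ.* e′ ℤ.+ y′ ℤ.* d′) ℤ.* (d ℤ.* e)
    eq = solve-∀

  *-cong : ∀ {f f′ g g′} → f ≈ f′ → g ≈ g′ → f F.* g ≈ f′ F.* g′
  *-cong {x over d} {x′ over d′} {y over e} {y′ over e′} p q n
    = subst₂ (λ u v → + (n !) ∣ residue x n ℤ.* residue y n ℤ.* u ℤ.- residue x′ n ℤ.* residue y′ n ℤ.* v)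
      (sym (ℤ.pos-* d′ e′)) (sym (ℤ.pos-* d e)) $ subst (+ (n !) ∣_)
      (eq (residue x n) (residue x′ n) (residue y n) (residue y′ n) (+ d) (+ d′) (+ e) (+ e′))
      (∣m∣n⇒∣m+n (∣m⇒∣m*n (residue y n ℤ.* + e′) (p n)) (∣m⇒∣m*n (residue x′ n ℤ.* + d) (q n)))
    where
    eq : ∀ x x′ y y′ d d′ e e′ →
      (x ℤ.* d′ ℤ.- x′ ℤ.* d) ℤ.* (y ℤ.* e′) ℤ.+ (y ℤ.* e′ ℤ.- y′ ℤ.* e) ℤ.* (x′ ℤ.* d) ≡
      (x ℤ.* y) ℤ.* (d′ ℤ.* e′) ℤ.- (x′ ℤ.* y′) ℤ.* (d ℤ.* e)
    eq = solve-∀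

  -‿cong : ∀ {f g} → f ≈ g → F.- f ≈ F.- g
  -‿cong {x over d} {y over e} p n = subst (+ (n !) ∣_)
    (eq (residue x n) (residue y n) (+ d) (+ e)) (∣m⇒∣-m (p n))
    where
    eq : ∀ x y d e → ℤ.- (x ℤ.* e ℤ.- y ℤ.* d) ≡ (ℤ.- x) ℤ.* e ℤ.- (ℤ.- y) ℤ.* d
    eq = solve-∀

  +-comm : ∀ f g → f F.+ g ≈ g F.+ f
  +-comm f@(x over d) g@(y over e) = ≈-pointwise (f F.+ g) (g F.+ f) λ n →
    cong₂ ℤ._*_ (ℤ.+-comm (residue x n ℤ.* + e) (residue y n ℤ.* + d)) (cong +_ (ℕ.*-comm e d))

  +-assoc : ∀ f g h → (f F.+ g) F.+ h ≈ f F.+ (g F.+ h)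
  +-assoc f@(x over d) g@(y over e) h@(z over k) = ≈-pointwise ((f F.+ g) F.+ h) (f F.+ (g F.+ h)) λ n →
    law (residue x n) (residue y n) (residue z n) (+ d) (+ e) (+ k)
      (ℤ.pos-* d e) (ℤ.pos-* e k) (ℤ.pos-* d (e ℕ.* k)) (ℤ.pos-* (d ℕ.* e) k)
    where
    eq : ∀ x y z d e f →
      ((x ℤ.* e ℤ.+ y ℤ.* d) ℤ.* f ℤ.+ z ℤ.* (d ℤ.* e)) ℤ.* (d ℤ.* (e ℤ.* f)) ≡
      (x ℤ.* (e ℤ.* f) ℤ.+ (y ℤ.* f ℤ.+ z ℤ.* e) ℤ.* d) ℤ.* (d ℤ.* e ℤ.* f)
    eq = solve-∀
    -- Denominators are multiplied in ℕ and then injected into ℤ, which the integer solver cannot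
    -- see through. The injected products are therefore variables, tied to integer products by
    -- equations.
    law : ∀ x y z d e f {de ef d[ef] [de]f} →
      de ≡ d ℤ.* e → ef ≡ e ℤ.* f → d[ef] ≡ d ℤ.* ef → [de]f ≡ de ℤ.* f →
      ((x ℤ.* e ℤ.+ y ℤ.* d) ℤ.* f ℤ.+ z ℤ.* de) ℤ.* d[ef] ≡
      (x ℤ.* ef ℤ.+ (y ℤ.* f ℤ.+ z ℤ.* e) ℤ.* d) ℤ.* [de]f
    law x y z d e f refl refl refl refl = eq x y z d e f

  +-identityˡ : ∀ f → F.0# F.+ f ≈ f
  +-identityˡ f@(x over d) = ≈-pointwise (F.0# F.+ f) (f) λ n →
    cong₂ ℤ._*_ (eq (residue x n) (+ d)) (cong +_ (sym (ℕ.*-identityˡ d)))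
    where
    eq : ∀ x d → 0ℤ ℤ.* d ℤ.+ x ℤ.* 1ℤ ≡ x
    eq = solve-∀

  -‿inverseˡ : ∀ f → (F.- f) F.+ f ≈ F.0#
  -‿inverseˡ f@(x over d) = ≈-pointwise ((F.- f) F.+ f) (F.0#) λ n → eq (residue x n) (+ d) (+ (d ℕ.* d))
    where
    eq : ∀ x d e → ((ℤ.- x) ℤ.* d ℤ.+ x ℤ.* d) ℤ.* 1ℤ ≡ 0ℤ ℤ.* e
    eq = solve-∀

  *-comm : ∀ f g → f F.* g ≈ g F.* f
  *-comm f@(x over d) g@(y over e) = ≈-pointwise (f F.* g) (g F.* f) λ n →
    cong₂ ℤ._*_ (ℤ.*-comm (residue x n) (residue y n)) (cong +_ (ℕ.*-comm e d))

  *-assoc : ∀ f g h → (f F.* g) F.* h ≈ f F.* (g F.* h)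
  *-assoc f@(x over d) g@(y over e) h@(z over k) = ≈-pointwise ((f F.* g) F.* h) (f F.* (g F.* h)) λ n →
    cong₂ ℤ._*_ (ℤ.*-assoc (residue x n) (residue y n) (residue z n)) (cong +_ (sym (ℕ.*-assoc d e k)))

  *-identityˡ : ∀ f → F.1# F.* f ≈ f
  *-identityˡ f@(x over d) = ≈-pointwise (F.1# F.* f) (f) λ n →
    cong₂ ℤ._*_ (ℤ.*-identityˡ (residue x n)) (cong +_ (sym (ℕ.*-identityˡ d)))

  *-distribˡ-+ : ∀ f g h → f F.* (g F.+ h) ≈ f F.* g F.+ f F.* h
  *-distribˡ-+ f@(x over d) g@(y over e) h@(z over k) = ≈-pointwise (f F.* (g F.+ h)) (f F.* g F.+ f F.* h) λ n →
    law (residue x n) (residue y n) (residue z n) (+ d) (+ e) (+ k)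
      (ℤ.pos-* d e) (ℤ.pos-* d k) (ℤ.pos-* (d ℕ.* e) (d ℕ.* k))
      (trans (ℤ.pos-* d (e ℕ.* k)) (cong (+ d ℤ.*_) (ℤ.pos-* e k)))
    where
    eq : ∀ x y z d e f →
      x ℤ.* (y ℤ.* f ℤ.+ z ℤ.* e) ℤ.* (d ℤ.* e ℤ.* (d ℤ.* f)) ≡
      (x ℤ.* y ℤ.* (d ℤ.* f) ℤ.+ x ℤ.* z ℤ.* (d ℤ.* e)) ℤ.* (d ℤ.* (e ℤ.* f))
    eq = solve-∀
    law : ∀ x y z d e f {de df dedf def} →
      de ≡ d ℤ.* e → df ≡ d ℤ.* f → dedf ≡ de ℤ.* df → def ≡ d ℤ.* (e ℤ.* f) →
      x ℤ.* (y ℤ.* f ℤ.+ z ℤ.* e) ℤ.* dedf ≡ (x ℤ.* y ℤ.* df ℤ.+ x ℤ.* z ℤ.* de) ℤ.* def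
    law x y z d e f refl refl refl refl = eq x y z d e f

  isCommutativeRing : IsCommutativeRing _≈_ F._+_ F._*_ F.-_ F.0# F.1#
  isCommutativeRing = record
    { isRing = record
      { +-isAbelianGroup = record
        { isGroup = record
          { isMonoid = record
            { isSemigroup = record
              { isMagma = record
                { isEquivalence = record
                  { refl = λ {f} → ≈-refl {f} ; sym = λ {f} {g} → ≈-sym {f} {g} ; trans = λ {f} {g} {h} → ≈-trans {f} {g} {h} }
                ; ∙-cong = λ {f} {f′} {g} {g′} → +-cong {f} {f′} {g} {g′}
                }
              ; assoc = +-assoc
              }
            ; identity = +-identityˡ , λ f → ≈-trans {f F.+ F.0#} {F.0# F.+ f} {f} (+-comm f F.0#) (+-identityˡ f)
            }
          ; inverse = -‿inverseˡ , λ f → ≈-trans {f F.+ F.- f} {F.- f F.+ f} {F.0#} (+-comm f (F.- f)) (-‿inverseˡ f)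
          ; ⁻¹-cong = λ {f} {g} → -‿cong {f} {g}
          }
        ; comm = +-comm
        }
      ; *-cong = λ {f} {f′} {g} {g′} → *-cong {f} {f′} {g} {g′}
      ; *-assoc = *-assoc
      ; *-identity = *-identityˡ , λ f → ≈-trans {f F.* F.1#} {F.1# F.* f} {f} (*-comm f F.1#) (*-identityˡ f)
      ; distrib = *-distribˡ-+ , λ f g h →
          ≈-trans {(g F.+ h) F.* f} {f F.* (g F.+ h)} {g F.* f F.+ h F.* f} (*-comm (g F.+ h) f)
            (≈-trans {f F.* (g F.+ h)} {f F.* g F.+ f F.* h} {g F.* f F.+ h F.* f} (*-distribˡ-+ f g h)
              (+-cong {f F.* g} {g F.* f} {f F.* h} {h F.* f} (*-comm f g) (*-comm f h)))
      }
    ; *-comm = *-comm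
    }

  commutativeRing : CommutativeRing 0ℓ 0ℓ
  commutativeRing = record { isCommutativeRing = isCommutativeRing }

  embed : ℚ → Fraction
  embed = Extension.embed extension

  -- Sums and products in ℚ are reduced to lowest terms while those of `fractions` are not. The
  -- unnormalised rationals have the same numerators and denominators as `fractions`, so their
  -- equivalence is the cross-multiplied equation.
  cross-multiplied : ∀ r s → ℚ.toℚᵘ r ℚᵘ.≃ s → ↥ r ℤ.* ℚᵘ.↧ s ≡ ℚᵘ.↥ s ℤ.* ℚ.↧ r
  cross-multiplied record{} _ r≃s = ℚᵘ.drop-*≡* r≃s

  embed-+ : ∀ p q → embed (p ℚ.+ q) ≈ embed p F.+ embed q
  embed-+ p@record{} q@record{} = ≈-pointwise (embed (p ℚ.+ q)) (embed p F.+ embed q)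
    (λ _ → cross-multiplied (p ℚ.+ q) (ℚ.toℚᵘ p ℚᵘ.+ ℚ.toℚᵘ q) (ℚ.toℚᵘ-homo-+ p q))

  embed-* : ∀ p q → embed (p ℚ.* q) ≈ embed p F.* embed q
  embed-* p@record{} q@record{} = ≈-pointwise (embed (p ℚ.* q)) (embed p F.* embed q)
    (λ _ → cross-multiplied (p ℚ.* q) (ℚ.toℚᵘ p ℚᵘ.* ℚ.toℚᵘ q) (ℚ.toℚᵘ-homo-* p q))

  embed-neg : ∀ p → embed (ℚ.- p) ≈ F.- embed p
  embed-neg p@record{} = ≈-pointwise (embed (ℚ.- p)) (F.- embed p)
    (λ _ → cross-multiplied (ℚ.- p) (ℚᵘ.- ℚ.toℚᵘ p) (ℚ.toℚᵘ-homo‿- p))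

-- Real quaternions: being a division ring forces a, b < 0

module RealQuaternions where
  open Reals

  opaque
    -- 1 / (n + 1), in lowest terms as written because 1 is coprime to everything. It is the
    -- precision of the n-th approximation to a square root.
    unitFraction : ℕ → ℚ
    unitFraction n = mkℚ (+ 1) n (1-coprimeTo (suc n))

    0<unitFraction : ∀ n → 0ℚ < unitFraction n
    0<unitFraction n = ℚ.positive⁻¹ (unitFraction n)

    unitFraction-small : ∀ ε → 0ℚ < ε → ∃[ N ] ∀ n → N ℕ.≤ n → unitFraction n ≤ ε
    unitFraction-small ε@(mkℚ (+ suc k) d _) 0<ε = suc d , λ n d<n → *≤* (begin
      + 1 ℤ.* + suc d         ≡⟨ ℤ.*-identityˡ (+ suc d) ⟩
      + suc d                 ≤⟨ +≤+ (ℕ.≤-trans d<n (ℕ.≤-trans (ℕ.n≤1+n n) (ℕ.m≤m+n (suc n) (k ℕ.* suc n)))) ⟩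
      + (suc k ℕ.* suc n)     ≡⟨ ℤ.pos-* (suc k) (suc n) ⟩
      + suc k ℤ.* + suc n     ∎)
      where open ℤ.≤-Reasoning
    unitFraction-small (mkℚ (+ zero) d _) (*<* (ℤ.+<+ ()))
    unitFraction-small (mkℚ (-[1+ k ]) d _) (*<* ())

  -- A rational is at most the absolute value of its numerator, as its denominator is at least 1;
  -- this is applied to p / δ.
  archimedean : ∀ {δ} p → 0ℚ < δ → ∃[ k ] p ≤ fromℤ (+ k) * δ
  archimedean {δ} p 0<δ = ℤ.∣ ↥ q ∣ ,
    subst (_≤ fromℤ (+ ℤ.∣ ↥ q ∣) * δ) (trans (ℚ.*-assoc p (1/ δ) δ) (trans (cong (p *_) (ℚ.*-inverseˡ δ)) (ℚ.*-identityʳ p)))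
      (ℚ.*-monoʳ-≤-nonNeg δ {{ℚ.pos⇒nonNeg δ}} (bound q))
    where
    instance
      δ-positive : Positive δ
      δ-positive = positive 0<δ
      δ-nonZero : NonZero δ
      δ-nonZero = ℚ.pos⇒nonZero δ
    q = p * 1/ δ
    bound : ∀ q → q ≤ fromℤ (+ ℤ.∣ ↥ q ∣)
    bound (mkℚ (+ n) d _) = *≤* (begin
      + n ℤ.* + 1         ≡⟨ ℤ.*-identityʳ (+ n) ⟩
      + n                 ≤⟨ +≤+ (ℕ.m≤m*n n (suc d)) ⟩
      + (n ℕ.* suc d)     ≡⟨ ℤ.pos-* n (suc d) ⟩
      + n ℤ.* + suc d     ∎)
      where open ℤ.≤-Reasoning
    bound (mkℚ -[1+ n ] d _) = *≤* ℤ.-≤+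

  opaque
    -- The grid of multiples of δ is walked downwards until a square drops to at most a. The point
    -- just above the stopping point still has a square exceeding a.
    rational-square-below : ∀ {a δ} → 0ℚ < a → 0ℚ < δ →
      ∃[ r ] 0ℚ ≤ r × r * r ≤ a × a < (r + δ) * (r + δ)
    rational-square-below {a} {δ} 0<a 0<δ with archimedean (a + 1ℚ) 0<δ
    -- The search starts at kδ ≥ a + 1, whose square exceeds a. It cannot reach 0 because a is
    -- positive.
    ... | k , a+1≤kδ = search k (ℚ.<-≤-trans (p<[p+1]² (ℚ.<⇒≤ 0<a)) (*-mono-≤-nonNeg 0≤a+1 (ℚ.≤-trans 0≤a+1 a+1≤kδ) a+1≤kδ a+1≤kδ))
      where
      0≤a+1 : 0ℚ ≤ a + 1ℚ
      0≤a+1 = +-nonNeg (ℚ.<⇒≤ 0<a) (ℚ.nonNegative⁻¹ 1ℚ)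

      suc-δ : ∀ k → fromℤ (+ suc k) * δ ≡ fromℤ (+ k) * δ + δ
      suc-δ k = trans (cong (_* δ) (trans (cong fromℤ (ℤ.+-comm (+ 1) (+ k))) (fromℤ-+ (+ k) (+ 1)))) (solve 2 (λ k δ → (k :+ con 1ℚ) :* δ := k :* δ :+ δ) refl (fromℤ (+ k)) δ)

      search : ∀ k → a < (fromℤ (+ k) * δ) * (fromℤ (+ k) * δ) →
               ∃[ r ] 0ℚ ≤ r × r * r ≤ a × a < (r + δ) * (r + δ)
      search zero a<0 = ⊥-elim (ℚ.<-asym 0<a (subst (a <_) (solve 1 (λ δ → (con 0ℚ :* δ) :* (con 0ℚ :* δ) := con 0ℚ) refl δ) a<0))
      search (suc k) a<[k+1]² with (fromℤ (+ k) * δ) * (fromℤ (+ k) * δ) ℚ.≤? a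
      ... | yes k²≤a = fromℤ (+ k) * δ , *-nonNeg (ℚ.nonNegative⁻¹ (fromℤ (+ k))) (ℚ.<⇒≤ 0<δ) , k²≤a
                     , subst (λ r → a < r * r) (suc-δ k) a<[k+1]²
      ... | no  k²≰a = search k (ℚ.≰⇒> k²≰a)

  ∣p∣≤ : ∀ {p q} → p ≤ q → - p ≤ q → ∣ p ∣ ≤ q
  ∣p∣≤ {p} {q} p≤q -p≤q with ℚ.∣p∣≡p∨∣p∣≡-p p
  ... | inj₁ ∣p∣≡p  = subst (_≤ q) (sym ∣p∣≡p) p≤q
  ... | inj₂ ∣p∣≡-p = subst (_≤ q) (sym ∣p∣≡-p) -p≤q

  p<q+r⇒p-q≤r : ∀ p q r → p < q + r → p - q ≤ r
  p<q+r⇒p-q≤r p q r p<q+r = subst (p - q ≤_)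
    (solve 2 (λ q r → (q :+ r) :+ :- q := r) refl q r) (ℚ.+-monoˡ-≤ (- q) (ℚ.<⇒≤ p<q+r))

  module _ {a : ℚ} (0<a : 0ℚ < a) where

    private
      root : ℕ → ℚ
      root n = proj₁ (rational-square-below 0<a (0<unitFraction n))

      root-nonNeg : ∀ n → 0ℚ ≤ root n
      root-nonNeg n = proj₁ (proj₂ (rational-square-below 0<a (0<unitFraction n)))

      root²≤a : ∀ n → root n * root n ≤ a
      root²≤a n = proj₁ (proj₂ (proj₂ (rational-square-below 0<a (0<unitFraction n))))

      a<[root+δ]² : ∀ n → a < (root n + unitFraction n) * (root n + unitFraction n)
      a<[root+δ]² n = proj₂ (proj₂ (proj₂ (rational-square-below 0<a (0<unitFraction n))))

      root-δ-nonNeg : ∀ n → 0ℚ ≤ root n + unitFraction n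
      root-δ-nonNeg n = +-nonNeg (root-nonNeg n) (ℚ.<⇒≤ (0<unitFraction n))

      -- The chain rᵢ² ≤ a < (rⱼ + δⱼ)² compares a root from below with one from above at a
      -- different precision. Used with i and j in both orders, it yields the Cauchy property.
      root-difference : ∀ i j → root i - root j ≤ unitFraction j
      root-difference i j = p<q+r⇒p-q≤r (root i) (root j) (unitFraction j)
        (square-cancel-< (root i) (root j + unitFraction j) (root-δ-nonNeg j) (ℚ.≤-<-trans (root²≤a i) (a<[root+δ]² j)))

    √ : ℝ
    √ = record
      { approx   = root
      ; isCauchy = λ ε 0<ε →
          let (N , small) = unitFraction-small ε 0<ε
          in N , λ i j i≥N j≥N → ∣p∣≤
            (ℚ.≤-trans (root-difference i j) (small j j≥N))
            (subst (_≤ ε) (solve 2 (λ p q → q :+ :- p := :- (p :+ :- q)) refl (root i) (root j))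
              (ℚ.≤-trans (root-difference j i) (small i i≥N)))
      }

    -- From r² ≤ a < (r + δ)² the defect a - r² is at most (2r + δ) δ. With r ≤ a + 1 and δ ≤ 1 the
    -- first factor stays below the constant 2 (a + 1) + 1, so small δ suffices.
    √-square : (√ ⊠ √) ≃ constant a
    √-square ε 0<ε with divide ε 0<ε 0<C
      where
      0<C : 0ℚ < (a + 1ℚ) + (a + 1ℚ) + 1ℚ
      0<C = ℚ.+-mono-< (ℚ.+-mono-< 0<a+1 0<a+1) (ℚ.positive⁻¹ 1ℚ)
        where
        0<a+1 = ℚ.+-mono-< 0<a (ℚ.positive⁻¹ 1ℚ)
    ... | δ , 0<δ , Cδ≡ε with unitFraction-small δ 0<δ | unitFraction-small 1ℚ (ℚ.positive⁻¹ 1ℚ)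
    ... | N , small | N₁ , ≤1 = N ℕ.+ N₁ , λ n n≥ → ∣p∣≤
      (ℚ.≤-trans (subst (root n * root n - a ≤_) (ℚ.+-inverseʳ a) (ℚ.+-monoˡ-≤ (- a) (root²≤a n))) (ℚ.<⇒≤ 0<ε))
      (subst (_≤ ε) (solve 2 (λ r a → a :+ :- r := :- (r :+ :- a)) refl (root n * root n) a)
        (ℚ.≤-trans (p<q+r⇒p-q≤r a (root n * root n) ((root n + root n + unitFraction n) * unitFraction n) (subst (a <_)
            (solve 2 (λ r δ → (r :+ δ) :* (r :+ δ) := r :* r :+ (r :+ r :+ δ) :* δ) refl (root n) (unitFraction n))
            (a<[root+δ]² n)))
          (subst ((root n + root n + unitFraction n) * unitFraction n ≤_) Cδ≡ε
            (*-mono-≤-nonNeg (ℚ.<⇒≤ (0<unitFraction n)) 0≤C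
              (ℚ.+-mono-≤ (ℚ.+-mono-≤ (root≤ n) (root≤ n)) (≤1 n (ℕ.m+n≤o⇒n≤o N n≥)))
              (small n (ℕ.m+n≤o⇒m≤o N n≥))))))
      where
      0≤a+1 : 0ℚ ≤ a + 1ℚ
      0≤a+1 = +-nonNeg (ℚ.<⇒≤ 0<a) (ℚ.nonNegative⁻¹ 1ℚ)
      0≤C : 0ℚ ≤ (a + 1ℚ) + (a + 1ℚ) + 1ℚ
      0≤C = +-nonNeg (+-nonNeg 0≤a+1 0≤a+1) (ℚ.nonNegative⁻¹ 1ℚ)
      root≤ : ∀ n → root n ≤ a + 1ℚ
      root≤ n = ℚ.<⇒≤ (square-cancel-< (root n) (a + 1ℚ) 0≤a+1 (ℚ.≤-<-trans (root²≤a n) (p<[p+1]² (ℚ.<⇒≤ 0<a))))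

  eventually-bounded : ∀ (x : ℝ) → ∃[ B ] 0ℚ < B × ∃[ N ] ∀ n → N ℕ.≤ n → ∣ approx x n ∣ ≤ B
  eventually-bounded x with isCauchy x 1ℚ (ℚ.positive⁻¹ 1ℚ)
  ... | N , close = ∣ approx x N ∣ + 1ℚ
                  , ℚ.+-mono-≤-< (ℚ.0≤∣p∣ (approx x N)) (ℚ.positive⁻¹ 1ℚ)
                  , N , λ n N≤n → subst (λ t → ∣ t ∣ ≤ ∣ approx x N ∣ + 1ℚ)
                      (solve 2 (λ s t → s :+ (t :+ :- s) := t) refl (approx x N) (approx x n))
                      (ℚ.≤-trans (ℚ.∣p+q∣≤∣p∣+∣q∣ (approx x N) (approx x n - approx x N))
                        (ℚ.+-monoʳ-≤ ∣ approx x N ∣ (close n N N≤n ℕ.≤-refl)))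

  private
    ¼ ¾ : ℚ
    ¼ = ½ * ½
    ¾ = ¼ + ¼ + ¼

    ¾<1 : ¾ < 1ℚ
    ¾<1 = from-yes (¾ ℚ.<? 1ℚ)

  -- If s t + c x ≈ 1 and s x + t ≈ 0, then 1 ≈ s t + c x ≈ (c - s²) x ≈ 0.
  isotropic-estimate : ∀ s t x c {S X δ δ′} → 0ℚ ≤ S → 0ℚ ≤ X → ∣ s ∣ ≤ S → ∣ x ∣ ≤ X →
    S * δ ≡ ¼ → X * δ′ ≡ ¼ →
    ∣ s * t + c * x - 1ℚ ∣ ≤ ¼ → ∣ s * x + t - 0ℚ ∣ ≤ δ → ∣ s * s - c ∣ ≤ δ′ → ⊥
  isotropic-estimate s t x c {S} {X} {δ} {δ′} 0≤S 0≤X s≤S x≤X Sδ≡¼ Xδ′≡¼ A≤¼ B≤δ C≤δ′ =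
    ℚ.<-irrefl refl (ℚ.≤-<-trans 1≤¾ ¾<1)
    where
    A B C : ℚ
    A = s * t + c * x - 1ℚ
    B = s * x + t - 0ℚ
    C = s * s - c
    -- An exact identity in which the unknowns cancel: `A`, `B` and `C` are the errors in the three
    -- approximate equations. Each of the three terms is at most ¼, so 1 ≤ ¾ would follow.
    sum≡1 : - A + s * B - x * C ≡ 1ℚ
    sum≡1 = solve 4 (λ s t x c → (:- (s :* t :+ c :* x :+ :- con 1ℚ) :+ s :* (s :* x :+ t :+ :- con 0ℚ)) :+ :- (x :* (s :* s :+ :- c)) := con 1ℚ) refl s t x c
    product-bound : ∀ {p P q Q} → 0ℚ ≤ P → ∣ p ∣ ≤ P → ∣ q ∣ ≤ Q → P * Q ≡ ¼ → ∣ p * q ∣ ≤ ¼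
    product-bound {p} {P} {q} {Q} 0≤P p≤P q≤Q PQ≡¼ = subst₂ _≤_ (sym (ℚ.∣p*q∣≡∣p∣*∣q∣ p q)) PQ≡¼
      (*-mono-≤-nonNeg {∣ p ∣} {P} {∣ q ∣} {Q} (ℚ.0≤∣p∣ q) 0≤P p≤P q≤Q)
    1≤¾ : 1ℚ ≤ ¾
    1≤¾ = begin
      1ℚ                               ≡⟨ cong ∣_∣ sum≡1 ⟨
      ∣ - A + s * B - x * C ∣          ≤⟨ ℚ.∣p-q∣≤∣p∣+∣q∣ (- A + s * B) (x * C) ⟩
      ∣ - A + s * B ∣ + ∣ x * C ∣      ≤⟨ ℚ.+-monoˡ-≤ ∣ x * C ∣ (ℚ.∣p+q∣≤∣p∣+∣q∣ (- A) (s * B)) ⟩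
      ∣ - A ∣ + ∣ s * B ∣ + ∣ x * C ∣  ≡⟨ cong (λ r → r + ∣ s * B ∣ + ∣ x * C ∣) (ℚ.∣-p∣≡∣p∣ A) ⟩
      ∣ A ∣ + ∣ s * B ∣ + ∣ x * C ∣    ≤⟨ ℚ.+-mono-≤ (ℚ.+-mono-≤ A≤¼ (product-bound {s} 0≤S s≤S B≤δ Sδ≡¼)) (product-bound {x} 0≤X x≤X C≤δ′ Xδ′≡¼) ⟩
      ¾                                ∎
      where open ℚ.≤-Reasoning

  -- The two equations are the coordinates along 1 and e of (s + e)(t + x e + ...) = 1, where e² =
  -- c. Taking e = i and e = j covers both structure constants.
  no-inverse : ∀ (s t x : ℝ) c → (s ⊠ s) ≃ constant c →
    (s ⊠ t ⊞ constant c ⊠ x) ≃ constant 1ℚ → (s ⊠ x ⊞ t) ≃ constant 0ℚ → ⊥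
  no-inverse s t x c s²≃c st+cx≃1 sx+t≃0 =
    let S , 0<S , N₁ , s≤S = eventually-bounded s
        X , 0<X , N₂ , x≤X = eventually-bounded x
        δ , 0<δ , Sδ≡¼ = divide ¼ 0<¼ 0<S
        δ′ , 0<δ′ , Xδ′≡¼ = divide ¼ 0<¼ 0<X
        N₃ , A≤¼ = st+cx≃1 ¼ 0<¼
        N₄ , B≤δ = sx+t≃0 δ 0<δ
        N₅ , C≤δ′ = s²≃c δ′ 0<δ′
        n = N₁ ⊔ (N₂ ⊔ (N₃ ⊔ (N₄ ⊔ N₅)))
        N₂≤n = ℕ.m≤n⇒m≤o⊔n N₁ (ℕ.m≤m⊔n N₂ (N₃ ⊔ (N₄ ⊔ N₅)))
        N₃≤n = ℕ.m≤n⇒m≤o⊔n N₁ (ℕ.m≤n⇒m≤o⊔n N₂ (ℕ.m≤m⊔n N₃ (N₄ ⊔ N₅)))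
        N₄≤n = ℕ.m≤n⇒m≤o⊔n N₁ (ℕ.m≤n⇒m≤o⊔n N₂ (ℕ.m≤n⇒m≤o⊔n N₃ (ℕ.m≤m⊔n N₄ N₅)))
        N₅≤n = ℕ.m≤n⇒m≤o⊔n N₁ (ℕ.m≤n⇒m≤o⊔n N₂ (ℕ.m≤n⇒m≤o⊔n N₃ (ℕ.m≤n⊔m N₄ N₅)))
    in isotropic-estimate (approx s n) (approx t n) (approx x n) c {S} {X} {δ} {δ′} (ℚ.<⇒≤ 0<S) (ℚ.<⇒≤ 0<X)
         (s≤S n (ℕ.m≤m⊔n N₁ (N₂ ⊔ (N₃ ⊔ (N₄ ⊔ N₅))))) (x≤X n N₂≤n) Sδ≡¼ Xδ′≡¼ (A≤¼ n N₃≤n) (B≤δ n N₄≤n) (C≤δ′ n N₅≤n)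
    where
    0<¼ : 0ℚ < ¼
    0<¼ = ℚ.positive⁻¹ ¼

  ≃-respˡ-approx : ∀ (x y z : ℝ) → (∀ n → approx x n ≡ approx y n) → x ≃ z → y ≃ z
  ≃-respˡ-approx x y z x≡y x≃z ε 0<ε with x≃z ε 0<ε
  ... | N , close = N , λ n N≤n → subst (λ t → ∣ t - approx z n ∣ ≤ ε) (x≡y n) (close n N≤n)

  1≄0 : ¬ (constant 1ℚ ≃ constant 0ℚ)
  1≄0 1≃0 with 1≃0 ½ (ℚ.positive⁻¹ ½)
  ... | N , close = from-no (1ℚ ℚ.≤? ½) (close N ℕ.≤-refl)

  module _ (D : QuaternionAlgebra) where
    open QuaternionAlgebra D
    open BaseChange D Reals.extension

    -- Inverses are available only under a double negation, which is enough to refute one. That √a +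
    -- i is nonzero is seen from its i-coordinate, which is the constant 1.
    a-negative : IsDivisionRing quaternions → a < 0ℚ
    a-negative (_ , invertible) with ℚ.<-cmp a 0ℚ
    ... | tri< a<0 _ _ = a<0
    ... | tri≈ _ a≡0 _ = ⊥-elim (a≢0 a≡0)
    ... | tri> _ _ 0<a = ⊥-elim (invertible u (λ (_ , 1≃0 , _) → 1≄0 1≃0) no-inv)
      where
      u : Quaternion
      u = quat (√ 0<a) (constant 1ℚ) (constant 0ℚ) (constant 0ℚ)
      no-inv : ¬ Invertible quaternions u
      no-inv (v@(quat t x y z) , _ , (t≃1 , x≃0 , _)) = no-inverse (√ 0<a) t x a (√-square 0<a)
        (≃-respˡ-approx (Quaternion.t (u Q.* v)) (√ 0<a ⊠ t ⊞ constant a ⊠ x) (constant 1ℚ) (λ n →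
          solve 7 (λ a b s t x y z →
            s :* t :+ a :* (con 1ℚ :* x) :+ b :* (con 0ℚ :* y) :+ :- (a :* b :* (con 0ℚ :* z)) := s :* t :+ a :* x)
            refl a b (approx (√ 0<a) n) (approx t n) (approx x n) (approx y n) (approx z n)) t≃1)
        (≃-respˡ-approx (Quaternion.x (u Q.* v)) (√ 0<a ⊠ x ⊞ t) (constant 0ℚ) (λ n →
          solve 6 (λ b s t x y z →
            s :* x :+ con 1ℚ :* t :+ b :* (con 0ℚ :* y) :+ :- (b :* (con 0ℚ :* z)) := s :* x :+ t)
            refl b (approx (√ 0<a) n) (approx t n) (approx x n) (approx y n) (approx z n)) x≃0)

    b-negative : IsDivisionRing quaternions → b < 0ℚ
    b-negative (_ , invertible) with ℚ.<-cmp b 0ℚ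
    ... | tri< b<0 _ _ = b<0
    ... | tri≈ _ b≡0 _ = ⊥-elim (b≢0 b≡0)
    ... | tri> _ _ 0<b = ⊥-elim (invertible u (λ (_ , _ , 1≃0 , _) → 1≄0 1≃0) no-inv)
      where
      u : Quaternion
      u = quat (√ 0<b) (constant 0ℚ) (constant 1ℚ) (constant 0ℚ)
      no-inv : ¬ Invertible quaternions u
      no-inv (v@(quat t x y z) , _ , (t≃1 , _ , y≃0 , _)) = no-inverse (√ 0<b) t y b (√-square 0<b)
        (≃-respˡ-approx (Quaternion.t (u Q.* v)) (√ 0<b ⊠ t ⊞ constant b ⊠ y) (constant 1ℚ) (λ n →
          solve 7 (λ a b s t x y z →
            s :* t :+ a :* (con 0ℚ :* x) :+ b :* (con 1ℚ :* y) :+ :- (a :* b :* (con 0ℚ :* z)) := s :* t :+ b :* y)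
            refl a b (approx (√ 0<b) n) (approx t n) (approx x n) (approx y n) (approx z n)) t≃1)
        (≃-respˡ-approx (Quaternion.y (u Q.* v)) (√ 0<b ⊠ y ⊞ t) (constant 0ℚ) (λ n →
          solve 6 (λ a s t x y z →
            s :* y :+ con 1ℚ :* t :+ a :* (con 0ℚ :* z) :+ :- (a :* (con 0ℚ :* x)) := s :* y :+ t)
            refl a (approx (√ 0<b) n) (approx t n) (approx x n) (approx y n) (approx z n)) y≃0)

-- Quaternions with polynomial coordinates, for stating identities to the solver.
record Poly⁴ (n : ℕ) : Set where
  constructor poly
  field
    t x y z : Polynomial n

module _ {n : ℕ} where
  infixl 6 _⊕_
  _⊕_ : Poly⁴ n → Poly⁴ n → Poly⁴ n
  poly t x y z ⊕ poly t′ x′ y′ z′ = poly (t :+ t′) (x :+ x′) (y :+ y′) (z :+ z′)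

  conjᴾ : Poly⁴ n → Poly⁴ n
  conjᴾ (poly t x y z) = poly t (:- x) (:- y) (:- z)

  scalarᴾ : Polynomial n → Poly⁴ n
  scalarᴾ c = poly c (con 0ℚ) (con 0ℚ) (con 0ℚ)

  scaleᴾ : Polynomial n → Poly⁴ n → Poly⁴ n
  scaleᴾ c (poly t x y z) = poly (c :* t) (c :* x) (c :* y) (c :* z)

  module _ (a b : Polynomial n) where
    mulᴾ : Poly⁴ n → Poly⁴ n → Poly⁴ n
    mulᴾ (poly t x y z) (poly t′ x′ y′ z′) = poly
      (t :* t′ :+ a :* (x :* x′) :+ b :* (y :* y′) :+ :- (a :* b :* (z :* z′)))
      (t :* x′ :+ x :* t′ :+ b :* (z :* y′) :+ :- (b :* (y :* z′)))
      (t :* y′ :+ y :* t′ :+ a :* (x :* z′) :+ :- (a :* (z :* x′)))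
      (t :* z′ :+ z :* t′ :+ x :* y′ :+ :- (y :* x′))

    normᴾ : Poly⁴ n → Polynomial n
    normᴾ (poly t x y z) =
      t :* t :+ (:- a) :* (x :* x) :+ (:- b) :* (y :* y) :+ a :* b :* (z :* z)

-- The rational quaternion ring, its conjugation and its reduced norm

module Quaternions (D : QuaternionAlgebra) where
  open QuaternionAlgebra D using (a; b)
  open Rational D

  quat-≡ : ∀ {t t′ x x′ y y′ z z′} → t ≡ t′ → x ≡ x′ → y ≡ y′ → z ≡ z′ →
           quat t x y z ≡ quat t′ x′ y′ z′
  quat-≡ refl refl refl refl = refl

  ≈⇒≡ : ∀ {u v} → u Q.≈ v → u ≡ v
  ≈⇒≡ (t≡ , x≡ , y≡ , z≡) = quat-≡ t≡ x≡ y≡ z≡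

  ≡⇒≈ : ∀ {u v} → u ≡ v → u Q.≈ v
  ≡⇒≈ refl = refl , refl , refl , refl

  *-assoc : ∀ u v w → (u Q.* v) Q.* w ≡ u Q.* (v Q.* w)
  *-assoc (quat t x y z) (quat t′ x′ y′ z′) (quat t″ x″ y″ z″) = quat-≡
    (solve 14 (law Poly⁴.t) refl a b t x y z t′ x′ y′ z′ t″ x″ y″ z″)
    (solve 14 (law Poly⁴.x) refl a b t x y z t′ x′ y′ z′ t″ x″ y″ z″)
    (solve 14 (law Poly⁴.y) refl a b t x y z t′ x′ y′ z′ t″ x″ y″ z″)
    (solve 14 (law Poly⁴.z) refl a b t x y z t′ x′ y′ z′ t″ x″ y″ z″)
    where
    -- The identity is stated once between polynomial quaternions, with the coordinate `π` as a
    -- parameter, so that four calls of the solver share it.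
    law = λ (π : Poly⁴ 14 → Polynomial 14) a b t x y z t′ x′ y′ z′ t″ x″ y″ z″ →
      let u = poly t x y z ; v = poly t′ x′ y′ z′ ; w = poly t″ x″ y″ z″
      in π (mulᴾ a b (mulᴾ a b u v) w) := π (mulᴾ a b u (mulᴾ a b v w))

  *-distribˡ-+ : ∀ u v w → u Q.* (v Q.+ w) ≡ u Q.* v Q.+ u Q.* w
  *-distribˡ-+ (quat t x y z) (quat t′ x′ y′ z′) (quat t″ x″ y″ z″) = quat-≡
    (solve 14 (law Poly⁴.t) refl a b t x y z t′ x′ y′ z′ t″ x″ y″ z″)
    (solve 14 (law Poly⁴.x) refl a b t x y z t′ x′ y′ z′ t″ x″ y″ z″)
    (solve 14 (law Poly⁴.y) refl a b t x y z t′ x′ y′ z′ t″ x″ y″ z″)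
    (solve 14 (law Poly⁴.z) refl a b t x y z t′ x′ y′ z′ t″ x″ y″ z″)
    where
    law = λ (π : Poly⁴ 14 → Polynomial 14) a b t x y z t′ x′ y′ z′ t″ x″ y″ z″ →
      let u = poly t x y z ; v = poly t′ x′ y′ z′ ; w = poly t″ x″ y″ z″
      in π (mulᴾ a b u (v ⊕ w)) := π (mulᴾ a b u v ⊕ mulᴾ a b u w)

  conj-* : ∀ u v → conj (u Q.* v) ≡ conj v Q.* conj u
  conj-* (quat t x y z) (quat t′ x′ y′ z′) = quat-≡
    (solve 10 (law Poly⁴.t) refl a b t x y z t′ x′ y′ z′)
    (solve 10 (law Poly⁴.x) refl a b t x y z t′ x′ y′ z′)
    (solve 10 (law Poly⁴.y) refl a b t x y z t′ x′ y′ z′)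
    (solve 10 (law Poly⁴.z) refl a b t x y z t′ x′ y′ z′)
    where
    law = λ (π : Poly⁴ 10 → Polynomial 10) a b t x y z t′ x′ y′ z′ →
      let u = poly t x y z ; v = poly t′ x′ y′ z′
      in π (conjᴾ (mulᴾ a b u v)) := π (mulᴾ a b (conjᴾ v) (conjᴾ u))

  conj-involutive : ∀ u → conj (conj u) ≡ u
  conj-involutive (quat t x y z) = quat-≡ refl (neg² x) (neg² y) (neg² z)
    where
    neg² : ∀ x → - (- x) ≡ x
    neg² = solve 1 (λ x → :- (:- x) := x) refl

  conj-+ : ∀ u v → conj (u Q.+ v) ≡ conj u Q.+ conj v
  conj-+ (quat t x y z) (quat t′ x′ y′ z′) = quat-≡ refl
    (ℚ.neg-distrib-+ x x′) (ℚ.neg-distrib-+ y y′) (ℚ.neg-distrib-+ z z′)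

  -- Conjugation is additive and reverses products, hence it turns distributivity on the left into
  -- distributivity on the right.
  *-distribʳ-+ : ∀ u v w → (v Q.+ w) Q.* u ≡ v Q.* u Q.+ w Q.* u
  *-distribʳ-+ u v w = begin
    (v Q.+ w) Q.* u                                   ≡⟨ conj-involutive _ ⟨
    conj (conj ((v Q.+ w) Q.* u))                     ≡⟨ cong conj (conj-* (v Q.+ w) u) ⟩
    conj (conj u Q.* conj (v Q.+ w))                  ≡⟨ cong (λ s → conj (conj u Q.* s)) (conj-+ v w) ⟩
    conj (conj u Q.* (conj v Q.+ conj w))             ≡⟨ cong conj (*-distribˡ-+ (conj u) (conj v) (conj w)) ⟩
    conj (conj u Q.* conj v Q.+ conj u Q.* conj w)    ≡⟨ cong conj (cong₂ Q._+_ (conj-* v u) (conj-* w u)) ⟨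
    conj (conj (v Q.* u) Q.+ conj (w Q.* u))          ≡⟨ cong conj (conj-+ (v Q.* u) (w Q.* u)) ⟨
    conj (conj (v Q.* u Q.+ w Q.* u))                 ≡⟨ conj-involutive _ ⟩
    v Q.* u Q.+ w Q.* u                               ∎
    where open ≡-Reasoning

  scalar-*ˡ : ∀ c u → scalar c Q.* u ≡ c • u
  scalar-*ˡ c (quat t x y z) = quat-≡
    (solve 7 (law Poly⁴.t) refl a b c t x y z)
    (solve 7 (law Poly⁴.x) refl a b c t x y z)
    (solve 7 (law Poly⁴.y) refl a b c t x y z)
    (solve 7 (law Poly⁴.z) refl a b c t x y z)
    where
    law = λ (π : Poly⁴ 7 → Polynomial 7) a b c t x y z →
      π (mulᴾ a b (scalarᴾ c) (poly t x y z)) := π (scaleᴾ c (poly t x y z))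

  scalar-*ʳ : ∀ c u → u Q.* scalar c ≡ c • u
  scalar-*ʳ c (quat t x y z) = quat-≡
    (solve 7 (law Poly⁴.t) refl a b c t x y z)
    (solve 7 (law Poly⁴.x) refl a b c t x y z)
    (solve 7 (law Poly⁴.y) refl a b c t x y z)
    (solve 7 (law Poly⁴.z) refl a b c t x y z)
    where
    law = λ (π : Poly⁴ 7 → Polynomial 7) a b c t x y z →
      π (mulᴾ a b (poly t x y z) (scalarᴾ c)) := π (scaleᴾ c (poly t x y z))

  1•u≡u : ∀ u → 1ℚ • u ≡ u
  1•u≡u (quat t x y z) = quat-≡
    (ℚ.*-identityˡ t) (ℚ.*-identityˡ x) (ℚ.*-identityˡ y) (ℚ.*-identityˡ z)

  -- The reduced norm. Grouping the signs as - a, - b and a b makes every coefficient positive when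
  -- a and b are negative.
  norm : Quaternion → ℚ
  norm (quat t x y z) = t * t + (- a) * (x * x) + (- b) * (y * y) + a * b * (z * z)

  *-conj : ∀ u → u Q.* conj u ≡ scalar (norm u)
  *-conj (quat t x y z) = quat-≡
    (solve 6 (law Poly⁴.t) refl a b t x y z)
    (solve 6 (law Poly⁴.x) refl a b t x y z)
    (solve 6 (law Poly⁴.y) refl a b t x y z)
    (solve 6 (law Poly⁴.z) refl a b t x y z)
    where
    law = λ (π : Poly⁴ 6 → Polynomial 6) a b t x y z →
      let u = poly t x y z
      in π (mulᴾ a b u (conjᴾ u)) := π (scalarᴾ (normᴾ a b u))

  norm-conj : ∀ u → norm (conj u) ≡ norm u
  norm-conj (quat t x y z) = solve 6 (λ a b t x y z →
    let u = poly t x y z in normᴾ a b (conjᴾ u) := normᴾ a b u) refl a b t x y z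

  conj-*-self : ∀ u → conj u Q.* u ≡ scalar (norm u)
  conj-*-self u = begin
    conj u Q.* u               ≡⟨ cong (conj u Q.*_) (conj-involutive u) ⟨
    conj u Q.* conj (conj u)   ≡⟨ *-conj (conj u) ⟩
    scalar (norm (conj u))     ≡⟨ cong scalar (norm-conj u) ⟩
    scalar (norm u)            ∎
    where open ≡-Reasoning

  norm-* : ∀ u v → norm (u Q.* v) ≡ norm u * norm v
  norm-* (quat t x y z) (quat t′ x′ y′ z′) = solve 10 (λ a b t x y z t′ x′ y′ z′ →
    let u = poly t x y z ; v = poly t′ x′ y′ z′
    in normᴾ a b (mulᴾ a b u v) := normᴾ a b u :* normᴾ a b v) refl a b t x y z t′ x′ y′ z′

  +-*-isRing : IsRing _≡_ Q._+_ Q._*_ Q.-_ Q.0# Q.1#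
  +-*-isRing = record
    { +-isAbelianGroup = record
      { isGroup = record
        { isMonoid = record
          { isSemigroup = record
            { isMagma = record { isEquivalence = isEquivalence ; ∙-cong = cong₂ Q._+_ }
            ; assoc   = λ (quat t x y z) (quat t′ x′ y′ z′) (quat t″ x″ y″ z″) → quat-≡
                (ℚ.+-assoc t t′ t″) (ℚ.+-assoc x x′ x″) (ℚ.+-assoc y y′ y″) (ℚ.+-assoc z z′ z″)
            }
          ; identity =
              (λ (quat t x y z) → quat-≡ (ℚ.+-identityˡ t) (ℚ.+-identityˡ x) (ℚ.+-identityˡ y) (ℚ.+-identityˡ z))
            , (λ (quat t x y z) → quat-≡ (ℚ.+-identityʳ t) (ℚ.+-identityʳ x) (ℚ.+-identityʳ y) (ℚ.+-identityʳ z))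
          }
        ; inverse =
            (λ (quat t x y z) → quat-≡ (ℚ.+-inverseˡ t) (ℚ.+-inverseˡ x) (ℚ.+-inverseˡ y) (ℚ.+-inverseˡ z))
          , (λ (quat t x y z) → quat-≡ (ℚ.+-inverseʳ t) (ℚ.+-inverseʳ x) (ℚ.+-inverseʳ y) (ℚ.+-inverseʳ z))
        ; ⁻¹-cong = cong Q.-_
        }
      ; comm = λ (quat t x y z) (quat t′ x′ y′ z′) → quat-≡
          (ℚ.+-comm t t′) (ℚ.+-comm x x′) (ℚ.+-comm y y′) (ℚ.+-comm z z′)
      }
    ; *-cong     = cong₂ Q._*_
    ; *-assoc    = *-assoc
    ; *-identity = (λ u → trans (scalar-*ˡ 1ℚ u) (1•u≡u u)) , (λ u → trans (scalar-*ʳ 1ℚ u) (1•u≡u u))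
    ; distrib    = *-distribˡ-+ , *-distribʳ-+
    }

  ring : Ring 0ℓ 0ℓ
  ring = record { isRing = +-*-isRing }

-- Matrices over D and unitary similitudes

module Matrices (D : QuaternionAlgebra) where
  open QuaternionAlgebra D using (a; b)
  open Rational D
  open Quaternions D
  open Ring ring using (+-identityʳ; +-identityˡ; zeroˡ; zeroʳ; *-identityˡ; *-identityʳ; +-commutativeMonoid; +-group)
  open CommutativeSemigroupProperties (Ring.+-commutativeSemigroup ring) using (interchange)

  infix 4 _≗ₘ_
  _≗ₘ_ : Matrix → Matrix → Set
  m ≗ₘ n = ∀ i → m i ≗ n i

  ≈⇒≗ₘ : ∀ {m n} → m M.≈ n → m ≗ₘ n
  ≈⇒≗ₘ m≈n i j = ≈⇒≡ (m≈n i j)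

  ≗ₘ⇒≈ : ∀ {m n} → m ≗ₘ n → m M.≈ n
  ≗ₘ⇒≈ m≗n i j = ≡⇒≈ (m≗n i j)

  ·-expand : ∀ u m j → (u · m) j ≡ u 0F Q.* m 0F j Q.+ u 1F Q.* m 1F j
  ·-expand u m j = cong (u 0F Q.* m 0F j Q.+_) (+-identityʳ (u 1F Q.* m 1F j))

  ·-cong : ∀ {u v m n} → u ≗ v → m ≗ₘ n → u · m ≗ v · n
  ·-cong {u} {v} {m} {n} u≗v m≗n j = cong₂ Q._+_
    (cong₂ Q._*_ (u≗v 0F) (m≗n 0F j))
    (cong (Q._+ Q.0#) (cong₂ Q._*_ (u≗v 1F) (m≗n 1F j)))

  ·-congˡ : ∀ u {m n} → m ≗ₘ n → u · m ≗ u · n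
  ·-congˡ u = ·-cong {u} {u} (λ _ → refl)

  ·-congʳ : ∀ {u v} m → u ≗ v → u · m ≗ v · m
  ·-congʳ m u≗v = ·-cong {m = m} {n = m} u≗v (λ _ _ → refl)

  ·-assoc : ∀ u m n → (u · m) · n ≗ u · (m M.* n)
  ·-assoc u m n j = begin
    ((u · m) · n) j
      ≡⟨ ·-expand (u · m) n j ⟩
    (u · m) 0F Q.* n 0F j Q.+ (u · m) 1F Q.* n 1F j
      ≡⟨ cong₂ Q._+_ (part 0F) (part 1F) ⟩
    (p 0F 0F Q.+ p 1F 0F) Q.+ (p 0F 1F Q.+ p 1F 1F)
      ≡⟨ interchange (p 0F 0F) (p 1F 0F) (p 0F 1F) (p 1F 1F) ⟩
    (p 0F 0F Q.+ p 0F 1F) Q.+ (p 1F 0F Q.+ p 1F 1F)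
      ≡⟨ cong₂ Q._+_ (*-distribˡ-+ (u 0F) (m 0F 0F Q.* n 0F j) (m 0F 1F Q.* n 1F j))
                        (*-distribˡ-+ (u 1F) (m 1F 0F Q.* n 0F j) (m 1F 1F Q.* n 1F j)) ⟨
    u 0F Q.* (m 0F 0F Q.* n 0F j Q.+ m 0F 1F Q.* n 1F j) Q.+
    u 1F Q.* (m 1F 0F Q.* n 0F j Q.+ m 1F 1F Q.* n 1F j)
      ≡⟨ cong₂ Q._+_ (cong (u 0F Q.*_) (·-expand (m 0F) n j)) (cong (u 1F Q.*_) (·-expand (m 1F) n j)) ⟨
    u 0F Q.* (m M.* n) 0F j Q.+ u 1F Q.* (m M.* n) 1F j
      ≡⟨ ·-expand u (m M.* n) j ⟨
    (u · (m M.* n)) j ∎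
    where
    open ≡-Reasoning
    p : Fin 2 → Fin 2 → Quaternion
    p k l = u k Q.* (m k l Q.* n l j)

    part : ∀ l → (u · m) l Q.* n l j ≡ p 0F l Q.+ p 1F l
    part l = begin
      (u · m) l Q.* n l j
        ≡⟨ cong (Q._* n l j) (·-expand u m l) ⟩
      (u 0F Q.* m 0F l Q.+ u 1F Q.* m 1F l) Q.* n l j
        ≡⟨ *-distribʳ-+ (n l j) (u 0F Q.* m 0F l) (u 1F Q.* m 1F l) ⟩
      (u 0F Q.* m 0F l) Q.* n l j Q.+ (u 1F Q.* m 1F l) Q.* n l j
        ≡⟨ cong₂ Q._+_ (*-assoc (u 0F) (m 0F l) (n l j)) (*-assoc (u 1F) (m 1F l) (n l j)) ⟩
      p 0F l Q.+ p 1F l ∎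

  ·-diagonal : ∀ u d j → (u · diagonal d) j ≡ u j Q.* d
  ·-diagonal u d 0F = begin
    (u · diagonal d) 0F                 ≡⟨ ·-expand u (diagonal d) 0F ⟩
    u 0F Q.* d Q.+ u 1F Q.* Q.0#        ≡⟨ cong (u 0F Q.* d Q.+_) (zeroʳ (u 1F)) ⟩
    u 0F Q.* d Q.+ Q.0#                 ≡⟨ +-identityʳ (u 0F Q.* d) ⟩
    u 0F Q.* d                          ∎
    where open ≡-Reasoning
  ·-diagonal u d 1F = begin
    (u · diagonal d) 1F                 ≡⟨ ·-expand u (diagonal d) 1F ⟩
    u 0F Q.* Q.0# Q.+ u 1F Q.* d        ≡⟨ cong (Q._+ u 1F Q.* d) (zeroʳ (u 0F)) ⟩
    Q.0# Q.+ u 1F Q.* d                 ≡⟨ +-identityˡ (u 1F Q.* d) ⟩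
    u 1F Q.* d                          ∎
    where open ≡-Reasoning

  ·-identity : ∀ u → u · M.1# ≗ u
  ·-identity u j = trans (·-diagonal u Q.1# j) (*-identityʳ (u j))

  •-* : ∀ c u v → (c • u) Q.* v ≡ c • (u Q.* v)
  •-* c u v = begin
    (c • u) Q.* v             ≡⟨ cong (Q._* v) (scalar-*ˡ c u) ⟨
    (scalar c Q.* u) Q.* v    ≡⟨ *-assoc (scalar c) u v ⟩
    scalar c Q.* (u Q.* v)    ≡⟨ scalar-*ˡ c (u Q.* v) ⟩
    c • (u Q.* v)             ∎
    where open ≡-Reasoning

  *-• : ∀ c u v → u Q.* (c • v) ≡ c • (u Q.* v)
  *-• c u v = begin
    u Q.* (c • v)             ≡⟨ cong (u Q.*_) (scalar-*ʳ c v) ⟨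
    u Q.* (v Q.* scalar c)    ≡⟨ *-assoc u v (scalar c) ⟨
    (u Q.* v) Q.* scalar c    ≡⟨ scalar-*ʳ c (u Q.* v) ⟩
    c • (u Q.* v)             ∎
    where open ≡-Reasoning

  •-distrib-+ : ∀ c u v → c • (u Q.+ v) ≡ c • u Q.+ c • v
  •-distrib-+ c (quat t x y z) (quat t′ x′ y′ z′) = quat-≡
    (ℚ.*-distribˡ-+ c t t′) (ℚ.*-distribˡ-+ c x x′) (ℚ.*-distribˡ-+ c y y′) (ℚ.*-distribˡ-+ c z z′)

  •-assoc : ∀ c d u → (c * d) • u ≡ c • d • u
  •-assoc c d (quat t x y z) = quat-≡
    (ℚ.*-assoc c d t) (ℚ.*-assoc c d x) (ℚ.*-assoc c d y) (ℚ.*-assoc c d z)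

  c•u≡0⇒u≡0 : ∀ {c} u → c ≢ 0ℚ → c • u ≡ Q.0# → u ≡ Q.0#
  c•u≡0⇒u≡0 (quat t x y z) c≢0 cu≡0 with ≡⇒≈ cu≡0
  ... | ct≡0 , cx≡0 , cy≡0 , cz≡0 = quat-≡
    (p*q≡0⇒q≡0 c≢0 ct≡0) (p*q≡0⇒q≡0 c≢0 cx≡0) (p*q≡0⇒q≡0 c≢0 cy≡0) (p*q≡0⇒q≡0 c≢0 cz≡0)

  †-* : ∀ m n → (m M.* n) † ≗ₘ (n †) M.* (m †)
  †-* m n i j = begin
    conj ((m j · n) i)
      ≡⟨ cong conj (·-expand (m j) n i) ⟩
    conj (m j 0F Q.* n 0F i Q.+ m j 1F Q.* n 1F i)
      ≡⟨ conj-+ (m j 0F Q.* n 0F i) (m j 1F Q.* n 1F i) ⟩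
    conj (m j 0F Q.* n 0F i) Q.+ conj (m j 1F Q.* n 1F i)
      ≡⟨ cong₂ Q._+_ (conj-* (m j 0F) (n 0F i)) (conj-* (m j 1F) (n 1F i)) ⟩
    (n †) i 0F Q.* (m †) 0F j Q.+ (n †) i 1F Q.* (m †) 1F j
      ≡⟨ ·-expand ((n †) i) (m †) j ⟨
    ((n †) M.* (m †)) i j ∎
    where open ≡-Reasoning

  similitude-diagonal : ∀ {μ m} → m M.* (m †) ≗ₘ diagonal (scalar μ) →
                        ∀ i → norm (m i 0F) + norm (m i 1F) ≡ μ
  similitude-diagonal {μ} {m} mm†≡μ i = cong Quaternion.t (begin
    scalar (norm (m i 0F)) Q.+ scalar (norm (m i 1F))          ≡⟨ cong₂ Q._+_ (*-conj (m i 0F)) (*-conj (m i 1F)) ⟨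
    m i 0F Q.* conj (m i 0F) Q.+ m i 1F Q.* conj (m i 1F)      ≡⟨ ·-expand (m i) (m †) i ⟨
    (m M.* (m †)) i i                                          ≡⟨ mm†≡μ i i ⟩
    diagonal (scalar μ) i i                                    ≡⟨ diag i ⟩
    scalar μ                                                   ∎)
    where
    open ≡-Reasoning
    diag : ∀ i → diagonal (scalar μ) i i ≡ scalar μ
    diag 0F = refl
    diag 1F = refl

  norm-neg : ∀ u → norm (Q.- u) ≡ norm u
  norm-neg (quat t x y z) = solve 6 (λ a b t x y z →
    normᴾ a b (poly (:- t) (:- x) (:- y) (:- z)) := normᴾ a b (poly t x y z)) refl a b t x y z

  module Definite (a<0 : a < 0ℚ) (b<0 : b < 0ℚ) where

    private
      0<-a : 0ℚ < - a
      0<-a = neg-pos a<0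

      0<-b : 0ℚ < - b
      0<-b = neg-pos b<0

      0<ab : 0ℚ < a * b
      0<ab = neg*neg-pos a<0 b<0

      term-nonNeg : ∀ {c} x → 0ℚ < c → 0ℚ ≤ c * (x * x)
      term-nonNeg x 0<c = *-nonNeg (ℚ.<⇒≤ 0<c) (square-nonNeg x)

      term≡0 : ∀ {c} x → 0ℚ < c → c * (x * x) ≡ 0ℚ → x ≡ 0ℚ
      term≡0 x 0<c cx²≡0 = square≡0⇒≡0 x (p*q≡0⇒q≡0 (≢-sym (ℚ.<⇒≢ 0<c)) cx²≡0)

    norm-nonNeg : ∀ u → 0ℚ ≤ norm u
    norm-nonNeg (quat t x y z) =
      +-nonNeg (+-nonNeg (+-nonNeg (square-nonNeg t) (term-nonNeg x 0<-a)) (term-nonNeg y 0<-b))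
               (term-nonNeg z 0<ab)

    norm≡0⇒≡0 : ∀ u → norm u ≡ 0ℚ → u ≡ Q.0#
    norm≡0⇒≡0 (quat t x y z) N≡0 =
      let txy≥0 = +-nonNeg (+-nonNeg (square-nonNeg t) (term-nonNeg x 0<-a)) (term-nonNeg y 0<-b)
          txy≡0 , z≡0 = nonNeg+nonNeg≡0 txy≥0 (term-nonNeg z 0<ab) N≡0
          tx≡0 , y≡0 = nonNeg+nonNeg≡0 (+-nonNeg (square-nonNeg t) (term-nonNeg x 0<-a)) (term-nonNeg y 0<-b) txy≡0
          t≡0 , x≡0 = nonNeg+nonNeg≡0 (square-nonNeg t) (term-nonNeg x 0<-a) tx≡0
      in quat-≡ (square≡0⇒≡0 t t≡0) (term≡0 x 0<-a x≡0) (term≡0 y 0<-b y≡0) (term≡0 z 0<ab z≡0)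

    -- With rows (x, y), (z, w): multiplying x z̄ + y w̄ = 0 by x̄ on the left and
    -- by w on the right gives N(x) z̄ w + N(w) x̄ y = 0, and N(x) = N(w).
    similitude-swap : ∀ {μ m} → μ ≢ 0ℚ → m M.* (m †) ≗ₘ diagonal (scalar μ) →
                      (m †) M.* m ≗ₘ diagonal (scalar μ)
    similitude-swap {μ} {m} μ≢0 mm†≡μ = result
      where
      open ≡-Reasoning
      x = m 0F 0F
      y = m 0F 1F
      z = m 1F 0F
      w = m 1F 1F

      Nx+Ny≡μ : norm x + norm y ≡ μ
      Nx+Ny≡μ = similitude-diagonal {m = m} mm†≡μ 0F

      Nz+Nw≡μ : norm z + norm w ≡ μ
      Nz+Nw≡μ = similitude-diagonal {m = m} mm†≡μ 1F

      off : x Q.* conj z Q.+ y Q.* conj w ≡ Q.0#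
      off = trans (sym (·-expand (m 0F) (m †) 1F)) (mm†≡μ 0F 1F)

      -- Norms are taken in x z̄ = - y w̄, the orthogonality of the two rows.
      NxNz≡NyNw : norm x * norm z ≡ norm y * norm w
      NxNz≡NyNw = begin
        norm x * norm z                  ≡⟨ cong (norm x *_) (norm-conj z) ⟨
        norm x * norm (conj z)           ≡⟨ norm-* x (conj z) ⟨
        norm (x Q.* conj z)              ≡⟨ cong norm (RingProperties.+-inverseˡ-unique ring (x Q.* conj z) (y Q.* conj w) off) ⟩
        norm (Q.- (y Q.* conj w))        ≡⟨ norm-neg (y Q.* conj w) ⟩
        norm (y Q.* conj w)              ≡⟨ norm-* y (conj w) ⟩
        norm y * norm (conj w)           ≡⟨ cong (norm y *_) (norm-conj w) ⟩
        norm y * norm w                  ∎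

      -- μ is written as N(z) + N(w) on the left and as N(x) + N(y) on the right; the two expansions
      -- differ exactly by the previous equation.
      Nx≡Nw : norm x ≡ norm w
      Nx≡Nw = *-cancelˡ-≢0 μ≢0 (begin
        μ * norm x                               ≡⟨ cong (_* norm x) Nz+Nw≡μ ⟨
        (norm z + norm w) * norm x               ≡⟨ solve 3 (λ x z w → (z :+ w) :* x := x :* z :+ x :* w) refl (norm x) (norm z) (norm w) ⟩
        norm x * norm z + norm x * norm w        ≡⟨ cong (_+ norm x * norm w) NxNz≡NyNw ⟩
        norm y * norm w + norm x * norm w        ≡⟨ solve 3 (λ x y w → y :* w :+ x :* w := (x :+ y) :* w) refl (norm x) (norm y) (norm w) ⟩
        (norm x + norm y) * norm w               ≡⟨ cong (_* norm w) Nx+Ny≡μ ⟩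
        μ * norm w                               ∎)

      Nx+Nz≡μ : norm x + norm z ≡ μ
      Nx+Nz≡μ = trans (cong (_+ norm z) Nx≡Nw) (trans (ℚ.+-comm (norm w) (norm z)) Nz+Nw≡μ)

      Ny+Nw≡μ : norm y + norm w ≡ μ
      Ny+Nw≡μ = trans (cong (λ n → norm y + n) (sym Nx≡Nw)) (trans (ℚ.+-comm (norm y) (norm x)) Nx+Ny≡μ)

      scaled : norm x • (conj x Q.* y Q.+ conj z Q.* w) ≡ Q.0#
      scaled = begin
        norm x • (conj x Q.* y Q.+ conj z Q.* w)
          ≡⟨ •-distrib-+ (norm x) (conj x Q.* y) (conj z Q.* w) ⟩
        norm x • (conj x Q.* y) Q.+ norm x • (conj z Q.* w)
          ≡⟨ Ring.+-comm ring (norm x • (conj x Q.* y)) (norm x • (conj z Q.* w)) ⟩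
        norm x • (conj z Q.* w) Q.+ norm x • (conj x Q.* y)
          ≡⟨ cong (norm x • (conj z Q.* w) Q.+_) (cong (_• (conj x Q.* y)) Nx≡Nw) ⟩
        norm x • (conj z Q.* w) Q.+ norm w • (conj x Q.* y)
          ≡⟨ cong₂ Q._+_ left right ⟩
        (conj x Q.* (x Q.* conj z)) Q.* w Q.+ (conj x Q.* (y Q.* conj w)) Q.* w
          ≡⟨ *-distribʳ-+ w (conj x Q.* (x Q.* conj z)) (conj x Q.* (y Q.* conj w)) ⟨
        (conj x Q.* (x Q.* conj z) Q.+ conj x Q.* (y Q.* conj w)) Q.* w
          ≡⟨ cong (Q._* w) (*-distribˡ-+ (conj x) (x Q.* conj z) (y Q.* conj w)) ⟨
        (conj x Q.* (x Q.* conj z Q.+ y Q.* conj w)) Q.* w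
          ≡⟨ cong (λ s → (conj x Q.* s) Q.* w) off ⟩
        (conj x Q.* Q.0#) Q.* w
          ≡⟨ cong (Q._* w) (zeroʳ (conj x)) ⟩
        Q.0# Q.* w
          ≡⟨ zeroˡ w ⟩
        Q.0# ∎
        where
        left : norm x • (conj z Q.* w) ≡ (conj x Q.* (x Q.* conj z)) Q.* w
        left = begin
          norm x • (conj z Q.* w)               ≡⟨ •-* (norm x) (conj z) w ⟨
          (norm x • conj z) Q.* w               ≡⟨ cong (Q._* w) (scalar-*ˡ (norm x) (conj z)) ⟨
          (scalar (norm x) Q.* conj z) Q.* w    ≡⟨ cong (λ s → (s Q.* conj z) Q.* w) (conj-*-self x) ⟨
          ((conj x Q.* x) Q.* conj z) Q.* w     ≡⟨ cong (Q._* w) (*-assoc (conj x) x (conj z)) ⟩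
          (conj x Q.* (x Q.* conj z)) Q.* w     ∎

        right : norm w • (conj x Q.* y) ≡ (conj x Q.* (y Q.* conj w)) Q.* w
        right = begin
          norm w • (conj x Q.* y)               ≡⟨ scalar-*ʳ (norm w) (conj x Q.* y) ⟨
          (conj x Q.* y) Q.* scalar (norm w)    ≡⟨ cong ((conj x Q.* y) Q.*_) (conj-*-self w) ⟨
          (conj x Q.* y) Q.* (conj w Q.* w)     ≡⟨ *-assoc (conj x Q.* y) (conj w) w ⟨
          ((conj x Q.* y) Q.* conj w) Q.* w     ≡⟨ cong (Q._* w) (*-assoc (conj x) y (conj w)) ⟩
          (conj x Q.* (y Q.* conj w)) Q.* w     ∎

      off′ : conj x Q.* y Q.+ conj z Q.* w ≡ Q.0#
      off′ with norm x ℚ.≟ 0ℚ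
      ... | no  Nx≢0 = c•u≡0⇒u≡0 (conj x Q.* y Q.+ conj z Q.* w) Nx≢0 scaled
      -- The factor N(x) cannot be cancelled here, but then N(w) = N(x) = 0, and definiteness gives
      -- x = w = 0, so both summands vanish.
      ... | yes Nx≡0 = begin
        conj x Q.* y Q.+ conj z Q.* w
          ≡⟨ cong₂ (λ s t → conj s Q.* y Q.+ conj z Q.* t)
               (norm≡0⇒≡0 x Nx≡0) (norm≡0⇒≡0 w (trans (sym Nx≡Nw) Nx≡0)) ⟩
        Q.0# Q.* y Q.+ conj z Q.* Q.0#
          ≡⟨ cong₂ Q._+_ (zeroˡ y) (zeroʳ (conj z)) ⟩
        Q.0# ∎

      result : (m †) M.* m ≗ₘ diagonal (scalar μ)
      result 0F 0F = trans (·-expand ((m †) 0F) m 0F)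
        (trans (cong₂ Q._+_ (conj-*-self x) (conj-*-self z)) (cong scalar Nx+Nz≡μ))
      result 0F 1F = trans (·-expand ((m †) 0F) m 1F) off′
      result 1F 0F = begin
        ((m †) M.* m) 1F 0F                                      ≡⟨ ·-expand ((m †) 1F) m 0F ⟩
        conj y Q.* x Q.+ conj w Q.* z                            ≡⟨ cong₂ (λ s t → conj y Q.* s Q.+ conj w Q.* t) (conj-involutive x) (conj-involutive z) ⟨
        conj y Q.* conj (conj x) Q.+ conj w Q.* conj (conj z)    ≡⟨ cong₂ Q._+_ (conj-* (conj x) y) (conj-* (conj z) w) ⟨
        conj (conj x Q.* y) Q.+ conj (conj z Q.* w)              ≡⟨ conj-+ (conj x Q.* y) (conj z Q.* w) ⟨
        conj (conj x Q.* y Q.+ conj z Q.* w)                     ≡⟨ cong conj off′ ⟩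
        Q.0#                                                     ∎
      result 1F 1F = trans (·-expand ((m †) 1F) m 1F)
        (trans (cong₂ Q._+_ (conj-*-self y) (conj-*-self w)) (cong scalar Ny+Nw≡μ))

-- Orders and their commensurability with ℤ⁴

module Orders (D : QuaternionAlgebra) where
  open QuaternionAlgebra D using (a; b)
  open Rational D
  open Quaternions D
  open Matrices D using (•-assoc; •-distrib-+)
  private module R = Ring ring

  -- The lattice ℤ⁴ in the basis 1, i, j, ij. It is a yardstick for denominators and need not be
  -- closed under multiplication, since a and b are rational.
  record IntegralQ (u : Quaternion) : Set where
    constructor integralQ
    field
      t-integer : IsInteger (Quaternion.t u)
      x-integer : IsInteger (Quaternion.x u)
      y-integer : IsInteger (Quaternion.y u)
      z-integer : IsInteger (Quaternion.z u)

  integralQ-+ : ∀ {u v} → IntegralQ u → IntegralQ v → IntegralQ (u Q.+ v)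
  integralQ-+ (integralQ t x y z) (integralQ t′ x′ y′ z′) =
    integralQ (integer-+ t t′) (integer-+ x x′) (integer-+ y y′) (integer-+ z z′)

  integralQ-• : ∀ {c u} → IsInteger c → IntegralQ u → IntegralQ (c • u)
  integralQ-• c (integralQ t x y z) =
    integralQ (integer-* c t) (integer-* c x) (integer-* c y) (integer-* c z)

  BoundedQ : {I : Set} → (I → Quaternion) → Set
  BoundedQ f = Bounded (λ i → Quaternion.t (f i)) × Bounded (λ i → Quaternion.x (f i)) ×
               Bounded (λ i → Quaternion.y (f i)) × Bounded (λ i → Quaternion.z (f i))

  common-denominator : ∀ {I : Set} {f : I → Quaternion} → BoundedQ f →
                       ∃[ N ] N ≢ 0ℤ × ∀ i → IntegralQ (fromℤ N • f i)
  common-denominator (t , x , y , z) with bounded-⊎ (bounded-⊎ t x) (bounded-⊎ y z)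
  ... | bounded N N≢0 Nf = N , N≢0 , λ i →
    integralQ (Nf (inj₁ (inj₁ i))) (Nf (inj₁ (inj₂ i))) (Nf (inj₂ (inj₁ i))) (Nf (inj₂ (inj₂ i)))

  boundedQ-const : ∀ {I : Set} u → BoundedQ {I} (λ _ → u)
  boundedQ-const (quat t x y z) = bounded-const t , bounded-const x , bounded-const y , bounded-const z

  boundedQ-finite : ∀ {k} (f : Fin k → Quaternion) → BoundedQ f
  boundedQ-finite f = bounded-finite (λ i → Quaternion.t (f i)) , bounded-finite (λ i → Quaternion.x (f i))
                    , bounded-finite (λ i → Quaternion.y (f i)) , bounded-finite (λ i → Quaternion.z (f i))

  boundedQ-+ : ∀ {I : Set} {f g : I → Quaternion} → BoundedQ f → BoundedQ g → BoundedQ (λ i → f i Q.+ g i)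
  boundedQ-+ (t , x , y , z) (t′ , x′ , y′ , z′) =
    bounded-+ t t′ , bounded-+ x x′ , bounded-+ y y′ , bounded-+ z z′

  boundedQ-* : ∀ {I : Set} {f g : I → Quaternion} → BoundedQ f → BoundedQ g → BoundedQ (λ i → f i Q.* g i)
  boundedQ-* (t , x , y , z) (t′ , x′ , y′ , z′) =
      lin (bounded-* t t′) (bounded-* (bounded-const a) (bounded-* x x′))
        (bounded-* (bounded-const b) (bounded-* y y′)) (bounded-* (bounded-* (bounded-const a) (bounded-const b)) (bounded-* z z′))
    , lin (bounded-* t x′) (bounded-* x t′) (bounded-* (bounded-const b) (bounded-* z y′)) (bounded-* (bounded-const b) (bounded-* y z′))
    , lin (bounded-* t y′) (bounded-* y t′) (bounded-* (bounded-const a) (bounded-* x z′)) (bounded-* (bounded-const a) (bounded-* z x′))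
    , lin (bounded-* t z′) (bounded-* z t′) (bounded-* x y′) (bounded-* y x′)
    where
    lin : ∀ {I : Set} {p q r s : I → ℚ} → Bounded p → Bounded q → Bounded r → Bounded s →
          Bounded (λ i → p i + q i + r i + - s i)
    lin p q r s = bounded-+ (bounded-+ (bounded-+ p q) r) (bounded-neg s)

  boundedQ-conj : ∀ {I : Set} {f : I → Quaternion} → BoundedQ f → BoundedQ (λ i → conj (f i))
  boundedQ-conj (t , x , y , z) = t , bounded-neg x , bounded-neg y , bounded-neg z

  •-swap : ∀ p q u v → p • (q • u Q.+ v) ≡ q • p • u Q.+ p • v
  •-swap p q u v = begin
    p • (q • u Q.+ v)         ≡⟨ •-distrib-+ p (q • u) v ⟩
    p • q • u Q.+ p • v       ≡⟨ cong (Q._+ p • v) (•-assoc p q u) ⟨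
    (p * q) • u Q.+ p • v     ≡⟨ cong (λ r → r • u Q.+ p • v) (ℚ.*-comm p q) ⟩
    (q * p) • u Q.+ p • v     ≡⟨ cong (Q._+ p • v) (•-assoc q p u) ⟩
    q • p • u Q.+ p • v       ∎
    where open ≡-Reasoning

  -- Multiplying by a denominator d of c = n / d makes the new coefficient integral and keeps the
  -- multiple of v that was integral before. The products are variables fixed by equations, so that
  -- `fromℤ` of an integer product can stand for them.
  •-clear : ∀ m c d {n md mn} → md ≡ m * d → mn ≡ m * n → d * c ≡ n →
            ∀ u v → md • (c • u Q.+ v) ≡ mn • u Q.+ d • m • v
  •-clear m c d refl refl refl u v = begin
    (m * d) • (c • u Q.+ v)                   ≡⟨ •-distrib-+ (m * d) (c • u) v ⟩
    (m * d) • c • u Q.+ (m * d) • v           ≡⟨ cong₂ Q._+_ (•-assoc (m * d) c u) (cong (_• v) (ℚ.*-comm d m)) ⟨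
    (m * d * c) • u Q.+ (d * m) • v           ≡⟨ cong₂ (λ r w → r • u Q.+ w) (ℚ.*-assoc m d c) (•-assoc d m v) ⟩
    (m * (d * c)) • u Q.+ d • m • v           ∎
    where open ≡-Reasoning

  -- A finite sum is built by adding one multiple of a generator at a time. The coefficient map is
  -- left general, so that the principle serves the ℤ-span that is 𝒪 and the ℚ-span that is D.
  span-induction : ∀ {C : Set} (ι : C → ℚ) {n} (e : Vector Quaternion n) (P : Pred Quaternion 0ℓ) →
    P Q.0# → (∀ c i {v} → P v → P (ι c • e i Q.+ v)) → ∀ {v} → v ∈ SpanOf D ι e → P v
  span-induction ι e P P0 P+ {v} (k , c , x , x∈e , v≈) = subst P (sym (≈⇒≡ v≈)) (go k c x x∈e)
    where
    go : ∀ k c x → (∀ i → ∃[ j ] x i ≡ e j) → P (sum Q.+-rawMonoid {k} (λ i → ι (c i) • x i))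
    go zero    c x x∈e = P0
    go (suc k) c x x∈e with x∈e zero
    ... | j , x₀≡eⱼ = subst (λ w → P (ι (c zero) • w Q.+ _)) (sym x₀≡eⱼ)
      (P+ (c zero) j (go k (λ i → c (suc i)) (λ i → x (suc i)) (λ i → x∈e (suc i))))

  module OrderProperties {𝒪 : Pred Quaternion 0ℓ} (isOrder : IsOrder D 𝒪) where
    open IsOrder isOrder public

    private
      ∈⇒span = proj₁ ℤ-spanned
      span⇒∈ = proj₂ ℤ-spanned

    𝒪-induction : ∀ (P : Pred Quaternion 0ℓ) → P Q.0# →
      (∀ (c : ℤ) i {v} → P v → P (fromℤ c • generators i Q.+ v)) → ∀ {v} → v ∈ 𝒪 → P v
    𝒪-induction P P0 P+ v∈𝒪 = span-induction (λ c → c / 1) generators P P0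
      (λ c i {v} Pv → subst (λ q → P (q • generators i Q.+ v)) (sym (/1≡fromℤ c)) (P+ c i Pv)) (∈⇒span v∈𝒪)

    0∈𝒪 : Q.0# ∈ 𝒪
    0∈𝒪 = span⇒∈ (0 , (λ ()) , (λ ()) , (λ ()) , ≡⇒≈ refl)

    cons∈𝒪 : ∀ c i {v} → v ∈ 𝒪 → (fromℤ c • generators i Q.+ v) ∈ 𝒪
    cons∈𝒪 c i {v} v∈𝒪 with ∈⇒span v∈𝒪
    ... | k , d , x , x∈e , v≈ = span⇒∈
      ( suc k , (c ∷ d) , (generators i ∷ x) , (λ { zero → i , refl ; (suc j) → x∈e j })
      , ≡⇒≈ (cong₂ Q._+_ (cong (_• generators i) (sym (/1≡fromℤ c))) (≈⇒≡ v≈)))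

    +-closed : ∀ {u v} → u ∈ 𝒪 → v ∈ 𝒪 → (u Q.+ v) ∈ 𝒪
    +-closed {u} {v} u∈𝒪 v∈𝒪 = 𝒪-induction (λ u → (u Q.+ v) ∈ 𝒪)
      (subst 𝒪 (sym (R.+-identityˡ v)) v∈𝒪)
      (λ c i {u} u+v∈𝒪 → subst 𝒪 (sym (R.+-assoc (fromℤ c • generators i) u v)) (cons∈𝒪 c i u+v∈𝒪)) u∈𝒪

    •-closed : ∀ n {v} → v ∈ 𝒪 → (fromℤ n • v) ∈ 𝒪
    •-closed n = 𝒪-induction (λ v → (fromℤ n • v) ∈ 𝒪)
      (subst 𝒪 (•-zero (fromℤ n)) 0∈𝒪)
      (λ c i {v} nv∈𝒪 → subst 𝒪
        (sym (trans (•-distrib-+ (fromℤ n) (fromℤ c • generators i) v)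
          (cong (Q._+ fromℤ n • v) (trans (sym (•-assoc (fromℤ n) (fromℤ c) (generators i)))
            (cong (_• generators i) (sym (fromℤ-* n c)))))))
        (cons∈𝒪 (n ℤ.* c) i nv∈𝒪))
      where
      •-zero : ∀ c → Q.0# ≡ c • Q.0#
      •-zero c = sym (quat-≡ (ℚ.*-zeroʳ c) (ℚ.*-zeroʳ c) (ℚ.*-zeroʳ c) (ℚ.*-zeroʳ c))

    -- One half of commensurability, N 𝒪 ⊆ ℤ⁴: a common denominator of the finitely many generators
    -- survives integer combinations.
    𝒪-bounded : ∃[ N ] N ≢ 0ℤ × ∀ {u} → u ∈ 𝒪 → IntegralQ (fromℤ N • u)
    𝒪-bounded = let N , N≢0 , Ne = common-denominator (boundedQ-finite generators) in bounds N N≢0 Ne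
      where
      bounds : ∀ N → N ≢ 0ℤ → (∀ i → IntegralQ (fromℤ N • generators i)) →
               ∃[ N ] N ≢ 0ℤ × ∀ {u} → u ∈ 𝒪 → IntegralQ (fromℤ N • u)
      bounds N N≢0 Ne = N , N≢0 , 𝒪-induction (λ u → IntegralQ (fromℤ N • u))
        (integralQ zero-integer zero-integer zero-integer zero-integer)
        (λ c i {v} Nv → subst IntegralQ (sym (•-swap (fromℤ N) (fromℤ c) (generators i) v))
          (integralQ-+ (integralQ-• (c , refl) (Ne i)) Nv))
        where
        zero-integer : IsInteger (fromℤ N * 0ℚ)
        zero-integer = 0ℤ , ℚ.*-zeroʳ (fromℤ N)

    -- The rational coefficients of u over the generators are cleared one after the other, each
    -- contributing its denominator to M.
    multiple∈𝒪 : ∀ u → ∃[ M ] M ≢ 0ℤ × (fromℤ M • u) ∈ 𝒪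
    multiple∈𝒪 u = span-induction (λ c → c) generators (λ u → ∃[ M ] M ≢ 0ℤ × (fromℤ M • u) ∈ 𝒪)
      (1ℤ , (λ ()) , subst 𝒪 (sym (1•u≡u Q.0#)) 0∈𝒪) step (ℚ-spanning u)
      where
      step : ∀ (c : ℚ) i {v} → ∃[ M ] M ≢ 0ℤ × (fromℤ M • v) ∈ 𝒪 →
             ∃[ M ] M ≢ 0ℤ × (fromℤ M • (c • generators i Q.+ v)) ∈ 𝒪
      step c i {v} (M , M≢0 , Mv∈𝒪) = M ℤ.* ↧ c , i*j≢0 M≢0 (↧≢0 c) , subst 𝒪
        (sym (•-clear (fromℤ M) c (fromℤ (↧ c)) (fromℤ-* M (↧ c)) (fromℤ-* M (↥ c)) (↧-clears c) (generators i) v))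
        (cons∈𝒪 (M ℤ.* ↥ c) i (•-closed (↧ c) Mv∈𝒪))

    -- The other half, M ℤ⁴ ⊆ 𝒪: M is the product of multipliers T, X, Y, Z that bring 1, i, j, ij
    -- into 𝒪, and each basis vector absorbs the other three as an integer coefficient.
    integral-multiples∈𝒪 : ∃[ M ] M ≢ 0ℤ × ∀ {u} → IntegralQ u → (fromℤ M • u) ∈ 𝒪
    integral-multiples∈𝒪 = combine (multiple∈𝒪 (quat 1ℚ 0ℚ 0ℚ 0ℚ)) (multiple∈𝒪 (quat 0ℚ 1ℚ 0ℚ 0ℚ))
                                   (multiple∈𝒪 (quat 0ℚ 0ℚ 1ℚ 0ℚ)) (multiple∈𝒪 (quat 0ℚ 0ℚ 0ℚ 1ℚ))
      where
      combine : ∃[ T ] T ≢ 0ℤ × (fromℤ T • quat 1ℚ 0ℚ 0ℚ 0ℚ) ∈ 𝒪 → ∃[ X ] X ≢ 0ℤ × (fromℤ X • quat 0ℚ 1ℚ 0ℚ 0ℚ) ∈ 𝒪 →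
                ∃[ Y ] Y ≢ 0ℤ × (fromℤ Y • quat 0ℚ 0ℚ 1ℚ 0ℚ) ∈ 𝒪 → ∃[ Z ] Z ≢ 0ℤ × (fromℤ Z • quat 0ℚ 0ℚ 0ℚ 1ℚ) ∈ 𝒪 →
                ∃[ M ] M ≢ 0ℤ × ∀ {u} → IntegralQ u → (fromℤ M • u) ∈ 𝒪
      combine (T , T≢0 , T∈𝒪) (X , X≢0 , X∈𝒪) (Y , Y≢0 , Y∈𝒪) (Z , Z≢0 , Z∈𝒪) =
        M , i*j≢0 (i*j≢0 T≢0 X≢0) (i*j≢0 Y≢0 Z≢0) , λ {u} → closed {u}
        where
        M = (T ℤ.* X) ℤ.* (Y ℤ.* Z)
        M≡ : fromℤ M ≡ (fromℤ T * fromℤ X) * (fromℤ Y * fromℤ Z)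
        M≡ = trans (fromℤ-* (T ℤ.* X) (Y ℤ.* Z)) (cong₂ _*_ (fromℤ-* T X) (fromℤ-* Y Z))
        closed : ∀ {u} → IntegralQ u → (fromℤ M • u) ∈ 𝒪
        closed {quat _ _ _ _} (integralQ (t , refl) (x , refl) (y , refl) (z , refl)) =
          subst 𝒪 (eq (fromℤ T) (fromℤ X) (fromℤ Y) (fromℤ Z) (fromℤ t) (fromℤ x) (fromℤ y) (fromℤ z)
                    (coefficient t X Y Z) (coefficient x T Y Z) (coefficient y T X Z) (coefficient z T X Y) M≡) (+-closed
            (+-closed (•-closed (t ℤ.* (X ℤ.* (Y ℤ.* Z))) T∈𝒪) (•-closed (x ℤ.* (T ℤ.* (Y ℤ.* Z))) X∈𝒪))
            (+-closed (•-closed (y ℤ.* (T ℤ.* (X ℤ.* Z))) Y∈𝒪) (•-closed (z ℤ.* (T ℤ.* (X ℤ.* Y))) Z∈𝒪)))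
          where
          coefficient : ∀ i j k l → fromℤ (i ℤ.* (j ℤ.* (k ℤ.* l))) ≡ fromℤ i * (fromℤ j * (fromℤ k * fromℤ l))
          coefficient i j k l = trans (fromℤ-* i (j ℤ.* (k ℤ.* l))) (cong (fromℤ i *_)
            (trans (fromℤ-* j (k ℤ.* l)) (cong (fromℤ j *_) (fromℤ-* k l))))
          eq : ∀ T X Y Z t x y z {p q r s m} →
               p ≡ t * (X * (Y * Z)) → q ≡ x * (T * (Y * Z)) → r ≡ y * (T * (X * Z)) → s ≡ z * (T * (X * Y)) →
               m ≡ (T * X) * (Y * Z) →
               p • T • quat 1ℚ 0ℚ 0ℚ 0ℚ Q.+ q • X • quat 0ℚ 1ℚ 0ℚ 0ℚ
                 Q.+ (r • Y • quat 0ℚ 0ℚ 1ℚ 0ℚ Q.+ s • Z • quat 0ℚ 0ℚ 0ℚ 1ℚ)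
               ≡ m • quat t x y z
          eq T X Y Z t x y z refl refl refl refl refl = quat-≡
            (solve 8 (law Poly⁴.t) refl T X Y Z t x y z) (solve 8 (law Poly⁴.x) refl T X Y Z t x y z)
            (solve 8 (law Poly⁴.y) refl T X Y Z t x y z) (solve 8 (law Poly⁴.z) refl T X Y Z t x y z)
            where
            law = λ (π : Poly⁴ 8 → Polynomial 8) T X Y Z t x y z →
              let 0ᴾ = con 0ℚ ; 1ᴾ = con 1ℚ
              in π (scaleᴾ (t :* (X :* (Y :* Z))) (scaleᴾ T (poly 1ᴾ 0ᴾ 0ᴾ 0ᴾ)) ⊕ scaleᴾ (x :* (T :* (Y :* Z))) (scaleᴾ X (poly 0ᴾ 1ᴾ 0ᴾ 0ᴾ))
                   ⊕ (scaleᴾ (y :* (T :* (X :* Z))) (scaleᴾ Y (poly 0ᴾ 0ᴾ 1ᴾ 0ᴾ)) ⊕ scaleᴾ (z :* (T :* (X :* Y))) (scaleᴾ Z (poly 0ᴾ 0ᴾ 0ᴾ 1ᴾ))))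
                 := π (scaleᴾ ((T :* X) :* (Y :* Z)) (poly t x y z))

-- The form q and inverses of similitudes

module HermitianForm (D : QuaternionAlgebra) where
  open Rational D
  open Quaternions D
  open Matrices D
  open Orders D

  -- The standard Hermitian form v v̄ᵀ, whose values are rational because u ū is.
  form : Row → ℚ
  form v = norm (v 0F) + norm (v 1F)

  private
    -- A row is doubled into a square matrix so that the laws for `†` and `·` apply to it; one entry
    -- of the product then carries the value of the form.
    repeat : Row → Matrix
    repeat v _ = v

    row-form : ∀ v → (v · (repeat v †)) 0F ≡ scalar (form v)
    row-form v = trans (·-expand v (repeat v †) 0F) (cong₂ Q._+_ (*-conj (v 0F)) (*-conj (v 1F)))

  •-· : ∀ c u m → (λ i → c • u i) · m ≗ (λ j → c • (u · m) j)
  •-· c u m j = begin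
    ((λ i → c • u i) · m) j                                     ≡⟨ ·-expand (λ i → c • u i) m j ⟩
    (c • u 0F) Q.* m 0F j Q.+ (c • u 1F) Q.* m 1F j             ≡⟨ cong₂ Q._+_ (•-* c (u 0F) (m 0F j)) (•-* c (u 1F) (m 1F j)) ⟩
    c • (u 0F Q.* m 0F j) Q.+ c • (u 1F Q.* m 1F j)             ≡⟨ •-distrib-+ c (u 0F Q.* m 0F j) (u 1F Q.* m 1F j) ⟨
    c • (u 0F Q.* m 0F j Q.+ u 1F Q.* m 1F j)                   ≡⟨ cong (c •_) (·-expand u m j) ⟨
    c • (u · m) j                                               ∎
    where open ≡-Reasoning

  ·-• : ∀ c u m → u · (λ i j → c • m i j) ≗ (λ j → c • (u · m) j)
  ·-• c u m j = begin
    (u · (λ i j → c • m i j)) j                                 ≡⟨ ·-expand u (λ i j → c • m i j) j ⟩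
    u 0F Q.* (c • m 0F j) Q.+ u 1F Q.* (c • m 1F j)             ≡⟨ cong₂ Q._+_ (*-• c (u 0F) (m 0F j)) (*-• c (u 1F) (m 1F j)) ⟩
    c • (u 0F Q.* m 0F j) Q.+ c • (u 1F Q.* m 1F j)             ≡⟨ •-distrib-+ c (u 0F Q.* m 0F j) (u 1F Q.* m 1F j) ⟨
    c • (u 0F Q.* m 0F j Q.+ u 1F Q.* m 1F j)                   ≡⟨ cong (c •_) (·-expand u m j) ⟨
    c • (u · m) j                                               ∎
    where open ≡-Reasoning

  -- (v m)(v m)† = v (m m†) v† = μ v v†, since the scalar μ is central.
  form-similitude : ∀ {μ} m → m M.* (m †) ≗ₘ diagonal (scalar μ) → ∀ v → form (v · m) ≡ μ * form v
  form-similitude {μ} m mm†≡μ v = cong Quaternion.t (begin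
    scalar (form (v · m))
      ≡⟨ row-form (v · m) ⟨
    ((v · m) · (repeat (v · m) †)) 0F
      ≡⟨ ·-congˡ (v · m) {repeat (v · m) †} {(m †) M.* (repeat v †)} (†-* (repeat v) m) 0F ⟩
    ((v · m) · ((m †) M.* (repeat v †))) 0F
      ≡⟨ ·-assoc (v · m) (m †) (repeat v †) 0F ⟨
    (((v · m) · (m †)) · (repeat v †)) 0F
      ≡⟨ ·-congʳ {(v · m) · (m †)} {λ i → μ • v i} (repeat v †) scaled 0F ⟩
    ((λ i → μ • v i) · (repeat v †)) 0F
      ≡⟨ •-· μ v (repeat v †) 0F ⟩
    μ • (v · (repeat v †)) 0F
      ≡⟨ cong (μ •_) (row-form v) ⟩
    μ • scalar (form v) ∎)
    where
    open ≡-Reasoning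
    scaled : (v · m) · (m †) ≗ (λ i → μ • v i)
    scaled i = begin
      ((v · m) · (m †)) i               ≡⟨ ·-assoc v m (m †) i ⟩
      (v · (m M.* (m †))) i             ≡⟨ ·-congˡ v {m M.* (m †)} {diagonal (scalar μ)} mm†≡μ i ⟩
      (v · diagonal (scalar μ)) i       ≡⟨ ·-diagonal v (scalar μ) i ⟩
      v i Q.* scalar μ                  ≡⟨ scalar-*ʳ μ (v i) ⟩
      μ • v i                           ∎

  form-bounded : ∀ {I : Set} {v : I → Row} → (∀ j → BoundedQ (λ i → v i j)) → Bounded (λ i → form (v i))
  form-bounded {v = v} Bv = bounded-+ (norm-bounded (Bv 0F)) (norm-bounded (Bv 1F))
    where
    norm-bounded : ∀ {I : Set} {f : I → Quaternion} → BoundedQ f → Bounded (λ i → norm (f i))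
    -- The norm is the rational coordinate of u ū, so bounds for products and conjugates are enough.
    norm-bounded {f = f} Bf = bounded-≗ (λ i → cong Quaternion.t (*-conj (f i)))
      (proj₁ (boundedQ-* Bf (boundedQ-conj Bf)))

  ·-bounded : ∀ {I : Set} {v : I → Row} m → (∀ k → BoundedQ (λ i → v i k)) → ∀ j → BoundedQ (λ i → (v i · m) j)
  ·-bounded m Bv j = boundedQ-+ (boundedQ-* (Bv 0F) (boundedQ-const (m 0F j)))
    (boundedQ-+ (boundedQ-* (Bv 1F) (boundedQ-const (m 1F j))) (boundedQ-const Q.0#))

  scaled-diagonal : ∀ {c μ} → c * μ ≡ 1ℚ → ∀ i j → c • diagonal (scalar μ) i j ≡ M.1# i j
  scaled-diagonal {c} cμ≡1 0F 0F = quat-≡ cμ≡1 (ℚ.*-zeroʳ c) (ℚ.*-zeroʳ c) (ℚ.*-zeroʳ c)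
  scaled-diagonal {c} cμ≡1 0F 1F = quat-≡ (ℚ.*-zeroʳ c) (ℚ.*-zeroʳ c) (ℚ.*-zeroʳ c) (ℚ.*-zeroʳ c)
  scaled-diagonal {c} cμ≡1 1F 0F = quat-≡ (ℚ.*-zeroʳ c) (ℚ.*-zeroʳ c) (ℚ.*-zeroʳ c) (ℚ.*-zeroʳ c)
  scaled-diagonal {c} cμ≡1 1F 1F = quat-≡ cμ≡1 (ℚ.*-zeroʳ c) (ℚ.*-zeroʳ c) (ℚ.*-zeroʳ c)

  ·-cancel : ∀ m n → m M.* n ≗ₘ M.1# → ∀ u → (u · m) · n ≗ u
  ·-cancel m n mn≡1 u i = trans (·-assoc u m n i) (trans (·-congˡ u {m M.* n} {M.1#} mn≡1 i) (·-identity u i))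

  1·m≗m : ∀ m i → M.1# i · m ≗ m i
  1·m≗m m 0F j = trans (·-expand (M.1# 0F) m j) (trans
    (cong₂ Q._+_ (Ring.*-identityˡ ring (m 0F j)) (Ring.zeroˡ ring (m 1F j))) (Ring.+-identityʳ ring (m 0F j)))
  1·m≗m m 1F j = trans (·-expand (M.1# 1F) m j) (trans
    (cong₂ Q._+_ (Ring.zeroˡ ring (m 0F j)) (Ring.*-identityˡ ring (m 1F j))) (Ring.+-identityˡ ring (m 1F j)))

  module _ {μ : ℚ} (μ⁻¹ : ℚ) (m : Matrix) (mm†≡μ : m M.* (m †) ≗ₘ diagonal (scalar μ)) (μ⁻¹μ≡1 : μ⁻¹ * μ ≡ 1ℚ) where

    similitude⁻¹ : Matrix
    similitude⁻¹ i j = μ⁻¹ • (m †) i j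

    similitude-inverseʳ : m M.* similitude⁻¹ ≗ₘ M.1#
    similitude-inverseʳ i j = trans (·-• μ⁻¹ (m i) (m †) j)
      (trans (cong (μ⁻¹ •_) (mm†≡μ i j)) (scaled-diagonal {μ⁻¹} {μ} μ⁻¹μ≡1 i j))

    -- The right inverse came straight from m m† = μ; for the left one the swapped relation has to
    -- be supplied, which is what `similitude-swap` provides.
    similitude-inverseˡ : (m †) M.* m ≗ₘ diagonal (scalar μ) → similitude⁻¹ M.* m ≗ₘ M.1#
    similitude-inverseˡ m†m≡μ i j = trans (•-· μ⁻¹ ((m †) i) m j)
      (trans (cong (μ⁻¹ •_) (m†m≡μ i j)) (scaled-diagonal {μ⁻¹} {μ} μ⁻¹μ≡1 i j))

-- What the proof needs of the finite adeles 𝔸, the subring Λ = ℤ̂ and the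
-- residues of Λ modulo n!, kept apart from the construction of 𝔸 by fractions,
-- which is expensive to unfold.
record AdeleRing : Set₁ where
  field
    algebra : RationalAlgebra
  open RationalAlgebra algebra public
    using (_≈_; 0#; 1#; embed; embed-+; embed-*; embed-neg; embed-0; embed-1; extension)
    renaming (Carrier to 𝔸; _+_ to _+ᴬ_; _*_ to _*ᴬ_; -_ to -ᴬ_)
  field
    Λ                  : Set
    integral           : Λ → 𝔸
    constant           : ℤ → Λ
    _⊞_ _⊠_            : Λ → Λ → Λ
    integral-⊞         : ∀ x y → integral x +ᴬ integral y ≈ integral (x ⊞ y)
    integral-⊠         : ∀ x y → integral x *ᴬ integral y ≈ integral (x ⊠ y)
    embed-constant     : ∀ z → embed (fromℤ z) ≈ integral (constant z)
    residue            : Λ → ℕ → ℤ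
    residue-⊞          : ∀ x y n → residue (x ⊞ y) n ≡ residue x n ℤ.+ residue y n
    residue-⊠          : ∀ x y n → residue (x ⊠ y) n ≡ residue x n ℤ.* residue y n
    residue-constant   : ∀ z n → residue (constant z) n ≡ z
    integral-injective : ∀ x y → integral x ≈ integral y → ∀ n → + (n !) ∣ residue x n ℤ.- residue y n

-- Rational approximation of finite adeles modulo n!

module Approximation (𝒜 : AdeleRing) (N : ℤ) (n : ℕ) where
  open AdeleRing 𝒜
  open RationalAlgebra algebra using (zeroʳ; distribˡ; +-cong; *-cong; *-commutativeSemigroup)
    renaming (refl to ≈-refl; sym to ≈-sym; trans to ≈-trans)

  infix 4 _∼_
  -- N f is integral and N q is the integer that represents it at level n; thus q agrees with f up
  -- to (n! / N) ℤ̂. The relation depends on the chosen representative, so f may have several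
  -- approximations q.
  record _∼_ (f : 𝔸) (q : ℚ) : Set where
    constructor approximation
    field
      multiple   : Λ
      multiple≈  : embed (fromℤ N) *ᴬ f ≈ integral multiple
      residue≡   : fromℤ (residue multiple n) ≡ fromℤ N * q

  private
    *-swap : ∀ c m q → c * (m * q) ≡ m * (c * q)
    *-swap = solve 3 (λ c m q → c :* (m :* q) := m :* (c :* q)) refl

  0∼0 : 0# ∼ 0ℚ
  0∼0 = approximation (constant 0ℤ)
    (≈-trans (zeroʳ (embed (fromℤ N))) (≈-trans (≈-sym embed-0) (embed-constant 0ℤ)))
    (trans (cong fromℤ (residue-constant 0ℤ n)) (sym (ℚ.*-zeroʳ (fromℤ N))))

  ∼-+ : ∀ {f g p q} → f ∼ p → g ∼ q → f +ᴬ g ∼ p + q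
  ∼-+ {f} {g} {p} {q} (approximation z Nf≈z z≡) (approximation w Ng≈w w≡) = approximation (z ⊞ w)
    (≈-trans (distribˡ (embed (fromℤ N)) f g) (≈-trans (+-cong Nf≈z Ng≈w) (integral-⊞ z w)))
    (trans (cong fromℤ (residue-⊞ z w n)) (trans (fromℤ-+ (residue z n) (residue w n))
      (trans (cong₂ _+_ z≡ w≡) (sym (ℚ.*-distribˡ-+ (fromℤ N) p q)))))

  ∼-* : ∀ c {f q} → f ∼ q → integral c *ᴬ f ∼ fromℤ (residue c n) * q
  ∼-* c {f} {q} (approximation z Nf≈z z≡) = approximation (c ⊠ z)
    (≈-trans (CommutativeSemigroupProperties.x∙yz≈y∙xz *-commutativeSemigroup (embed (fromℤ N)) (integral c) f)
      (≈-trans (*-cong ≈-refl Nf≈z) (integral-⊠ c z)))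
    (trans (cong fromℤ (residue-⊠ c z n)) (trans (fromℤ-* (residue c n) (residue z n))
      (trans (cong (fromℤ (residue c n) *_) z≡) (*-swap (fromℤ (residue c n)) (fromℤ N) q))))

  ∼-resp-≈ : ∀ {f g q} → f ≈ g → g ∼ q → f ∼ q
  ∼-resp-≈ f≈g (approximation z Ng≈z z≡) = approximation z (≈-trans (*-cong ≈-refl f≈g) Ng≈z) z≡

  ∼-embed : ∀ {q} → IsInteger (fromℤ N * q) → embed q ∼ q
  ∼-embed {q} (z , Nq≡z) = approximation (constant z)
    (≈-trans (≈-sym (embed-* (fromℤ N) q)) (subst (λ r → embed r ≈ integral (constant z)) (sym Nq≡z) (embed-constant z)))
    (trans (cong fromℤ (residue-constant z n)) (sym Nq≡z))

  -- N p and N q represent the same integral adele N f at level n, hence differ by a multiple of n!,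
  -- and n! = K N M. Cancelling N leaves a multiple of M.
  ∼-unique : ∀ M K → N ≢ 0ℤ → + (n !) ≡ K ℤ.* (N ℤ.* M) → ∀ {f p q} → f ∼ p → f ∼ q →
             ∃[ T ] p - q ≡ fromℤ M * fromℤ T
  ∼-unique M K N≢0 n!≡KNM {f} {p} {q} (approximation z Nf≈z z≡) (approximation w Nf≈w w≡) =
    conclude (integral-injective z w (≈-trans (≈-sym Nf≈z) Nf≈w) n)
    where
    open ≡-Reasoning
    expand : ∀ m p q → m * (p - q) ≡ m * p - m * q
    expand = solve 3 (λ m p q → m :* (p :+ :- q) := m :* p :+ :- (m :* q)) refl
    rearrange : ∀ T K N M → T ℤ.* (K ℤ.* (N ℤ.* M)) ≡ N ℤ.* (M ℤ.* (K ℤ.* T))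
    rearrange = solve-∀
    conclude : + (n !) ∣ residue z n ℤ.- residue w n → ∃[ T ] p - q ≡ fromℤ M * fromℤ T
    conclude (divides T z-w≡Tn!) = K ℤ.* T , *-cancelˡ-≢0 (fromℤ≢0 N≢0) (begin
      fromℤ N * (p - q)                                ≡⟨ expand (fromℤ N) p q ⟩
      fromℤ N * p - fromℤ N * q                        ≡⟨ cong₂ _-_ z≡ w≡ ⟨
      fromℤ (residue z n) - fromℤ (residue w n)        ≡⟨ cong (λ r → fromℤ (residue z n) + r) (fromℤ-neg (residue w n)) ⟨
      fromℤ (residue z n) + fromℤ (ℤ.- residue w n)    ≡⟨ fromℤ-+ (residue z n) (ℤ.- residue w n) ⟨
      fromℤ (residue z n ℤ.- residue w n)              ≡⟨ cong fromℤ (trans z-w≡Tn! (trans (cong (T ℤ.*_) n!≡KNM) (rearrange T K N M))) ⟩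
      fromℤ (N ℤ.* (M ℤ.* (K ℤ.* T)))                  ≡⟨ fromℤ-* N (M ℤ.* (K ℤ.* T)) ⟩
      fromℤ N * fromℤ (M ℤ.* (K ℤ.* T))                ≡⟨ cong (fromℤ N *_) (fromℤ-* M (K ℤ.* T)) ⟩
      fromℤ N * (fromℤ M * fromℤ (K ℤ.* T))            ∎)

-- A rational vector in the completion of 𝒪² lies in 𝒪²

module Saturation (D : QuaternionAlgebra) (𝒜 : AdeleRing) {𝒪 : Pred (Rational.Quaternion D) 0ℓ} (isOrder : IsOrder D 𝒪) where
  open AdeleRing 𝒜 using (Λ; residue; integral; extension)
  open Rational D
  open Quaternions D
  open Matrices D using (•-distrib-+)
  open Orders D
  open OrderProperties isOrder
  private
    module 𝔸 = BaseChange D extension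
    module A = BaseChangeProperties D (AdeleRing.algebra 𝒜)
    module R = Ring ring
  open A.Completion integral using (combination; hat)

  module _ (N : ℤ) (n : ℕ) where
    open Approximation 𝒜 N n

    record _∼Q_ (v : 𝔸.Quaternion) (u : Quaternion) : Set where
      constructor approximationQ
      field
        t∼ : 𝔸.Quaternion.t v ∼ Quaternion.t u
        x∼ : 𝔸.Quaternion.x v ∼ Quaternion.x u
        y∼ : 𝔸.Quaternion.y v ∼ Quaternion.y u
        z∼ : 𝔸.Quaternion.z v ∼ Quaternion.z u

    ∼Q-resp-≈ : ∀ {v v′ w} → v 𝔸.Q.≈ v′ → v′ ∼Q w → v ∼Q w
    ∼Q-resp-≈ (t , x , y , z) (approximationQ t′ x′ y′ z′) = approximationQ
      (∼-resp-≈ t t′) (∼-resp-≈ x x′) (∼-resp-≈ y y′) (∼-resp-≈ z z′)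

    approximants : ∀ {k} → Vector Λ k → Vector Quaternion k → Quaternion
    approximants c u = sum Q.+-rawMonoid (λ i → fromℤ (residue (c i) n) • u i)

    approximants∈𝒪 : ∀ {k} (c : Vector Λ k) (u : Vector Quaternion k) → (∀ i → u i ∈ 𝒪) → approximants c u ∈ 𝒪
    approximants∈𝒪 {zero}  c u u∈𝒪 = 0∈𝒪
    approximants∈𝒪 {suc k} c u u∈𝒪 = +-closed (•-closed (residue (c zero) n) (u∈𝒪 zero))
      (approximants∈𝒪 (λ i → c (suc i)) (λ i → u (suc i)) (λ i → u∈𝒪 (suc i)))

    ∼Q-embed : ∀ {v} u → v 𝔸.Q.≈ A.bc u → IntegralQ (fromℤ N • u) → v ∼Q u
    ∼Q-embed u (t , x , y , z) (integralQ t′ x′ y′ z′) = approximationQ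
      (∼-resp-≈ t (∼-embed t′)) (∼-resp-≈ x (∼-embed x′)) (∼-resp-≈ y (∼-embed y′)) (∼-resp-≈ z (∼-embed z′))

    combination∼ : ∀ {k} (c : Vector Λ k) (x : Vector 𝔸.Row k) (u : Vector Quaternion k) j →
      (∀ i → x i j 𝔸.Q.≈ A.bc (u i)) → (∀ i → IntegralQ (fromℤ N • u i)) →
      combination c x j ∼Q approximants c u
    combination∼ {zero}  c x u j x≈u Nu = approximationQ 0∼0 0∼0 0∼0 0∼0
    combination∼ {suc k} c x u j x≈u Nu
      with ∼Q-embed (u zero) (x≈u zero) (Nu zero)
         | combination∼ (λ i → c (suc i)) (λ i → x (suc i)) (λ i → u (suc i)) j (λ i → x≈u (suc i)) (λ i → Nu (suc i))
    ... | approximationQ t x′ y z | approximationQ t′ x″ y′ z′ = approximationQ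
      (∼-+ (∼-* (c zero) t) t′) (∼-+ (∼-* (c zero) x′) x″) (∼-+ (∼-* (c zero) y) y′) (∼-+ (∼-* (c zero) z) z′)

  private
    -- At level |N M| two approximations of the same quaternion differ by an element of M ℤ⁴ ⊆ 𝒪, so
    -- membership in 𝒪 passes from one to the other.
    ∼-unique∈𝒪 : ∀ N M → N ≢ 0ℤ → M ≢ 0ℤ → (∀ {u} → IntegralQ u → (fromℤ M • u) ∈ 𝒪) →
      ∀ {v u w} → (_∼Q_ N ℤ.∣ N ℤ.* M ∣ v u) → (_∼Q_ N ℤ.∣ N ℤ.* M ∣ v w) → w ∈ 𝒪 → u ∈ 𝒪
    ∼-unique∈𝒪 N M N≢0 M≢0 M∈𝒪 {v} {u} {w} (approximationQ t x y z) (approximationQ t′ x′ y′ z′) w∈𝒪 =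
      conclude (unique t t′) (unique x x′) (unique y y′) (unique z z′)
      where
      n = ℤ.∣ N ℤ.* M ∣
      instance
        n≢0 : ℕ.NonZero n
        n≢0 = ℤ.≢-nonZero (i*j≢0 N≢0 M≢0)
      NM∣n! : N ℤ.* M ∣ + (n !)
      NM∣n! = ∣-trans m∣∣m∣ (∣ᵤ⇒∣ (n∣n! n))
      open _∣_ NM∣n! renaming (quotient to K; equality to n!≡KNM)
      open Approximation 𝒜 N n
      unique : ∀ {f p q} → f ∼ p → f ∼ q → ∃[ T ] p - q ≡ fromℤ M * fromℤ T
      unique = ∼-unique M K N≢0 n!≡KNM
      add-back : ∀ p q r → p - q ≡ r → p ≡ q + r
      add-back p q r refl = solve 2 (λ p q → p := q :+ (p :+ :- q)) refl p q
      conclude : (∃[ T ] Quaternion.t u - Quaternion.t w ≡ fromℤ M * fromℤ T) →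
                 (∃[ X ] Quaternion.x u - Quaternion.x w ≡ fromℤ M * fromℤ X) →
                 (∃[ Y ] Quaternion.y u - Quaternion.y w ≡ fromℤ M * fromℤ Y) →
                 (∃[ Z ] Quaternion.z u - Quaternion.z w ≡ fromℤ M * fromℤ Z) → u ∈ 𝒪
      conclude (T , t≡) (X , x≡) (Y , y≡) (Z , z≡) = subst 𝒪
        (sym (quat-≡ (add-back _ _ _ t≡) (add-back _ _ _ x≡) (add-back _ _ _ y≡) (add-back _ _ _ z≡)))
        (+-closed w∈𝒪 (M∈𝒪 {quat (fromℤ T) (fromℤ X) (fromℤ Y) (fromℤ Z)}
          (integralQ (T , refl) (X , refl) (Y , refl) (Z , refl))))

  -- If w = Σᵢ cᵢ uᵢ with cᵢ ∈ ℤ̂, then replacing each cᵢ by an integer congruent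
  -- to it modulo n! changes w by an element of (n! / N) ℤ⁴, where N is a common
  -- denominator of w and the uᵢ; this is contained in 𝒪 for n = |N M| if
  -- M ℤ⁴ ⊆ 𝒪.
  bc∈hat⇒∈ : ∀ w → A.bcᴿ w ∈ hat (standard D 𝒪) → w ∈ standard D 𝒪
  bc∈hat⇒∈ w (k , c , x , x∈ , w≈) j =
    let M , M≢0 , M∈𝒪 = integral-multiples∈𝒪
        -- A single denominator for the target `w j`, at index `zero`, and for all the rational
        -- vectors that span it, at the successors.
        N , N≢0 , Nf = common-denominator (boundedQ-finite (w j ∷ u))
        n = ℤ.∣ N ℤ.* M ∣
    in ∼-unique∈𝒪 N M N≢0 M≢0 M∈𝒪
         (∼Q-embed N n (w j) (A.≈-refl {A.bc (w j)}) (Nf zero))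
         (∼Q-resp-≈ N n (w≈ j) (combination∼ N n c x u j (λ i → proj₂ (proj₂ (x∈ i)) j) (λ i → Nf (suc i))))
         (approximants∈𝒪 N n c u (λ i → proj₁ (proj₂ (x∈ i)) j))
    where
    u : Vector Quaternion k
    u i = proj₁ (x∈ i) j

-- The stabiliser of the lattice L = 𝒪² g

module Lattice (D : QuaternionAlgebra) (𝒜 : AdeleRing) {𝒪 : Pred (Rational.Quaternion D) 0ℓ} (isOrder : IsOrder D 𝒪)
  (G : GL₂ D) where

  open Rational D
  open Quaternions D
  open Matrices D
  open Orders D
  open OrderProperties isOrder
  open HermitianForm D
  open Saturation D 𝒜 isOrder using (bc∈hat⇒∈)
  private
    module R = Ring ring
    module A = BaseChangeProperties D (AdeleRing.algebra 𝒜)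
    module 𝔸 = BaseChange D (AdeleRing.extension 𝒜)
  open A.Completion (AdeleRing.integral 𝒜)

  g g⁻¹ : Matrix
  g = proj₁ G
  g⁻¹ = proj₁ (proj₂ G)

  g⁻¹g≈1 : g⁻¹ M.* g M.≈ M.1#
  g⁻¹g≈1 = proj₁ (proj₂ (proj₂ G))

  gg⁻¹≈1 : g M.* g⁻¹ M.≈ M.1#
  gg⁻¹≈1 = proj₂ (proj₂ (proj₂ G))

  L : Pred Row 0ℓ
  L = standard D 𝒪 ·ₗ g

  -- Only one inclusion. Stability L γ = L is handled as this property for γ and for γ⁻¹, because
  -- the two inclusions are used separately.
  Preserves : Matrix → Set
  Preserves m = ∀ u → u ∈ L → (u · m) ∈ L

  ·g-cancel : ∀ u → (u · g) · g⁻¹ ≗ u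
  ·g-cancel = ·-cancel g g⁻¹ (≈⇒≗ₘ {g M.* g⁻¹} {M.1#} gg⁻¹≈1)

  ·g⁻¹-cancel : ∀ u → (u · g⁻¹) · g ≗ u
  ·g⁻¹-cancel = ·-cancel g⁻¹ g (≈⇒≗ₘ {g⁻¹ M.* g} {M.1#} g⁻¹g≈1)

  standard-resp : ∀ {u v} → u ≗ v → u ∈ standard D 𝒪 → v ∈ standard D 𝒪
  standard-resp u≗v u∈ i = subst 𝒪 (u≗v i) (u∈ i)

  ∈L⇒·g⁻¹∈ : ∀ u → u ∈ L → (u · g⁻¹) ∈ standard D 𝒪
  ∈L⇒·g⁻¹∈ u (w , w∈ , u≈wg) = standard-resp {w} {u · g⁻¹}
    (λ i → sym (trans (·-congʳ {u} {w · g} g⁻¹ (λ j → ≈⇒≡ (u≈wg j)) i) (·g-cancel w i))) w∈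

  ·g⁻¹∈⇒∈L : ∀ u → (u · g⁻¹) ∈ standard D 𝒪 → u ∈ L
  ·g⁻¹∈⇒∈L u ug⁻¹∈ = u · g⁻¹ , ug⁻¹∈ , λ i → ≡⇒≈ (sym (·g⁻¹-cancel u i))

  M1∈𝒪 : ∀ i → M.1# i ∈ standard D 𝒪
  M1∈𝒪 0F 0F = 1∈𝒪
  M1∈𝒪 0F 1F = 0∈𝒪
  M1∈𝒪 1F 0F = 0∈𝒪
  M1∈𝒪 1F 1F = 1∈𝒪

  g-row∈L : ∀ i → g i ∈ L
  g-row∈L i = M.1# i , M1∈𝒪 i , λ j → ≡⇒≈ (sym (1·m≗m g i j))

  -- Multiplication by g⁻¹ carries L̂ into the completion of 𝒪² and keeps rational rows rational,
  -- which reduces the claim to 𝒪².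
  bc∈L̂⇒∈L : ∀ u → A.bcᴿ u ∈ hat L → u ∈ L
  bc∈L̂⇒∈L u û∈L̂ = ·g⁻¹∈⇒∈L u (bc∈hat⇒∈ (u · g⁻¹)
    (hat-resp-≈ (standard D 𝒪) {A.bcᴿ u 𝔸.· A.bcᴹ g⁻¹} {A.bcᴿ (u · g⁻¹)}
      (A.≈ᵣ-sym {A.bcᴿ (u · g⁻¹)} {A.bcᴿ u 𝔸.· A.bcᴹ g⁻¹} (A.bc-· u g⁻¹))
      (hat-· L (standard D 𝒪) g⁻¹ ∈L⇒·g⁻¹∈ {A.bcᴿ u} û∈L̂)))

  bc∈L̂ : ∀ u → u ∈ L → A.bcᴿ u ∈ hat L
  bc∈L̂ = ∈-hat L (constant 1ℤ) (K.trans (K.sym (embed-constant 1ℤ)) embed-1)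
    where
    open AdeleRing 𝒜 using (constant; embed-constant; embed-1)
    module K = RationalAlgebra (AdeleRing.algebra 𝒜)

  L̂γ⊆L̂⇒preserves : ∀ γ → (hat L 𝔸.·ₗ A.bcᴹ γ) ⊆ hat L → Preserves γ
  L̂γ⊆L̂⇒preserves γ L̂γ⊆L̂ u u∈L = bc∈L̂⇒∈L (u · γ)
    (L̂γ⊆L̂ {A.bcᴿ (u · γ)} (A.bcᴿ u , bc∈L̂ u u∈L , A.bc-· u γ))

  -- The vector v ∈ L̂ with u = v γ is a priori adelic. Cancelling γ identifies it with u γ⁻¹, which
  -- is rational, so it lies in L.
  L̂⊆L̂γ⇒preserves : ∀ γ γ⁻¹ → (∀ u → (u · γ) · γ⁻¹ ≗ u) → hat L ⊆ (hat L 𝔸.·ₗ A.bcᴹ γ) → Preserves γ⁻¹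
  L̂⊆L̂γ⇒preserves γ γ⁻¹ cancel L̂⊆L̂γ u u∈L = bc∈L̂⇒∈L (u · γ⁻¹) (from (L̂⊆L̂γ {A.bcᴿ u} (bc∈L̂ u u∈L)))
    where
    from : A.bcᴿ u ∈ (hat L 𝔸.·ₗ A.bcᴹ γ) → A.bcᴿ (u · γ⁻¹) ∈ hat L
    from (v , v∈L̂ , û≈vγ) = hat-resp-≈ L {v} {A.bcᴿ (u · γ⁻¹)}
      (A.≈ᵣ-sym {A.bcᴿ (u · γ⁻¹)} {v}
        (A.≈ᵣ-trans {A.bcᴿ (u · γ⁻¹)} {A.bcᴿ u 𝔸.· A.bcᴹ γ⁻¹} {v} (A.bc-· u γ⁻¹)
          (A.≈ᵣ-trans {A.bcᴿ u 𝔸.· A.bcᴹ γ⁻¹} {(v 𝔸.· A.bcᴹ γ) 𝔸.· A.bcᴹ γ⁻¹} {v}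
            (A.·-≈-congˡ {A.bcᴿ u} {v 𝔸.· A.bcᴹ γ} (A.bcᴹ γ⁻¹) û≈vγ)
            (hat-·-cancel L γ γ⁻¹ cancel {v} v∈L̂)))) v∈L̂

  preserves⇒L̂γ⊆L̂ : ∀ γ → Preserves γ → (hat L 𝔸.·ₗ A.bcᴹ γ) ⊆ hat L
  preserves⇒L̂γ⊆L̂ γ Lγ⊆L {v} (u , u∈L̂ , v≈uγ) = hat-resp-≈ L {u 𝔸.· A.bcᴹ γ} {v}
    (A.≈ᵣ-sym {v} {u 𝔸.· A.bcᴹ γ} v≈uγ) (hat-· L L γ Lγ⊆L {u} u∈L̂)

  preserves⇒L̂⊆L̂γ : ∀ γ γ⁻¹ → (∀ u → (u · γ⁻¹) · γ ≗ u) → Preserves γ⁻¹ → hat L ⊆ (hat L 𝔸.·ₗ A.bcᴹ γ)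
  preserves⇒L̂⊆L̂γ γ γ⁻¹ cancel Lγ⁻¹⊆L {v} v∈L̂ =
    v 𝔸.· A.bcᴹ γ⁻¹ , hat-· L L γ⁻¹ Lγ⁻¹⊆L {v} v∈L̂ ,
    A.≈ᵣ-sym {(v 𝔸.· A.bcᴹ γ⁻¹) 𝔸.· A.bcᴹ γ} {v} (hat-·-cancel L γ⁻¹ γ cancel {v} v∈L̂)

  conjugate : Matrix → Matrix
  conjugate m = (g M.* m) M.* g⁻¹

  -- Row i of g m g⁻¹ is the image under g⁻¹ of the i-th row of g times m, and the rows of g belong
  -- to L.
  conjugate∈𝒪 : ∀ m → Preserves m → ∀ i j → conjugate m i j ∈ 𝒪
  conjugate∈𝒪 m Lm⊆L i = ∈L⇒·g⁻¹∈ (g i · m) (Lm⊆L (g i) (g-row∈L i))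

  ·-conjugate : ∀ m u → u · conjugate m ≗ ((u · g) · m) · g⁻¹
  ·-conjugate m u i = sym (begin
    (((u · g) · m) · g⁻¹) i       ≡⟨ ·-congʳ {(u · g) · m} {u · (g M.* m)} g⁻¹ (·-assoc u g m) i ⟩
    ((u · (g M.* m)) · g⁻¹) i     ≡⟨ ·-assoc u (g M.* m) g⁻¹ i ⟩
    (u · conjugate m) i           ∎)
    where open ≡-Reasoning

  conjugate-inverse : ∀ m n → (∀ u → (u · m) · n ≗ u) → conjugate m M.* conjugate n ≗ₘ M.1#
  conjugate-inverse m n cancel i j = begin
    (conjugate m i · conjugate n) j
      ≡⟨ ·-conjugate n (conjugate m i) j ⟩
    (((((g i · m) · g⁻¹) · g) · n) · g⁻¹) j
      ≡⟨ ·-congʳ {(((g i · m) · g⁻¹) · g) · n} {(g i · m) · n} g⁻¹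
           (·-congʳ {((g i · m) · g⁻¹) · g} {g i · m} n (·g⁻¹-cancel (g i · m))) j ⟩
    (((g i · m) · n) · g⁻¹) j
      ≡⟨ ·-congʳ {(g i · m) · n} {g i} g⁻¹ (cancel (g i)) j ⟩
    (g i · g⁻¹) j
      ≡⟨ ≈⇒≡ (gg⁻¹≈1 i j) ⟩
    M.1# i j ∎
    where open ≡-Reasoning

  conjugate-back : ∀ m → m ≗ₘ g⁻¹ M.* conjugate m M.* g
  conjugate-back m i j = sym (begin
    ((g⁻¹ i · conjugate m) · g) j
      ≡⟨ ·-congʳ {g⁻¹ i · conjugate m} {((g⁻¹ i · g) · m) · g⁻¹} g (·-conjugate m (g⁻¹ i)) j ⟩
    ((((g⁻¹ i · g) · m) · g⁻¹) · g) j
      ≡⟨ ·g⁻¹-cancel ((g⁻¹ i · g) · m) j ⟩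
    ((g⁻¹ i · g) · m) j
      ≡⟨ ·-congʳ {g⁻¹ i · g} {M.1# i} m (λ k → ≈⇒≡ (g⁻¹g≈1 i k)) j ⟩
    (M.1# i · m) j
      ≡⟨ 1·m≗m m i j ⟩
    m i j ∎)
    where open ≡-Reasoning

  ·-in-𝒪 : ∀ h → (∀ i j → h i j ∈ 𝒪) → ∀ u → u ∈ standard D 𝒪 → (u · h) ∈ standard D 𝒪
  ·-in-𝒪 h h∈𝒪 u u∈ j = subst 𝒪 (sym (·-expand u h j))
    (+-closed (*-closed (u∈ 0F) (h∈𝒪 0F j)) (*-closed (u∈ 1F) (h∈𝒪 1F j)))

  ·-conjugated : ∀ h u → u · (g⁻¹ M.* h M.* g) ≗ ((u · g⁻¹) · h) · g
  ·-conjugated h u i = sym (begin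
    (((u · g⁻¹) · h) · g) i          ≡⟨ ·-congʳ {(u · g⁻¹) · h} {u · (g⁻¹ M.* h)} g (·-assoc u g⁻¹ h) i ⟩
    ((u · (g⁻¹ M.* h)) · g) i        ≡⟨ ·-assoc u (g⁻¹ M.* h) g i ⟩
    (u · (g⁻¹ M.* h M.* g)) i        ∎)
    where open ≡-Reasoning

  conjugated-preserves : ∀ m h → m ≗ₘ g⁻¹ M.* h M.* g → (∀ i j → h i j ∈ 𝒪) → Preserves m
  conjugated-preserves m h m≗ h∈𝒪 u u∈L =
    (u · g⁻¹) · h , ·-in-𝒪 h h∈𝒪 (u · g⁻¹) (∈L⇒·g⁻¹∈ u u∈L) ,
    λ i → ≡⇒≈ (trans (·-congˡ u {m} {g⁻¹ M.* h M.* g} m≗ i) (·-conjugated h u i))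

  conjugated-cancel : ∀ h k → k M.* h ≗ₘ M.1# →
    ∀ u → (u · (g⁻¹ M.* k M.* g)) · (g⁻¹ M.* h M.* g) ≗ u
  conjugated-cancel h k kh≡1 u i = begin
    ((u · (g⁻¹ M.* k M.* g)) · (g⁻¹ M.* h M.* g)) i
      ≡⟨ ·-congʳ {u · (g⁻¹ M.* k M.* g)} {((u · g⁻¹) · k) · g} (g⁻¹ M.* h M.* g) (·-conjugated k u) i ⟩
    ((((u · g⁻¹) · k) · g) · (g⁻¹ M.* h M.* g)) i
      ≡⟨ ·-conjugated h (((u · g⁻¹) · k) · g) i ⟩
    ((((((u · g⁻¹) · k) · g) · g⁻¹) · h) · g) i
      ≡⟨ ·-congʳ {((((u · g⁻¹) · k) · g) · g⁻¹) · h} {((u · g⁻¹) · k) · h} g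
           (·-congʳ {(((u · g⁻¹) · k) · g) · g⁻¹} {(u · g⁻¹) · k} h (·g-cancel ((u · g⁻¹) · k))) i ⟩
    ((((u · g⁻¹) · k) · h) · g) i
      ≡⟨ ·-congʳ {((u · g⁻¹) · k) · h} {u · g⁻¹} g (·-cancel k h kh≡1 (u · g⁻¹)) i ⟩
    ((u · g⁻¹) · g) i
      ≡⟨ ·g⁻¹-cancel u i ⟩
    u i ∎
    where open ≡-Reasoning

  module _ (a<0 : QuaternionAlgebra.a D < 0ℚ) (b<0 : QuaternionAlgebra.b D < 0ℚ) where
    open Definite a<0 b<0

    private
      -- Membership is carried along because this type is both the index set of the common
      -- denominator and the space on which the descent iterates γ.
      Vector∈L : Set
      Vector∈L = Σ Row L

      -- Writing v = (v g⁻¹) g puts v g⁻¹ in 𝒪², whose coordinates have a common denominator; the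
      -- fixed matrix g and the form preserve boundedness.
      form-bounded-on-L : Bounded {Vector∈L} (λ (v , _) → form v)
      form-bounded-on-L = bounded-≗ {f = λ (v , _) → form ((v · g⁻¹) · g)} {g = λ (v , _) → form v}
        (λ (v , _) → cong₂ (λ x y → norm x + norm y) (·g⁻¹-cancel v 0F) (·g⁻¹-cancel v 1F))
        (form-bounded {v = λ (v , _) → (v · g⁻¹) · g} (·-bounded {v = λ (v , _) → v · g⁻¹} g (λ k → from-𝒪 k 𝒪-bounded)))
        where
        from-𝒪 : ∀ k → (∃[ N ] N ≢ 0ℤ × ∀ {u} → u ∈ 𝒪 → IntegralQ (fromℤ N • u)) →
                 BoundedQ {Vector∈L} (λ (v , _) → (v · g⁻¹) k)
        from-𝒪 k (N , N≢0 , N𝒪) =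
            bounded N N≢0 (λ v → IntegralQ.t-integer (integral v)) , bounded N N≢0 (λ v → IntegralQ.x-integer (integral v))
          , bounded N N≢0 (λ v → IntegralQ.y-integer (integral v)) , bounded N N≢0 (λ v → IntegralQ.z-integer (integral v))
          where
          integral : ∀ ((v , _) : Vector∈L) → IntegralQ (fromℤ N • (v · g⁻¹) k)
          integral (v , v∈L) = N𝒪 (∈L⇒·g⁻¹∈ v v∈L k)

      form-nonNeg : ∀ v → 0ℚ ≤ form v
      form-nonNeg v = +-nonNeg (norm-nonNeg (v 0F)) (norm-nonNeg (v 1F))

      -- The descent needs a starting vector of positive value. The first row of g is in L and is
      -- nonzero because g has a right inverse.
      0<form-g₀ : 0ℚ < form (g 0F)
      0<form-g₀ = ≤∧≢⇒< (form-nonNeg (g 0F)) λ form≡0 →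
        let N₀≡0 , N₁≡0 = nonNeg+nonNeg≡0 (norm-nonNeg (g 0F 0F)) (norm-nonNeg (g 0F 1F)) form≡0
        in g₀≢0 (norm≡0⇒≡0 (g 0F 0F) N₀≡0) (norm≡0⇒≡0 (g 0F 1F) N₁≡0)
        where
        open ≡-Reasoning
        1≢0Q : Q.1# ≢ Q.0#
        1≢0Q eq = ℚ.1≢0 (cong Quaternion.t eq)
        g₀≢0 : g 0F 0F ≡ Q.0# → g 0F 1F ≡ Q.0# → ⊥
        g₀≢0 g₀₀≡0 g₀₁≡0 = 1≢0Q (begin
          Q.1#                                                      ≡⟨ ≈⇒≡ (gg⁻¹≈1 0F 0F) ⟨
          (g 0F · g⁻¹) 0F                                           ≡⟨ ·-expand (g 0F) g⁻¹ 0F ⟩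
          g 0F 0F Q.* g⁻¹ 0F 0F Q.+ g 0F 1F Q.* g⁻¹ 1F 0F           ≡⟨ cong₂ (λ x y → x Q.* g⁻¹ 0F 0F Q.+ y Q.* g⁻¹ 1F 0F) g₀₀≡0 g₀₁≡0 ⟩
          Q.0# Q.* g⁻¹ 0F 0F Q.+ Q.0# Q.* g⁻¹ 1F 0F                 ≡⟨ cong₂ Q._+_ (R.zeroˡ (g⁻¹ 0F 0F)) (R.zeroˡ (g⁻¹ 1F 0F)) ⟩
          Q.0#                                                      ∎)

    preserves⇒¬contraction : ∀ m ν → Preserves m → (∀ v → form (v · m) ≡ ν * form v) → 0ℚ < ν → ν < 1ℚ → ⊥
    preserves⇒¬contraction m ν Lm⊆L form-m 0<ν ν<1 = contradiction form-bounded-on-L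
      where
      contradiction : Bounded {Vector∈L} (λ (v , _) → form v) → ⊥
      contradiction (bounded N N≢0 N-form) = no-contraction {Vector∈L} Φ
        (λ v → integer-* (N , refl) (N-form v)) (λ (v , v∈L) → v · m , Lm⊆L v v∈L) ν
        (λ (v , _) → trans (cong (λ q → fromℤ N * (fromℤ N * q)) (form-m v)) (swap (fromℤ N) ν (form v)))
        0<ν ν<1 (g 0F , g-row∈L 0F) 0<Φ
        where
        -- The second factor N keeps the values integral and makes the overall factor N² positive,
        -- whatever the sign of N.
        Φ : Vector∈L → ℚ
        Φ (v , _) = fromℤ N * (fromℤ N * form v)
        swap : ∀ N ν q → N * (N * (ν * q)) ≡ ν * (N * (N * q))
        swap = solve 3 (λ N ν q → N :* (N :* (ν :* q)) := ν :* (N :* (N :* q))) refl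
        0<N² : 0ℚ < fromℤ N * fromℤ N
        0<N² with ℚ.<-cmp (fromℤ N) 0ℚ
        ... | tri< N<0 _ _ = neg*neg-pos N<0 N<0
        ... | tri≈ _ N≡0 _ = ⊥-elim (fromℤ≢0 N≢0 N≡0)
        ... | tri> _ _ 0<N = *-pos 0<N 0<N
        0<Φ : 0ℚ < Φ (g 0F , g-row∈L 0F)
        0<Φ = subst (0ℚ <_) (ℚ.*-assoc (fromℤ N) (fromℤ N) (form (g 0F))) (*-pos 0<N² 0<form-g₀)

    -- The diagonal of γ γ† shows that μ is the value of the form on the first row of γ.
    similitude-pos : ∀ {μ} γ → γ M.* (γ †) ≗ₘ diagonal (scalar μ) → μ ≢ 0ℚ → 0ℚ < μ
    similitude-pos γ γγ†≡μ = ≤∧≢⇒<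
      (subst (0ℚ ≤_) (similitude-diagonal {m = γ} γγ†≡μ 0F) (form-nonNeg (γ 0F)))

    -- If μ < 1 then γ contracts the form on L, and if μ > 1 then γ⁻¹ does. Both are excluded by
    -- descent, and for the second the invariance of L under γ⁻¹ is essential.
    stabilizer-similitude≡1 : ∀ {μ} μ⁻¹ γ γ⁻¹ → γ M.* (γ †) ≗ₘ diagonal (scalar μ) → μ⁻¹ * μ ≡ 1ℚ → μ ≢ 0ℚ →
      (∀ u → (u · γ⁻¹) · γ ≗ u) → Preserves γ → Preserves γ⁻¹ → μ ≡ 1ℚ
    stabilizer-similitude≡1 {μ} μ⁻¹ γ γ⁻¹ γγ†≡μ μ⁻¹μ≡1 μ≢0 cancel Lγ⊆L Lγ⁻¹⊆L with ℚ.<-cmp μ 1ℚ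
    ... | tri≈ _ μ≡1 _ = μ≡1
    ... | tri< μ<1 _ _ = ⊥-elim (preserves⇒¬contraction γ μ Lγ⊆L (form-similitude γ γγ†≡μ) (similitude-pos γ γγ†≡μ μ≢0) μ<1)
    ... | tri> _ _ 1<μ = ⊥-elim (preserves⇒¬contraction γ⁻¹ μ⁻¹ Lγ⁻¹⊆L form-γ⁻¹ 0<μ⁻¹ μ⁻¹<1)
      where
      open ≡-Reasoning
      0<μ⁻¹ : 0ℚ < μ⁻¹
      0<μ⁻¹ = 1/pos μ⁻¹μ≡1 (ℚ.<-trans (ℚ.positive⁻¹ 1ℚ) 1<μ)
      μ⁻¹<1 : μ⁻¹ < 1ℚ
      μ⁻¹<1 = subst₂ _<_ (ℚ.*-identityʳ μ⁻¹) μ⁻¹μ≡1 (ℚ.*-monoʳ-<-pos μ⁻¹ {{positive 0<μ⁻¹}} 1<μ)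
      -- The scaling law of γ at v γ⁻¹ is divided by μ; here γ⁻¹ acts as a left inverse of γ.
      form-γ⁻¹ : ∀ v → form (v · γ⁻¹) ≡ μ⁻¹ * form v
      form-γ⁻¹ v = begin
        form (v · γ⁻¹)                     ≡⟨ ℚ.*-identityˡ (form (v · γ⁻¹)) ⟨
        1ℚ * form (v · γ⁻¹)                ≡⟨ cong (_* form (v · γ⁻¹)) μ⁻¹μ≡1 ⟨
        μ⁻¹ * μ * form (v · γ⁻¹)           ≡⟨ ℚ.*-assoc μ⁻¹ μ (form (v · γ⁻¹)) ⟩
        μ⁻¹ * (μ * form (v · γ⁻¹))         ≡⟨ cong (μ⁻¹ *_) (form-similitude γ γγ†≡μ (v · γ⁻¹)) ⟨
        μ⁻¹ * form ((v · γ⁻¹) · γ)         ≡⟨ cong (μ⁻¹ *_) (cong₂ (λ x y → norm x + norm y) (cancel v 0F) (cancel v 1F)) ⟩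
        μ⁻¹ * form v                       ∎

    -- The element of GL₂(𝒪) is g γ g⁻¹, with inverse g γ⁻¹ g⁻¹. Each of the two inclusions in L̂ γ
    -- = L̂ makes one of them integral.
    stabilizer⊆unitary : ∀ {γ} → γ ∈ GU₂ → (hat L 𝔸.·ₗ A.bcᴹ γ) ≐ hat L → γ ∈ (SU₂ ∩ conjugateBy D G (GL₂[_] D 𝒪))
    stabilizer⊆unitary {γ} (μ , (μ⁻¹ , μ⁻¹μ≡1 , _) , γγ†≈μ) (L̂γ⊆L̂ , L̂⊆L̂γ) =
        subst (λ μ → HasSimilitude μ γ) μ≡1 γγ†≈μ
      , conjugate γ
      , ( conjugate∈𝒪 γ Lγ⊆L , conjugate γ⁻¹ , conjugate∈𝒪 γ⁻¹ Lγ⁻¹⊆L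
        , ≗ₘ⇒≈ {conjugate γ⁻¹ M.* conjugate γ} {M.1#} (conjugate-inverse γ⁻¹ γ γ⁻¹γ-cancel)
        , ≗ₘ⇒≈ {conjugate γ M.* conjugate γ⁻¹} {M.1#} (conjugate-inverse γ γ⁻¹ γγ⁻¹-cancel))
      , ≗ₘ⇒≈ {γ} {g⁻¹ M.* conjugate γ M.* g} (conjugate-back γ)
      where
      γγ†≡μ : γ M.* (γ †) ≗ₘ diagonal (scalar μ)
      γγ†≡μ = ≈⇒≗ₘ {γ M.* (γ †)} {diagonal (scalar μ)} γγ†≈μ
      μ≢0 : μ ≢ 0ℚ
      μ≢0 refl = ℚ.1≢0 (trans (sym μ⁻¹μ≡1) (ℚ.*-zeroʳ μ⁻¹))
      γ⁻¹ : Matrix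
      γ⁻¹ = similitude⁻¹ μ⁻¹ γ γγ†≡μ μ⁻¹μ≡1
      γγ⁻¹-cancel : ∀ u → (u · γ) · γ⁻¹ ≗ u
      γγ⁻¹-cancel = ·-cancel γ γ⁻¹ (similitude-inverseʳ μ⁻¹ γ γγ†≡μ μ⁻¹μ≡1)
      γ⁻¹γ-cancel : ∀ u → (u · γ⁻¹) · γ ≗ u
      γ⁻¹γ-cancel = ·-cancel γ⁻¹ γ (similitude-inverseˡ μ⁻¹ γ γγ†≡μ μ⁻¹μ≡1 (similitude-swap {m = γ} μ≢0 γγ†≡μ))
      Lγ⊆L : Preserves γ
      Lγ⊆L = L̂γ⊆L̂⇒preserves γ (λ {v} → L̂γ⊆L̂ {v})
      Lγ⁻¹⊆L : Preserves γ⁻¹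
      Lγ⁻¹⊆L = L̂⊆L̂γ⇒preserves γ γ⁻¹ γγ⁻¹-cancel (λ {v} → L̂⊆L̂γ {v})
      μ≡1 : μ ≡ 1ℚ
      μ≡1 = stabilizer-similitude≡1 μ⁻¹ γ γ⁻¹ γγ†≡μ μ⁻¹μ≡1 μ≢0 γ⁻¹γ-cancel Lγ⊆L Lγ⁻¹⊆L

  unitary⊆stabilizer : ∀ {γ} → γ ∈ (SU₂ ∩ conjugateBy D G (GL₂[_] D 𝒪)) →
    γ ∈ GU₂ × A.bcᴹ γ ∈ 𝔸.GU₂ × (hat L 𝔸.·ₗ A.bcᴹ γ) ≐ hat L
  unitary⊆stabilizer {γ} (γγ†≈1 , h , (h∈𝒪 , h⁻¹ , h⁻¹∈𝒪 , h⁻¹h≈1 , _) , γ≈) =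
      (1ℚ , (1ℚ , refl , refl) , γγ†≈1)
    , (embed 1ℚ , (embed 1ℚ , 1*1≈1 , 1*1≈1) , A.bc-similitude {1ℚ} γ (≈⇒≗ₘ {γ M.* (γ †)} {diagonal (scalar 1ℚ)} γγ†≈1))
    , (λ {v} → preserves⇒L̂γ⊆L̂ γ (conjugated-preserves γ h γ≗ h∈𝒪) {v})
    , (λ {v} → preserves⇒L̂⊆L̂γ γ γ⁻¹ cancel (conjugated-preserves γ⁻¹ h⁻¹ (λ _ _ → refl) h⁻¹∈𝒪) {v})
    where
    open AdeleRing 𝒜 using (embed; embed-1; embed-*; _≈_; _*ᴬ_; 1#)
    module K = RationalAlgebra (AdeleRing.algebra 𝒜)
    1*1≈1 : embed 1ℚ *ᴬ embed 1ℚ ≈ 1#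
    1*1≈1 = K.trans (K.sym (embed-* 1ℚ 1ℚ)) embed-1
    γ≗ : γ ≗ₘ g⁻¹ M.* h M.* g
    γ≗ = ≈⇒≗ₘ {γ} {g⁻¹ M.* h M.* g} γ≈
    -- Taken as g⁻¹ h⁻¹ g instead of γ†, so that integrality of h⁻¹ shows at once that it preserves
    -- L.
    γ⁻¹ : Matrix
    γ⁻¹ = g⁻¹ M.* h⁻¹ M.* g
    cancel : ∀ u → (u · γ⁻¹) · γ ≗ u
    cancel u i = trans (·-congˡ (u · γ⁻¹) {γ} {g⁻¹ M.* h M.* g} γ≗ i)
      (conjugated-cancel h h⁻¹ (≈⇒≗ₘ {h⁻¹ M.* h} {M.1#} h⁻¹h≈1) u i)

-- Its `extension` unfolds to `Adelic.extension`, so statements about the abstract adele ring are,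
-- up to computation, statements about `U₂`.
finiteAdeles : AdeleRing
finiteAdeles = record
  { algebra = record
    { commutativeRing = F.commutativeRing
    ; embed           = F.embed
    ; embed-+         = F.embed-+
    ; embed-*         = F.embed-*
    ; embed-neg       = F.embed-neg
    ; embed-0         = F.≈-refl {F.embed 0ℚ}
    ; embed-1         = F.≈-refl {F.embed 1ℚ}
    }
  ; Λ                  = Adelic.ℤ̂
  ; integral           = Adelic.integral
  ; constant           = Adelic.fromℤ
  ; _⊞_                = Adelic._⊞_
  ; _⊠_                = Adelic._⊠_
  ; integral-⊞         = λ x y → F.≈-pointwise (RawRing._+_ Adelic.fractions (Adelic.integral x) (Adelic.integral y))
      (Adelic.integral (x Adelic.⊞ y)) λ n → drop-1 (Adelic.residue x n) (Adelic.residue y n)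
  ; integral-⊠         = λ x y → F.≈-refl {Adelic.integral (x Adelic.⊠ y)}
  ; embed-constant     = λ z → F.≈-refl {Adelic.integral (Adelic.fromℤ z)}
  ; residue            = Adelic.residue
  ; residue-⊞          = λ _ _ _ → refl
  ; residue-⊠          = λ _ _ _ → refl
  ; residue-constant   = λ _ _ → refl
  ; integral-injective = λ x y x≈y n → subst (+ (n !) ∣_) (drop-1′ (Adelic.residue x n) (Adelic.residue y n)) (x≈y n)
  }
  where
  module F = Fractions
  drop-1 : ∀ x y → (x ℤ.* 1ℤ ℤ.+ y ℤ.* 1ℤ) ℤ.* 1ℤ ≡ (x ℤ.+ y) ℤ.* 1ℤ
  drop-1 = solve-∀
  drop-1′ : ∀ x y → x ℤ.* 1ℤ ℤ.- y ℤ.* 1ℤ ≡ x ℤ.- y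
  drop-1′ = solve-∀

theorem5p1 : (p : ℕ) (p-prime : Prime p)
    (D : QuaternionAlgebra) → RamifiedExactlyAt-∞-and D p p-prime →
    (𝒪 : Pred (Rational.Quaternion D) 0ℓ) → IsMaximalOrder D 𝒪 →
    (g : GL₂ D) → NonPrincipal D p 𝒪 (proj₁ g) →
    Γ⁽²⁾ D 𝒪 g ≐ (Rational.SU₂ D ∩ conjugateBy D g (GL₂[_] D 𝒪))
theorem5p1 p p-prime D ramified 𝒪 (isOrder , _) G _ =
    (λ {γ} (γ∈GU₂ , _ , stable) → stabilizer⊆unitary (RealQuaternions.a-negative D ramified-∞) (RealQuaternions.b-negative D ramified-∞) {γ} γ∈GU₂ stable)
  , (λ {γ} γ∈ → unitary⊆stabilizer {γ} γ∈)
  where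
  open Lattice D finiteAdeles isOrder G

  -- This is definiteness: the real quaternions form a division ring, from which the signs of both
  -- structure constants follow.
  ramified-∞ : RamifiedAt D infinite
  ramified-∞ = Equivalence.from (ramified infinite) (inj₂ refl)
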